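{- Let $q$ be a prime power, let $G=\mathrm{PGL}(2,q)$, and let $D$ be a dihedral subgroup of $G$ of order $2(q+1)$. Set \[ A=\{g\in G:\ g^{q+1}=1,\ g^2\neq 1\}. \] Then $A\cdot D=\lambda G$, where $\lambda=q$ if $q$ is even and $\lambda=q-1$ if $q$ is odd.
   Context: For subsets $A,B$ of a finite group $G$ and a natural number $\lambda$, the notation $A\cdot B=\lambda G$ (equivalently $\lambda G=A\cdot B$) means that the multiset $\{ab:\ a\in A,\ b\in B\}$ covers each element of $G$ exactly $\lambda$ times; i.e. for every $g\in G$ there are exactly $\lambda$ pairs $(a,b)\in A\times B$ with $ab=g$. $\mathrm{PGL}(2,q)$ is the quotient of $\mathrm{GL}(2,q)$ by its subgroup of scalar matrices. A dihedral group of order $2n$ is the group $\langle x,y \mid x^n=y^2=1,\ yxy^{ -1}=x^{ -1}\rangle$. -}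

module Defs where

open import Level using (Level; _⊔_; 0ℓ) renaming (suc to lsuc)
open import Algebra.Bundles using (CommutativeRing; Group; Monoid; RawMonoid)
open import Algebra.Apartness.Bundles using (HeytingField)
import Algebra.Definitions
import Algebra.Definitions.RawMonoid
open import Algebra.Morphism.Structures using (module GroupMorphisms)
import Algebra.Properties.Group as GroupProperties
import Algebra.Solver.Ring.NaturalCoefficients.Default as SemiringSolver
open import Data.Fin.Base using (Fin)
open import Data.Nat.Base using (ℕ; suc; _≥_)
import Data.Nat.Base as ℕ
open import Data.Nat.Primality using (Prime)
open import Data.Product.Base using (Σ; ∃; ∃-syntax; _×_; _,_; proj₁; proj₂)
open import Data.Product.Relation.Binary.Pointwise.NonDependent using (×-setoid)
open import Function.Bundles using (Inverse)
open import Relation.Binary.Bundles using (Setoid)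
open import Relation.Binary.Core using (Rel)
import Relation.Binary.Construct.On as On
open import Relation.Binary.Definitions using (_Respects_)
open import Relation.Binary.PropositionalEquality.Core using (_≡_)
import Relation.Binary.PropositionalEquality.Properties as ≡
import Relation.Binary.Reasoning.Setoid as SetoidReasoning
open import Relation.Nullary.Negation.Core using (¬_)
open import Relation.Unary using (Pred)

IsPrimePower : ℕ → Set
IsPrimePower q = ∃[ p ] ∃[ k ] Prime p × k ≥ 1 × q ≡ p ℕ.^ k

subsetoid : ∀ {a ℓ p} (S : Setoid a ℓ) → Pred (Setoid.Carrier S) p → Setoid (a ⊔ p) ℓ
subsetoid S P = On.setoid {B = Σ (Setoid.Carrier S) P} S proj₁

-- Elements are counted up to the setoid equality.
HasCardinality : ∀ {a ℓ} → Setoid a ℓ → ℕ → Set (a ⊔ ℓ)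
HasCardinality S n = Inverse (≡.setoid (Fin n)) S

module _ {c ℓ} (M : RawMonoid c ℓ) where

  power : RawMonoid.Carrier M → ℕ → RawMonoid.Carrier M
  power x n = Algebra.Definitions.RawMonoid._×_ M n x

module _ {c ℓ} (M : Monoid c ℓ) where

  open Monoid M
  open Algebra.Definitions _≈_ using (Invertible)

  private
    cancel-middle : ∀ {x x′ y y′} → y ∙ y′ ≈ ε → x ∙ x′ ≈ ε →
                    (x ∙ y) ∙ (y′ ∙ x′) ≈ ε
    cancel-middle {x} {x′} {y} {y′} yy′ xx′ = begin
      (x ∙ y) ∙ (y′ ∙ x′)  ≈⟨ assoc x y (y′ ∙ x′) ⟩
      x ∙ (y ∙ (y′ ∙ x′))  ≈⟨ ∙-congˡ (sym (assoc y y′ x′)) ⟩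
      x ∙ ((y ∙ y′) ∙ x′)  ≈⟨ ∙-congˡ (∙-congʳ yy′) ⟩
      x ∙ (ε ∙ x′)         ≈⟨ ∙-congˡ (identityˡ x′) ⟩
      x ∙ x′               ≈⟨ xx′ ⟩
      ε                    ∎
      where open SetoidReasoning setoid

    inverse-cong : ∀ {x x′ y y′} → x ≈ y → x′ ∙ x ≈ ε → y ∙ y′ ≈ ε → x′ ≈ y′
    inverse-cong {x} {x′} {y} {y′} x≈y x′x yy′ = begin
      x′              ≈⟨ sym (identityʳ x′) ⟩
      x′ ∙ ε          ≈⟨ ∙-congˡ (sym yy′) ⟩
      x′ ∙ (y ∙ y′)   ≈⟨ sym (assoc x′ y y′) ⟩
      (x′ ∙ y) ∙ y′   ≈⟨ ∙-congʳ (∙-congˡ (sym x≈y)) ⟩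
      (x′ ∙ x) ∙ y′   ≈⟨ ∙-congʳ x′x ⟩
      ε ∙ y′          ≈⟨ identityˡ y′ ⟩
      y′              ∎
      where open SetoidReasoning setoid

  unitGroup : Group (c ⊔ ℓ) ℓ
  unitGroup = record
    { Carrier = Σ Carrier (Invertible ε _∙_)
    ; _≈_     = λ u v → proj₁ u ≈ proj₁ v
    ; _∙_     = λ (x , x′ , x′x , xx′) (y , y′ , y′y , yy′) →
                  x ∙ y , y′ ∙ x′ , cancel-middle x′x y′y , cancel-middle yy′ xx′
    ; ε       = ε , ε , identityˡ ε , identityˡ ε
    ; _⁻¹     = λ (x , x′ , x′x , xx′) → x′ , x , xx′ , x′x
    ; isGroup = record
      { isMonoid = record
        { isSemigroup = record
          { isMagma = record
            { isEquivalence = On.isEquivalence proj₁ isEquivalence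
            ; ∙-cong        = ∙-cong
            }
          ; assoc = λ u v w → assoc (proj₁ u) (proj₁ v) (proj₁ w)
          }
        ; identity = (λ u → identityˡ (proj₁ u)) , (λ u → identityʳ (proj₁ u))
        }
      ; inverse = (λ (_ , _ , x′x , _) → x′x) , (λ (_ , _ , _ , xx′) → xx′)
      ; ⁻¹-cong = λ { {_ , _ , x′x , _} {_ , _ , _ , yy′} x≈y → inverse-cong x≈y x′x yy′ }
      }
    }

module _ {c ℓ} (G : Group c ℓ) where

  open Group G

  record Subgroup (p : Level) : Set (c ⊔ ℓ ⊔ lsuc p) where
    field
      Member    : Pred Carrier p
      resp      : Member Respects _≈_
      ε-closed  : Member ε
      ∙-closed  : ∀ {x y} → Member x → Member y → Member (x ∙ y)
      ⁻¹-closed : ∀ {x} → Member x → Member (x ⁻¹)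

  Normal : ∀ {p} → Subgroup p → Set (c ⊔ p)
  Normal N = ∀ g {n} → Member n → Member (g ∙ n ∙ g ⁻¹)
    where open Subgroup N

  subgroupGroup : ∀ {p} → Subgroup p → Group (c ⊔ p) ℓ
  subgroupGroup H = record
    { Carrier = Σ Carrier Member
    ; _≈_     = λ u v → proj₁ u ≈ proj₁ v
    ; _∙_     = λ (x , hx) (y , hy) → x ∙ y , ∙-closed hx hy
    ; ε       = ε , ε-closed
    ; _⁻¹     = λ (x , hx) → x ⁻¹ , ⁻¹-closed hx
    ; isGroup = record
      { isMonoid = record
        { isSemigroup = record
          { isMagma = record
            { isEquivalence = On.isEquivalence proj₁ isEquivalence
            ; ∙-cong        = ∙-cong
            }
          ; assoc = λ u v w → assoc (proj₁ u) (proj₁ v) (proj₁ w)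
          }
        ; identity = (λ u → identityˡ (proj₁ u)) , (λ u → identityʳ (proj₁ u))
        }
      ; inverse = (λ u → inverseˡ (proj₁ u)) , (λ u → inverseʳ (proj₁ u))
      ; ⁻¹-cong = ⁻¹-cong
      }
    }
    where open Subgroup H

  -- The quotient keeps the carrier of G; x and y are identified when xN = yN.
  quotientGroup : ∀ {p} (N : Subgroup p) → Normal N → Group c p
  quotientGroup N normal = record
    { Carrier = Carrier
    ; _≈_     = _∼_
    ; _∙_     = _∙_
    ; ε       = ε
    ; _⁻¹     = _⁻¹
    ; isGroup = record
      { isMonoid = record
        { isSemigroup = record
          { isMagma = record
            { isEquivalence = record
              { refl  = ≈⇒∼ refl
              ; sym   = ∼-sym
              ; trans = ∼-trans
              }
            ; ∙-cong = ∼-∙-cong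
            }
          ; assoc = λ x y z → ≈⇒∼ (assoc x y z)
          }
        ; identity = (λ x → ≈⇒∼ (identityˡ x)) , (λ x → ≈⇒∼ (identityʳ x))
        }
      ; inverse = (λ x → ≈⇒∼ (inverseˡ x)) , (λ x → ≈⇒∼ (inverseʳ x))
      ; ⁻¹-cong = ∼-⁻¹-cong
      }
    }
    where
    open Subgroup N
    open GroupProperties G
    open SetoidReasoning setoid

    _∼_ : Rel Carrier _
    x ∼ y = Member (x ⁻¹ ∙ y)

    ≈⇒∼ : ∀ {x y} → x ≈ y → x ∼ y
    ≈⇒∼ {x} x≈y = resp (trans (sym (inverseˡ x)) (∙-congˡ x≈y)) ε-closed

    flip-inverse : ∀ x y → (x ⁻¹ ∙ y) ⁻¹ ≈ y ⁻¹ ∙ x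
    flip-inverse x y = trans (⁻¹-anti-homo-∙ (x ⁻¹) y) (∙-congˡ (⁻¹-involutive x))

    ∼-sym : ∀ {x y} → x ∼ y → y ∼ x
    ∼-sym {x} {y} x∼y = resp (flip-inverse x y) (⁻¹-closed x∼y)

    ∼-trans : ∀ {x y z} → x ∼ y → y ∼ z → x ∼ z
    ∼-trans {x} {y} {z} x∼y y∼z = resp eq (∙-closed x∼y y∼z)
      where
      eq : (x ⁻¹ ∙ y) ∙ (y ⁻¹ ∙ z) ≈ x ⁻¹ ∙ z
      eq = begin
        (x ⁻¹ ∙ y) ∙ (y ⁻¹ ∙ z)  ≈⟨ assoc (x ⁻¹) y (y ⁻¹ ∙ z) ⟩
        x ⁻¹ ∙ (y ∙ (y ⁻¹ ∙ z))  ≈⟨ ∙-congˡ (\\-leftDividesˡ y z) ⟩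
        x ⁻¹ ∙ z                 ∎

    conj : ∀ g {n} → Member n → Member (g ⁻¹ ∙ n ∙ g)
    conj g h = resp (∙-congˡ (⁻¹-involutive g)) (normal (g ⁻¹) h)

    ∼-∙-cong : ∀ {x y u v} → x ∼ y → u ∼ v → (x ∙ u) ∼ (y ∙ v)
    ∼-∙-cong {x} {y} {u} {v} x∼y u∼v = resp eq (∙-closed (conj u x∼y) u∼v)
      where
      eq : (u ⁻¹ ∙ (x ⁻¹ ∙ y) ∙ u) ∙ (u ⁻¹ ∙ v) ≈ (x ∙ u) ⁻¹ ∙ (y ∙ v)
      eq = begin
        (u ⁻¹ ∙ (x ⁻¹ ∙ y) ∙ u) ∙ (u ⁻¹ ∙ v)  ≈⟨ assoc _ u _ ⟩
        (u ⁻¹ ∙ (x ⁻¹ ∙ y)) ∙ (u ∙ (u ⁻¹ ∙ v)) ≈⟨ ∙-congˡ (\\-leftDividesˡ u v) ⟩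
        (u ⁻¹ ∙ (x ⁻¹ ∙ y)) ∙ v               ≈⟨ ∙-congʳ (sym (assoc (u ⁻¹) (x ⁻¹) y)) ⟩
        ((u ⁻¹ ∙ x ⁻¹) ∙ y) ∙ v               ≈⟨ ∙-congʳ (∙-congʳ (sym (⁻¹-anti-homo-∙ x u))) ⟩
        ((x ∙ u) ⁻¹ ∙ y) ∙ v                  ≈⟨ assoc ((x ∙ u) ⁻¹) y v ⟩
        (x ∙ u) ⁻¹ ∙ (y ∙ v)                  ∎

    ∼-⁻¹-cong : ∀ {x y} → x ∼ y → (x ⁻¹) ∼ (y ⁻¹)
    ∼-⁻¹-cong {x} {y} x∼y = resp eq (normal x (∼-sym x∼y))
      where
      eq : x ∙ (y ⁻¹ ∙ x) ∙ x ⁻¹ ≈ (x ⁻¹) ⁻¹ ∙ y ⁻¹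
      eq = begin
        x ∙ (y ⁻¹ ∙ x) ∙ x ⁻¹    ≈⟨ ∙-congʳ (sym (assoc x (y ⁻¹) x)) ⟩
        x ∙ y ⁻¹ ∙ x ∙ x ⁻¹      ≈⟨ //-rightDividesʳ x (x ∙ y ⁻¹) ⟩
        x ∙ y ⁻¹                 ≈⟨ ∙-congʳ (sym (⁻¹-involutive x)) ⟩
        (x ⁻¹) ⁻¹ ∙ y ⁻¹         ∎

data Word {x} (X : Set x) : Set x where
  gen : X → Word X
  one : Word X
  _·_ : Word X → Word X → Word X
  inv : Word X → Word X

infixl 7 _·_

wordMonoid : ∀ {x} → Set x → RawMonoid x x
wordMonoid X = record { Carrier = Word X ; _≈_ = _≡_ ; _∙_ = _·_ ; ε = one }

-- The least group congruence on words containing the defining relations R.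
data Congruence {x r} {X : Set x} (R : Rel (Word X) r) : Rel (Word X) (x ⊔ r) where
  relation    : ∀ {u v} → R u v → Congruence R u v
  ~-refl      : ∀ {u} → Congruence R u u
  ~-sym       : ∀ {u v} → Congruence R u v → Congruence R v u
  ~-trans     : ∀ {u v w} → Congruence R u v → Congruence R v w → Congruence R u w
  ~-·-cong    : ∀ {u u′ v v′} → Congruence R u u′ → Congruence R v v′ →
                Congruence R (u · v) (u′ · v′)
  ~-inv-cong  : ∀ {u v} → Congruence R u v → Congruence R (inv u) (inv v)
  ~-assoc     : ∀ u v w → Congruence R ((u · v) · w) (u · (v · w))
  ~-identityˡ : ∀ u → Congruence R (one · u) u
  ~-identityʳ : ∀ u → Congruence R (u · one) u
  ~-inverseˡ  : ∀ u → Congruence R (inv u · u) one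
  ~-inverseʳ  : ∀ u → Congruence R (u · inv u) one

⟨_∣_⟩ : ∀ {x r} (X : Set x) → Rel (Word X) r → Group x (x ⊔ r)
⟨ X ∣ R ⟩ = record
  { Carrier = Word X
  ; _≈_     = Congruence R
  ; _∙_     = _·_
  ; ε       = one
  ; _⁻¹     = inv
  ; isGroup = record
    { isMonoid = record
      { isSemigroup = record
        { isMagma = record
          { isEquivalence = record { refl = ~-refl ; sym = ~-sym ; trans = ~-trans }
          ; ∙-cong        = ~-·-cong
          }
        ; assoc = ~-assoc
        }
      ; identity = ~-identityˡ , ~-identityʳ
      }
    ; inverse = ~-inverseˡ , ~-inverseʳ
    ; ⁻¹-cong = ~-inv-cong
    }
  }

data DihedralGenerator : Set where
  genX genY : DihedralGenerator

data DihedralRelation (n : ℕ) : Rel (Word DihedralGenerator) 0ℓ where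
  xⁿ≈1      : DihedralRelation n (power (wordMonoid DihedralGenerator) (gen genX) n) one
  y²≈1      : DihedralRelation n (power (wordMonoid DihedralGenerator) (gen genY) 2) one
  yxy⁻¹≈x⁻¹ : DihedralRelation n (gen genY · gen genX · inv (gen genY)) (inv (gen genX))

-- The dihedral group of order 2n (for n ≥ 1).
Dihedral : ℕ → Group 0ℓ 0ℓ
Dihedral n = ⟨ DihedralGenerator ∣ DihedralRelation n ⟩

Isomorphic : ∀ {a ℓ₁ b ℓ₂} → Group a ℓ₁ → Group b ℓ₂ → Set (a ⊔ b ⊔ ℓ₁ ⊔ ℓ₂)
Isomorphic G H = ∃ (GroupMorphisms.IsGroupIsomorphism (Group.rawGroup G) (Group.rawGroup H))

module _ {c ℓ} (G : Group c ℓ) where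

  open Group G

  Factorization : ∀ {a b} → Pred Carrier a → Pred Carrier b → Carrier →
                  Pred (Carrier × Carrier) (a ⊔ b ⊔ ℓ)
  Factorization A B g (a , b) = A a × B b × a ∙ b ≈ g

  CoversExactly : ∀ {a b} → Pred Carrier a → Pred Carrier b → ℕ → Set (a ⊔ b ⊔ c ⊔ ℓ)
  CoversExactly A B n =
    ∀ g → HasCardinality (subsetoid (×-setoid setoid setoid) (Factorization A B g)) n

module _ {c ℓ} (R : CommutativeRing c ℓ) where

  private module R = CommutativeRing R
  open R using (Carrier; _≈_; _+_; _*_; 0#; 1#)

  record Mat₂ : Set c where
    constructor mat
    field
      m₁₁ m₁₂ m₂₁ m₂₂ : Carrier

  open Mat₂

  record _≈ᴹ_ (M N : Mat₂) : Set ℓ where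
    constructor mat≈
    field
      eq₁₁ : m₁₁ M ≈ m₁₁ N
      eq₁₂ : m₁₂ M ≈ m₁₂ N
      eq₂₁ : m₂₁ M ≈ m₂₁ N
      eq₂₂ : m₂₂ M ≈ m₂₂ N

  _*ᴹ_ : Mat₂ → Mat₂ → Mat₂
  mat a b c d *ᴹ mat a′ b′ c′ d′ =
    mat (a * a′ + b * c′) (a * b′ + b * d′)
        (c * a′ + d * c′) (c * b′ + d * d′)

  scalarMat : Carrier → Mat₂
  scalarMat s = mat s 0# 0# s

  private
    open SemiringSolver R.commutativeSemiring using (solve; _:+_; _:*_; _:=_; con)

    assoc-entry : ∀ a b e f g h i k →
      (a * e + b * g) * i + (a * f + b * h) * k ≈ a * (e * i + f * k) + b * (g * i + h * k)
    assoc-entry = solve 8 (λ a b e f g h i k →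
      (a :* e :+ b :* g) :* i :+ (a :* f :+ b :* h) :* k :=
      a :* (e :* i :+ f :* k) :+ b :* (g :* i :+ h :* k)) R.refl

    scale₁ : ∀ s a b → s * a + 0# * b ≈ s * a
    scale₁ = solve 3 (λ s a b → s :* a :+ con 0 :* b := s :* a) R.refl

    scale₂ : ∀ s a b → 0# * a + s * b ≈ s * b
    scale₂ = solve 3 (λ s a b → con 0 :* a :+ s :* b := s :* b) R.refl

    scale₃ : ∀ s a b → a * s + b * 0# ≈ s * a
    scale₃ = solve 3 (λ s a b → a :* s :+ b :* con 0 := s :* a) R.refl

    scale₄ : ∀ s a b → a * 0# + b * s ≈ s * b
    scale₄ = solve 3 (λ s a b → a :* con 0 :+ b :* s := s :* b) R.refl

    scalar-comm : ∀ s M → (scalarMat s *ᴹ M) ≈ᴹ (M *ᴹ scalarMat s)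
    scalar-comm s (mat a b c d) = mat≈
      (R.trans (scale₁ s a c) (R.sym (scale₃ s a b)))
      (R.trans (scale₁ s b d) (R.sym (scale₄ s a b)))
      (R.trans (scale₂ s a c) (R.sym (scale₃ s c d)))
      (R.trans (scale₂ s b d) (R.sym (scale₄ s c d)))

  Mat₂-monoid : Monoid c ℓ
  Mat₂-monoid = record
    { Carrier  = Mat₂
    ; _≈_      = _≈ᴹ_
    ; _∙_      = _*ᴹ_
    ; ε        = scalarMat 1#
    ; isMonoid = record
      { isSemigroup = record
        { isMagma = record
          { isEquivalence = record
            { refl  = mat≈ R.refl R.refl R.refl R.refl
            ; sym   = λ (mat≈ p q r s) → mat≈ (R.sym p) (R.sym q) (R.sym r) (R.sym s)
            ; trans = λ (mat≈ p q r s) (mat≈ p′ q′ r′ s′) →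
                mat≈ (R.trans p p′) (R.trans q q′) (R.trans r r′) (R.trans s s′)
            }
          ; ∙-cong = λ (mat≈ p q r s) (mat≈ p′ q′ r′ s′) → mat≈
              (R.+-cong (R.*-cong p p′) (R.*-cong q r′))
              (R.+-cong (R.*-cong p q′) (R.*-cong q s′))
              (R.+-cong (R.*-cong r p′) (R.*-cong s r′))
              (R.+-cong (R.*-cong r q′) (R.*-cong s s′))
          }
        ; assoc = λ (mat a b c d) (mat e f g h) (mat i j k l) → mat≈
            (assoc-entry a b e f g h i k)
            (assoc-entry a b e f g h j l)
            (assoc-entry c d e f g h i k)
            (assoc-entry c d e f g h j l)
        }
      ; identity = idˡ , λ M → M-trans (scalar-comm′ M) (idˡ M)
      }
    }
    where
    M-trans : ∀ {L M N} → L ≈ᴹ M → M ≈ᴹ N → L ≈ᴹ N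
    M-trans (mat≈ p q r s) (mat≈ p′ q′ r′ s′) =
      mat≈ (R.trans p p′) (R.trans q q′) (R.trans r r′) (R.trans s s′)

    idˡ : ∀ M → (scalarMat 1# *ᴹ M) ≈ᴹ M
    idˡ (mat a b c d) = mat≈
      (R.trans (scale₁ 1# a c) (R.*-identityˡ a))
      (R.trans (scale₁ 1# b d) (R.*-identityˡ b))
      (R.trans (scale₂ 1# a c) (R.*-identityˡ c))
      (R.trans (scale₂ 1# b d) (R.*-identityˡ d))

    scalar-comm′ : ∀ M → (M *ᴹ scalarMat 1#) ≈ᴹ (scalarMat 1# *ᴹ M)
    scalar-comm′ M with scalar-comm 1# M
    ... | mat≈ p q r s = mat≈ (R.sym p) (R.sym q) (R.sym r) (R.sym s)

  GL₂ : Group (c ⊔ ℓ) ℓ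
  GL₂ = unitGroup Mat₂-monoid

  private
    module M = Monoid Mat₂-monoid
    module GL = Group GL₂

  IsScalar : Pred GL.Carrier (c ⊔ ℓ)
  IsScalar g = ∃[ s ] proj₁ g ≈ᴹ scalarMat s

  private
    scalar-* : ∀ s t → (scalarMat s *ᴹ scalarMat t) ≈ᴹ scalarMat (s * t)
    scalar-* s t = mat≈
      (scale₁ s t 0#)
      (R.trans (scale₁ s 0# t) (R.zeroʳ s))
      (R.trans (scale₂ s t 0#) (R.zeroʳ s))
      (scale₂ s 0# t)

    -- If MN = I with M = sI, then s·n₁₁ = 1 and so N = n₁₁ I.
    scalar-inverse : ∀ s M N → M ≈ᴹ scalarMat s → (M *ᴹ N) ≈ᴹ scalarMat 1# →
                     N ≈ᴹ scalarMat (m₁₁ N)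
    scalar-inverse s M N@(mat a b c d) M≈s MN≈1 = mat≈
      R.refl
      (cancel (R.trans (R.sym (scale₁ s b d)) e₁₂))
      (cancel (R.trans (R.sym (scale₂ s a c)) e₂₁))
      (R.trans (R.sym (R.*-identityˡ d))
        (R.trans (R.*-congʳ (R.sym as≈1))
          (R.trans (R.*-assoc a s d)
            (R.trans (R.*-congˡ sd≈1) (R.*-identityʳ a)))))
      where
      sN≈1 : (scalarMat s *ᴹ N) ≈ᴹ scalarMat 1#
      sN≈1 = M.trans (M.∙-congʳ {N} (M.sym M≈s)) MN≈1

      open _≈ᴹ_ sN≈1 renaming (eq₁₁ to e₁₁; eq₁₂ to e₁₂; eq₂₁ to e₂₁; eq₂₂ to e₂₂)

      as≈1 : a * s ≈ 1#
      as≈1 = R.trans (R.*-comm a s) (R.trans (R.sym (scale₁ s a c)) e₁₁)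

      sd≈1 : s * d ≈ 1#
      sd≈1 = R.trans (R.sym (scale₂ s b d)) e₂₂

      cancel : ∀ {t} → s * t ≈ 0# → t ≈ 0#
      cancel {t} st≈0 =
        R.trans (R.sym (R.*-identityˡ t))
          (R.trans (R.*-congʳ (R.sym as≈1))
            (R.trans (R.*-assoc a s t)
              (R.trans (R.*-congˡ st≈0) (R.zeroʳ a))))

  scalars : Subgroup GL₂ (c ⊔ ℓ)
  scalars = record
    { Member    = IsScalar
    ; resp      = λ g≈h (s , g≈s) → s , M.trans (M.sym g≈h) g≈s
    ; ε-closed  = 1# , M.refl
    ; ∙-closed  = λ (s , g≈s) (t , h≈t) →
        s * t , M.trans (M.∙-cong g≈s h≈t) (scalar-* s t)
    ; ⁻¹-closed = λ { {M , N , _ , MN≈1} (s , M≈s) → m₁₁ N , scalar-inverse s M N M≈s MN≈1 }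
    }

  scalars-normal : Normal GL₂ scalars
  scalars-normal g@(P , P′ , _ , PP′≈1) {n , _} (s , n≈s) = s , (begin
    (P *ᴹ n) *ᴹ P′            ≈⟨ M.∙-congʳ (M.∙-congˡ {P} n≈s) ⟩
    (P *ᴹ scalarMat s) *ᴹ P′  ≈⟨ M.∙-congʳ (M.sym (scalar-comm s P)) ⟩
    (scalarMat s *ᴹ P) *ᴹ P′  ≈⟨ M.assoc (scalarMat s) P P′ ⟩
    scalarMat s *ᴹ (P *ᴹ P′)  ≈⟨ M.∙-congˡ {scalarMat s} PP′≈1 ⟩
    scalarMat s *ᴹ scalarMat 1# ≈⟨ M.identityʳ (scalarMat s) ⟩
    scalarMat s               ∎)
    where open SetoidReasoning M.setoid

  PGL₂ : Group (c ⊔ ℓ) (c ⊔ ℓ)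
  PGL₂ = quotientGroup GL₂ scalars scalars-normal

-- Over a finite carrier both _≈_ and _#_ are decidable, so that _#_ is the
-- negation of _≈_ and a Heyting field is a field in the usual sense.
record FiniteField (c ℓ₁ ℓ₂ : Level) (q : ℕ) : Set (lsuc (c ⊔ ℓ₁ ⊔ ℓ₂)) where
  field
    heytingField : HeytingField c ℓ₁ ℓ₂

  open HeytingField heytingField public

  commutativeRing : CommutativeRing c ℓ₁
  commutativeRing = record { isCommutativeRing = isCommutativeRing }

  field
    cardinality : HasCardinality (CommutativeRing.setoid commutativeRing) q

PGL[2,_] : ∀ {c ℓ₁ ℓ₂ q} → FiniteField c ℓ₁ ℓ₂ q → Group (c ⊔ ℓ₁) (c ⊔ ℓ₁)
PGL[2, F ] = PGL₂ (FiniteField.commutativeRing F)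

module _ {c ℓ} (G : Group c ℓ) where

  open Group G

  SetA : ℕ → Pred Carrier ℓ
  SetA q g = power rawMonoid g (suc q) ≈ ε × ¬ power rawMonoid g 2 ≈ ε

{-# OPTIONS --safe #-}

-- Writing b = h⁻¹, one has to count the h ∈ D with gh ∈ A.
--
-- For a non-scalar matrix M whose characteristic polynomial has r roots in F, the group F[M]ˣ / Fˣ has
-- q + 1 − r elements; by Lagrange, A consists of the matrices with nonzero trace and r = 0.
--
-- A generator X of the cyclic part of D has q + 1 distinct powers, so they exhaust the projective line
-- of F[X], and F[X] is a field.  For Y ∈ D inverting X, the set gD therefore consists of the two pencils
-- g(u + vX) and g(u + vX)Y, whose nonzero members are invertible.  In such a pencil exactly one member
-- fixes a given point of the projective line; hence, unless it contains a scalar, the numbers r of its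
-- members add up to q + 1.  Each pencil has one traceless member.  In characteristic 2 it is the only
-- member with r = 1; in odd characteristic, the members of one pencil with r = 1 correspond to the
-- eigenvalues of the traceless member of the other.  In both cases the corrections cancel in the sum.

module Submission where

open import Defs
open import Level using (Level; _⊔_)
open import Algebra.Bundles using (CommutativeMonoid; CommutativeRing; Group; Monoid)
open import Algebra.Morphism.Structures using (module GroupMorphisms)
import Algebra.Properties.CommutativeMonoid.Sum as MonoidSum
import Algebra.Properties.Group as GroupProperties
import Algebra.Properties.Monoid.Mult as Mult
import Algebra.Properties.Ring as RingProperties
import Algebra.Properties.Semiring.Mult as SemiringMult
import Algebra.Solver.Ring
open import Algebra.Solver.Ring.AlmostCommutativeRing using (fromCommutativeRing; _-Raw-AlmostCommutative⟶_)
open import Data.Fin.Base as Fin using (Fin; zero; suc; toℕ; _↑ˡ_; _↑ʳ_)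
open import Data.Fin.Permutation using (Permutation; permutation)
import Data.Fin.Properties as Fin
open import Data.Integer.Base as ℤ using (ℤ; +_; -[1+_]; _⊖_)
import Data.Integer.Properties as ℤ
open import Data.Maybe.Base using (Maybe; just; nothing)
open import Data.Nat.Base as ℕ using (ℕ; zero; suc)
open import Data.Nat.Divisibility using (_∣_; divides; ∣1⇒≡1)
open import Data.Nat.DivMod using (_divMod_; result)
open import Data.Nat.Primality using (Prime; euclidsLemma; prime[2]; prime⇒irreducible)
import Data.Nat.Properties as ℕ
open import Data.Nat.Solver using (module +-*-Solver)
open import Data.Product.Base using (∃-syntax; _×_; _,_; proj₁; proj₂)
open import Data.Product.Relation.Binary.Pointwise.NonDependent using (×-setoid)
open import Data.Sum.Base using (_⊎_; inj₁; inj₂; [_,_]′)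
open import Function.Base using (_∘_; id)
open import Function.Bundles using (Inverse)
open import Function.Definitions using (Injective)
open import Relation.Binary.Bundles using (Setoid)
import Relation.Binary.Definitions as Binary
open import Relation.Binary.PropositionalEquality as ≡ using (_≡_; _≢_)
import Relation.Binary.Reasoning.Setoid as SetoidReasoning
open import Relation.Nullary using (Dec; yes; no; contradiction; _×-dec_)
open import Relation.Nullary.Negation.Core using (¬_)
import Relation.Nullary.Decidable as Dec
open import Relation.Unary using (Pred; Decidable)

-- In odd characteristic the equation for one pencil contains two unknown corrections: the number of
-- eigenvalues of the traceless member, and the number of members with r = 1. One polynomial
-- identity, `dual-relation`, removes both from the sum. Let N(u, v) = u² + tuv + dv² be the norm
-- form of F[X], and let a pencil have determinant δN and trace pu + rv. Its traceless member sits
-- at (r, -p), so it has determinant δN(r, -p) up to a square. The discriminant (pu + rv)² - 4δN is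
-- the form of a traceless matrix of determinant -4δ(N(r, -p) + δ(t² - 4d)). The two pencils have δ
-- = Δ and δ = -Δ for Δ = det g, and N(r₂, -p₂) = N(r₁, -p₁) + Δ(t² - 4d) identifies the second
-- quantity of each pencil with the first one of the other, up to squares.
--
-- A pencil contains a scalar exactly when the trace form of the other pencil vanishes identically.
-- That other pencil then contributes nothing, and the scalar, which fixes every point, leaves no
-- fixed point to the remaining members of its own pencil.

private
  variable
    ℓᵃ ℓᵖ ℓᵖ′ : Level
    m n : ℕ

-- Counting over finite index types

open MonoidSum ℕ.+-0-commutativeMonoid using (sum; sum-cong-≗; ∑-distrib-+; ∑-comm; sum-permute)

indicator : {A : Set ℓᵃ} → Dec A → ℕ
indicator (yes _) = 1
indicator (no _)  = 0

indicator-yes : {A : Set ℓᵃ} (A? : Dec A) → A → indicator A? ≡ 1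
indicator-yes (yes _) _ = ≡.refl
indicator-yes (no ¬x) x = contradiction x ¬x

indicator-no : {A : Set ℓᵃ} (A? : Dec A) → ¬ A → indicator A? ≡ 0
indicator-no (yes x) ¬x = contradiction x ¬x
indicator-no (no _)  _  = ≡.refl

indicator-⇔ : {A : Set ℓᵃ} {B : Set ℓᵖ} (A? : Dec A) (B? : Dec B) →
              (A → B) → (B → A) → indicator A? ≡ indicator B?
indicator-⇔ (yes x) B? f g = ≡.sym (indicator-yes B? (f x))
indicator-⇔ (no ¬x) B? f g = ≡.sym (indicator-no B? (¬x ∘ g))

count : {P : Pred (Fin n) ℓᵖ} → Decidable P → ℕ
count P? = sum (indicator ∘ P?)

count-⇔ : {P : Pred (Fin n) ℓᵖ} {Q : Pred (Fin n) ℓᵖ′} (P? : Decidable P) (Q? : Decidable Q) →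
          (∀ i → P i → Q i) → (∀ i → Q i → P i) → count P? ≡ count Q?
count-⇔ P? Q? f g = sum-cong-≗ (λ i → indicator-⇔ (P? i) (Q? i) (f i) (g i))

sum-const : ∀ n k → sum {n} (λ _ → k) ≡ n ℕ.* k
sum-const zero    k = ≡.refl
sum-const (suc n) k = ≡.cong (k ℕ.+_) (sum-const n k)

sum-*ʳ : ∀ {n} (f : Fin n → ℕ) k → sum (λ i → f i ℕ.* k) ≡ sum f ℕ.* k
sum-*ʳ {zero}  f k = ≡.refl
sum-*ʳ {suc n} f k = ≡.trans (≡.cong (f zero ℕ.* k ℕ.+_) (sum-*ʳ (f ∘ suc) k))
                           (≡.sym (ℕ.*-distribʳ-+ k (f zero) (sum (f ∘ suc))))

count-none : {P : Pred (Fin n) ℓᵖ} (P? : Decidable P) → (∀ i → ¬ P i) → count P? ≡ 0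
count-none {n} P? ¬P = ≡.trans (sum-cong-≗ (λ i → indicator-no (P? i) (¬P i)))
                         (≡.trans (sum-const n 0) (ℕ.*-zeroʳ n))

count≡0⇒none : {P : Pred (Fin n) ℓᵖ} (P? : Decidable P) → count P? ≡ 0 → ∀ i → ¬ P i
count≡0⇒none {n = suc n} P? eq i Pi with P? zero
count≡0⇒none {n = suc n} P? eq zero    Pi | no ¬P0 = ¬P0 Pi
count≡0⇒none {n = suc n} P? eq (suc i) Pi | no _   = count≡0⇒none (P? ∘ suc) eq i Pi

count-unique : {P : Pred (Fin n) ℓᵖ} (P? : Decidable P) →
               ∀ i → P i → (∀ j → P j → j ≡ i) → count P? ≡ 1
count-unique P? zero Pi unique = ≡.cong₂ ℕ._+_ (indicator-yes (P? zero) Pi)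
  (count-none (P? ∘ suc) (λ j Pj → contradiction (unique (suc j) Pj) λ ()))
count-unique P? (suc i) Pi unique = ≡.cong₂ ℕ._+_
  (indicator-no (P? zero) (λ P0 → contradiction (unique zero P0) λ ()))
  (count-unique (P? ∘ suc) i Pi (λ j Pj → Fin.suc-injective (unique (suc j) Pj)))

count-two : {P : Pred (Fin n) ℓᵖ} (P? : Decidable P) → ∀ {i j} → i ≢ j → P i → P j →
            (∀ k → P k → k ≡ i ⊎ k ≡ j) → count P? ≡ 2
count-two P? {i} {j} i≢j Pi Pj only = begin
  count P?                                          ≡⟨ sum-cong-≗ split ⟩
  sum (λ k → indicator (k Fin.≟ i) ℕ.+ indicator (k Fin.≟ j))
                                                    ≡⟨ ∑-distrib-+ (λ k → indicator (k Fin.≟ i)) _ ⟩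
  count (Fin._≟ i) ℕ.+ count (Fin._≟ j)               ≡⟨ ≡.cong₂ ℕ._+_ (count-unique (Fin._≟ i) i ≡.refl (λ _ → id))
                                                                 (count-unique (Fin._≟ j) j ≡.refl (λ _ → id)) ⟩
  2                                                 ∎
  where
  open ≡.≡-Reasoning
  split : ∀ k → indicator (P? k) ≡ indicator (k Fin.≟ i) ℕ.+ indicator (k Fin.≟ j)
  split k with P? k | k Fin.≟ i | k Fin.≟ j
  ... | yes _  | yes ≡.refl | yes ≡.refl = contradiction ≡.refl i≢j
  ... | yes _  | yes _    | no _     = ≡.refl
  ... | yes _  | no _     | yes _    = ≡.refl
  ... | yes Pk | no k≢i   | no k≢j   = contradiction (only k Pk) [ k≢i , k≢j ]′
  ... | no ¬Pk | yes ≡.refl | _        = contradiction Pi ¬Pk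
  ... | no ¬Pk | no _     | yes ≡.refl = contradiction Pj ¬Pk
  ... | no _   | no _     | no _     = ≡.refl

sum-++ : ∀ m {n} (f : Fin (m ℕ.+ n) → ℕ) → sum f ≡ sum (f ∘ (_↑ˡ n)) ℕ.+ sum (f ∘ (m ↑ʳ_))
sum-++ zero    f = ≡.refl
sum-++ (suc m) f = ≡.trans (≡.cong (f zero ℕ.+_) (sum-++ m (f ∘ suc))) (≡.sym (ℕ.+-assoc (f zero) _ _))

select : {P : Pred (Fin n) ℓᵖ} (P? : Decidable P) → Fin (count P?) → Fin n
select {n = suc n} P? k with P? zero
select {n = suc n} P? zero    | yes _ = zero
select {n = suc n} P? (suc k) | yes _ = suc (select (P? ∘ suc) k)
select {n = suc n} P? k       | no _  = suc (select (P? ∘ suc) k)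

select-holds : {P : Pred (Fin n) ℓᵖ} (P? : Decidable P) (k : Fin (count P?)) → P (select P? k)
select-holds {n = suc n} P? k with P? zero
select-holds {n = suc n} P? zero    | yes P0 = P0
select-holds {n = suc n} P? (suc k) | yes _  = select-holds (P? ∘ suc) k
select-holds {n = suc n} P? k       | no _   = select-holds (P? ∘ suc) k

rank : {P : Pred (Fin n) ℓᵖ} (P? : Decidable P) (i : Fin n) → P i → Fin (count P?)
rank {n = suc n} P? i Pi with P? zero
rank {n = suc n} P? zero    Pi | yes _  = zero
rank {n = suc n} P? (suc i) Pi | yes _  = suc (rank (P? ∘ suc) i Pi)
rank {n = suc n} P? zero    Pi | no ¬P0 = contradiction Pi ¬P0
rank {n = suc n} P? (suc i) Pi | no _   = rank (P? ∘ suc) i Pi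

select-rank : {P : Pred (Fin n) ℓᵖ} (P? : Decidable P) (i : Fin n) (Pi : P i) → select P? (rank P? i Pi) ≡ i
select-rank {n = suc n} P? i Pi with P? zero
select-rank {n = suc n} P? zero    Pi | yes _  = ≡.refl
select-rank {n = suc n} P? (suc i) Pi | yes _  = ≡.cong suc (select-rank (P? ∘ suc) i Pi)
select-rank {n = suc n} P? zero    Pi | no ¬P0 = contradiction Pi ¬P0
select-rank {n = suc n} P? (suc i) Pi | no _   = ≡.cong suc (select-rank (P? ∘ suc) i Pi)

select-injective : {P : Pred (Fin n) ℓᵖ} (P? : Decidable P) {k l : Fin (count P?)} →
                   select P? k ≡ select P? l → k ≡ l
select-injective {n = suc n} P? {k} {l} eq with P? zero
select-injective {n = suc n} P? {zero}  {zero}  eq | yes _ = ≡.refl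
select-injective {n = suc n} P? {suc k} {suc l} eq | yes _ =
  ≡.cong suc (select-injective (P? ∘ suc) (Fin.suc-injective eq))
select-injective {n = suc n} P? {k} {l} eq | no _ = select-injective (P? ∘ suc) (Fin.suc-injective eq)

module _ {c ℓ} (S : Setoid c ℓ) {n p} {P : Pred (Fin n) p} (P? : Decidable P) where

  open Setoid S

  -- The round trips are required for every proof of `P`, because the proof returned by
  -- `select-holds` need not be the one that an element of `S` supplies.
  hasCardinality-count :
    (element : ∀ i → P i → Carrier)
    (label : Carrier → Fin n) →
    (∀ {x y} → x ≈ y → label x ≡ label y) →
    (∀ x → P (label x)) →
    (∀ x Pi → element (label x) Pi ≈ x) →
    (∀ i Pi → label (element i Pi) ≡ i) →
    HasCardinality S (count P?)
  hasCardinality-count element label label-cong P-label element-label label-element = record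
    { to        = λ k → element (select P? k) (select-holds P? k)
    ; from      = λ x → rank P? (label x) (P-label x)
    ; to-cong   = λ { ≡.refl → refl }
    ; from-cong = λ x≈y → select-injective P? (≡.trans (select-rank P? _ _)
                    (≡.trans (label-cong x≈y) (≡.sym (select-rank P? _ _))))
    ; inverse   =
        (λ { {x} ≡.refl → element-≡ x (select-rank P? (label x) (P-label x)) _ }) ,
        (λ {k} x≈ → select-injective P? (≡.trans (select-rank P? _ _)
          (≡.trans (label-cong x≈) (label-element (select P? k) (select-holds P? k)))))
    }
    where
    element-≡ : ∀ x {i} → i ≡ label x → ∀ Pi → element i Pi ≈ x
    element-≡ x ≡.refl Pi = element-label x Pi

-- A missed value `j` could be punched out of the codomain, leaving an injection from `Fin (suc n)`
-- into `Fin n`.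
injective⇒surjective : {f : Fin n → Fin n} → Injective _≡_ _≡_ f → ∀ j → ∃[ i ] f i ≡ j
injective⇒surjective {suc n} {f} inj j with Fin.any? (λ i → f i Fin.≟ j)
... | yes hit  = hit
... | no ¬hit = contradiction
  (Fin.injective⇒≤ (λ eq → inj (Fin.punchOut-injective (λ j≡ → ¬hit (_ , ≡.sym j≡)) (λ j≡ → ¬hit (_ , ≡.sym j≡)) eq)))
  ℕ.1+n≰n

-- A section of `f` is injective, hence surjective, hence a two-sided inverse.
surjective⇒injective : {f : Fin n → Fin n} → (∀ j → ∃[ i ] f i ≡ j) → Injective _≡_ _≡_ f
surjective⇒injective {f = f} surj {i} {j} fi≡fj = ≡.trans (≡.sym (g∘f i)) (≡.trans (≡.cong g fi≡fj) (g∘f j))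
  where
  g = proj₁ ∘ surj

  g-injective : Injective _≡_ _≡_ g
  g-injective {x} {y} eq = ≡.trans (≡.sym (proj₂ (surj x))) (≡.trans (≡.cong f eq) (proj₂ (surj y)))

  g∘f : ∀ i → g (f i) ≡ i
  g∘f i with k , ≡.refl ← injective⇒surjective g-injective i = ≡.cong g (proj₂ (surj k))

-- Lagrange's theorem for finite abelian groups

module _ {c ℓ} (G : Group c ℓ) (comm : ∀ x y → Group._≈_ G (Group._∙_ G x y) (Group._∙_ G y x)) where

  open Group G

  private
    commutativeMonoid : CommutativeMonoid c ℓ
    commutativeMonoid = record
      { isCommutativeMonoid = record { isMonoid = isMonoid ; comm = comm } }

    module Π = MonoidSum commutativeMonoid

  -- Multiplication by x permutes the group, hence fixes the product of all elements.
  power-cardinality : ∀ {n} → HasCardinality setoid n → ∀ x → power rawMonoid x n ≈ ε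
  power-cardinality {n} card x = identityˡ-unique _ _ (begin
    power rawMonoid x n ∙ Π.sum to          ≈⟨ ∙-congʳ (Π.sum-replicate n) ⟨
    Π.sum {n} (λ _ → x) ∙ Π.sum to          ≈⟨ Π.∑-distrib-+ (λ _ → x) to ⟨
    Π.sum (λ i → x ∙ to i)                  ≈⟨ Π.sum-cong-≋ (λ i → strictlyInverseˡ (x ∙ to i)) ⟨
    Π.sum (λ i → to (from (x ∙ to i)))      ≈⟨ Π.sum-permute to π ⟨
    Π.sum to                                ∎)
    where
    open Inverse card using (to; from; from-cong; strictlyInverseˡ; strictlyInverseʳ)
    open GroupProperties G
    open SetoidReasoning setoid

    π : Permutation n n
    π = permutation (λ i → from (x ∙ to i)) (λ i → from (x ⁻¹ ∙ to i))
      (λ i → ≡.trans (from-cong (trans (∙-congˡ (strictlyInverseˡ _)) (\\-leftDividesˡ x (to i)))) (strictlyInverseʳ i))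
      (λ i → ≡.trans (from-cong (trans (∙-congˡ (strictlyInverseˡ _)) (\\-leftDividesʳ x (to i)))) (strictlyInverseʳ i))

power-subgroup : ∀ {c ℓ p} (G : Group c ℓ) (S : Subgroup G p) (x : Group.Carrier (subgroupGroup G S)) n →
  proj₁ (power (Group.rawMonoid (subgroupGroup G S)) x n) ≡ power (Group.rawMonoid G) (proj₁ x) n
power-subgroup G S x zero    = ≡.refl
power-subgroup G S x (suc n) = ≡.cong (Group._∙_ G (proj₁ x)) (power-subgroup G S x n)

-- A ring solver with integer coefficients

module IntegerSolver {c ℓ} (R : CommutativeRing c ℓ) where
  open CommutativeRing R hiding (zero)
  open import Algebra.Properties.Ring ring
  open import Algebra.Properties.Semiring.Mult.TCOptimised semiring
    using (×-homo-+; ×1-homo-*; 1+×) renaming (_×_ to _·ⁿ_)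
  open SetoidReasoning setoid

  -- With the optimised multiples, `con (+ 1)` and `con (+ 2)` evaluate to `1#` and `1# + 1#` on the
  -- nose, so solved identities match the terms of the field definitionally.
  fromℤ : ℤ → Carrier
  fromℤ (+ n)    = n ·ⁿ 1#
  fromℤ -[1+ n ] = - (suc n ·ⁿ 1#)

  fromℤ-⊖ : ∀ m n → fromℤ (m ⊖ n) ≈ m ·ⁿ 1# - n ·ⁿ 1#
  fromℤ-⊖ m zero = trans (sym (+-identityʳ _)) (+-congˡ (sym -0#≈0#))
  fromℤ-⊖ zero (suc n) = sym (+-identityˡ _)
  fromℤ-⊖ (suc m) (suc n) = begin
    fromℤ (suc m ⊖ suc n)              ≡⟨ ≡.cong fromℤ (ℤ.[1+m]⊖[1+n]≡m⊖n m n) ⟩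
    fromℤ (m ⊖ n)                      ≈⟨ fromℤ-⊖ m n ⟩
    m ·ⁿ 1# - n ·ⁿ 1#                    ≈⟨ +-congʳ (+-identityʳ _) ⟨
    m ·ⁿ 1# + 0# - n ·ⁿ 1#               ≈⟨ +-congʳ (+-congˡ (-‿inverseʳ 1#)) ⟨
    m ·ⁿ 1# + (1# - 1#) - n ·ⁿ 1#        ≈⟨ +-congʳ (+-assoc _ _ _) ⟨
    m ·ⁿ 1# + 1# - 1# - n ·ⁿ 1#          ≈⟨ +-congʳ (+-congʳ (+-comm _ _)) ⟩
    1# + m ·ⁿ 1# - 1# - n ·ⁿ 1#          ≈⟨ +-assoc _ _ _ ⟩
    1# + m ·ⁿ 1# + (- 1# - n ·ⁿ 1#)      ≈⟨ +-cong (sym (1+× m 1#)) (-‿+-comm _ _) ⟩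
    suc m ·ⁿ 1# - (1# + n ·ⁿ 1#)         ≈⟨ +-congˡ (-‿cong (1+× n 1#)) ⟨
    suc m ·ⁿ 1# - suc n ·ⁿ 1#            ∎

  fromℤ-+ : ∀ i j → fromℤ (i ℤ.+ j) ≈ fromℤ i + fromℤ j
  fromℤ-+ (+ m) (+ n) = ×-homo-+ 1# m n
  fromℤ-+ (+ m) -[1+ n ] = fromℤ-⊖ m (suc n)
  fromℤ-+ -[1+ m ] (+ n) = trans (fromℤ-⊖ n (suc m)) (+-comm _ _)
  fromℤ-+ -[1+ m ] -[1+ n ] = begin
    - (suc (suc (m ℕ.+ n)) ·ⁿ 1#)       ≡⟨ ≡.cong (λ k → - (suc k ·ⁿ 1#)) (ℕ.+-suc m n) ⟨
    - ((suc m ℕ.+ suc n) ·ⁿ 1#)         ≈⟨ -‿cong (×-homo-+ 1# (suc m) (suc n)) ⟩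
    - (suc m ·ⁿ 1# + suc n ·ⁿ 1#)        ≈⟨ -‿+-comm _ _ ⟨
    - (suc m ·ⁿ 1#) - suc n ·ⁿ 1#        ∎

  fromℤ-neg : ∀ i → fromℤ (ℤ.- i) ≈ - fromℤ i
  fromℤ-neg (+ zero)  = sym -0#≈0#
  fromℤ-neg (+ suc n) = refl
  fromℤ-neg -[1+ n ]  = sym (-‿involutive _)

  fromℤ-*ⁿ : ∀ m j → fromℤ (+ m ℤ.* j) ≈ fromℤ (+ m) * fromℤ j
  fromℤ-*ⁿ m (+ n) = begin
    fromℤ (+ m ℤ.* + n)                ≡⟨ ≡.cong fromℤ (ℤ.pos-* m n) ⟨
    (m ℕ.* n) ·ⁿ 1#                     ≈⟨ ×1-homo-* m n ⟩
    (m ·ⁿ 1#) * (n ·ⁿ 1#)                ∎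
  fromℤ-*ⁿ m -[1+ n ] = begin
    fromℤ (+ m ℤ.* (ℤ.- + suc n))      ≡⟨ ≡.cong fromℤ (ℤ.neg-distribʳ-* (+ m) (+ suc n)) ⟨
    fromℤ (ℤ.- (+ m ℤ.* + suc n))      ≈⟨ fromℤ-neg (+ m ℤ.* + suc n) ⟩
    - fromℤ (+ m ℤ.* + suc n)          ≈⟨ -‿cong (fromℤ-*ⁿ m (+ suc n)) ⟩
    - (fromℤ (+ m) * fromℤ (+ suc n))  ≈⟨ -‿distribʳ-* _ _ ⟩
    fromℤ (+ m) * fromℤ -[1+ n ]       ∎

  fromℤ-* : ∀ i j → fromℤ (i ℤ.* j) ≈ fromℤ i * fromℤ j
  fromℤ-* (+ m) j = fromℤ-*ⁿ m j
  fromℤ-* -[1+ m ] j = begin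
    fromℤ ((ℤ.- + suc m) ℤ.* j)        ≡⟨ ≡.cong fromℤ (ℤ.neg-distribˡ-* (+ suc m) j) ⟨
    fromℤ (ℤ.- (+ suc m ℤ.* j))        ≈⟨ fromℤ-neg (+ suc m ℤ.* j) ⟩
    - fromℤ (+ suc m ℤ.* j)            ≈⟨ -‿cong (fromℤ-*ⁿ (suc m) j) ⟩
    - (fromℤ (+ suc m) * fromℤ j)      ≈⟨ -‿distribˡ-* _ _ ⟩
    fromℤ -[1+ m ] * fromℤ j           ∎

  morphism : ℤ.+-*-rawRing -Raw-AlmostCommutative⟶ fromCommutativeRing R
  morphism = record
    { ⟦_⟧    = fromℤ
    ; +-homo = fromℤ-+
    ; *-homo = fromℤ-*
    ; -‿homo = fromℤ-neg
    ; 0-homo = refl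
    ; 1-homo = refl
    }

  -- Only equal integers are recognised as equal coefficients; this is sound in every
  -- characteristic, so every solved identity is one over the integers.
  _≟ᶜ_ : ∀ i j → Maybe (fromℤ i ≈ fromℤ j)
  i ≟ᶜ j with i ℤ.≟ j
  ... | yes ≡.refl = just refl
  ... | no _       = nothing

  open Algebra.Solver.Ring ℤ.+-*-rawRing (fromCommutativeRing R) morphism _≟ᶜ_ public

-- Arithmetic of the final count

-- `x` and `y` are the numbers of eigenvalues of the two traceless members. Each enters its own
-- equation as `2 ∸ x` and the other one as `x`, so on adding the equations both disappear. The
-- bounds by 2 make the truncated subtractions exact.
goods-cancel : ∀ g g′ x y s → x ℕ.≤ 2 → y ℕ.≤ 2 →
  g ℕ.+ g ℕ.+ y ℕ.+ suc s ℕ.+ (2 ℕ.∸ x) ≡ suc s ℕ.* 2 →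
  g′ ℕ.+ g′ ℕ.+ x ℕ.+ suc s ℕ.+ (2 ℕ.∸ y) ≡ suc s ℕ.* 2 →
  g ℕ.+ g′ ≡ s ℕ.∸ 1
goods-cancel g g′ x y s x≤2 y≤2 eq eq′ = ≡.trans (≡.sym (ℕ.m+n∸n≡m (g ℕ.+ g′) 2))
  (≡.cong (ℕ._∸ 2) {g ℕ.+ g′ ℕ.+ 2} {suc s} (ℕ.*-cancelʳ-≡ (g ℕ.+ g′ ℕ.+ 2) (suc s) 2
    (ℕ.+-cancelʳ-≡ (suc s ℕ.* 2) _ _ (begin
  (g ℕ.+ g′ ℕ.+ 2) ℕ.* 2 ℕ.+ suc s ℕ.* 2
    ≡⟨ solve 3 (λ g g′ s → (g :+ g′ :+ con 2) :* con 2 :+ s :* con 2 := (g :+ g :+ (g′ :+ g′) :+ con 2 :* s) :+ (con 2 :+ con 2)) ≡.refl g g′ (suc s) ⟩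
  (g ℕ.+ g ℕ.+ (g′ ℕ.+ g′) ℕ.+ 2 ℕ.* suc s) ℕ.+ (2 ℕ.+ 2)
    ≡⟨ ≡.cong₂ (λ m n → (g ℕ.+ g ℕ.+ (g′ ℕ.+ g′) ℕ.+ 2 ℕ.* suc s) ℕ.+ (m ℕ.+ n)) (ℕ.m+[n∸m]≡n x≤2) (ℕ.m+[n∸m]≡n y≤2) ⟨
  (g ℕ.+ g ℕ.+ (g′ ℕ.+ g′) ℕ.+ 2 ℕ.* suc s) ℕ.+ ((x ℕ.+ (2 ℕ.∸ x)) ℕ.+ (y ℕ.+ (2 ℕ.∸ y)))
    ≡⟨ solve 7 (λ g g′ x y s x′ y′ → (g :+ g :+ (g′ :+ g′) :+ con 2 :* s) :+ ((x :+ x′) :+ (y :+ y′)) :=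
         (g :+ g :+ y :+ s :+ x′) :+ (g′ :+ g′ :+ x :+ s :+ y′)) ≡.refl g g′ x y (suc s) (2 ℕ.∸ x) (2 ℕ.∸ y) ⟩
  (g ℕ.+ g ℕ.+ y ℕ.+ suc s ℕ.+ (2 ℕ.∸ x)) ℕ.+ (g′ ℕ.+ g′ ℕ.+ x ℕ.+ suc s ℕ.+ (2 ℕ.∸ y)) ≡⟨ ≡.cong₂ ℕ._+_ eq eq′ ⟩
  suc s ℕ.* 2 ℕ.+ suc s ℕ.* 2 ∎))))
  where
  open ≡.≡-Reasoning
  open +-*-Solver

double-cancel : ∀ g g′ s → g ℕ.+ g ≡ s → g′ ℕ.+ g′ ≡ s → g ℕ.+ g′ ≡ s
double-cancel g g′ s eq eq′ = ℕ.*-cancelʳ-≡ (g ℕ.+ g′) s 2 (begin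
  (g ℕ.+ g′) ℕ.* 2             ≡⟨ solve 2 (λ g g′ → (g :+ g′) :* con 2 := (g :+ g) :+ (g′ :+ g′)) ≡.refl g g′ ⟩
  (g ℕ.+ g) ℕ.+ (g′ ℕ.+ g′)    ≡⟨ ≡.cong₂ ℕ._+_ eq eq′ ⟩
  s ℕ.+ s                      ≡⟨ solve 1 (λ s → s :+ s := s :* con 2) ≡.refl s ⟩
  s ℕ.* 2                      ∎)
  where
  open ≡.≡-Reasoning
  open +-*-Solver

suc-double : ∀ n → suc n ℕ.* 2 ≡ n ℕ.+ (suc n ℕ.+ 1)
suc-double = solve 1 (λ n → (con 1 :+ n) :* con 2 := n :+ (con 1 :+ n :+ con 1)) ≡.refl
  where open +-*-Solver

-- Powers in groups and normal forms in dihedral groups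

module _ {c ℓ} (H : Group c ℓ) where

  open Group H
  open Mult monoid using (×-homo-+; ×-assocˡ; ×-congʳ)
  open SetoidReasoning setoid

  private
    pow : Carrier → ℕ → Carrier
    pow = power rawMonoid

  power-cong : ∀ {x y} n → x ≈ y → pow x n ≈ pow y n
  power-cong n = ×-congʳ n

  power-ε : ∀ n → pow ε n ≈ ε
  power-ε zero    = refl
  power-ε (suc n) = trans (identityˡ _) (power-ε n)

  power-reduce : ∀ {x n} .{{_ : ℕ.NonZero n}} → pow x n ≈ ε → ∀ k → ∃[ i ] pow x k ≈ pow x (toℕ {n} i)
  power-reduce {x} {n} xⁿ≈ε k with result m i k≡ ← k divMod n = i , (begin
    pow x k                            ≡⟨ ≡.cong (pow x) k≡ ⟩
    pow x (toℕ i ℕ.+ m ℕ.* n)          ≈⟨ ×-homo-+ x (toℕ i) (m ℕ.* n) ⟩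
    pow x (toℕ i) ∙ pow x (m ℕ.* n)    ≈⟨ ∙-congˡ (×-assocˡ x m n) ⟨
    pow x (toℕ i) ∙ pow (pow x n) m    ≈⟨ ∙-congˡ (trans (power-cong m xⁿ≈ε) (power-ε m)) ⟩
    pow x (toℕ i) ∙ ε                  ≈⟨ identityʳ _ ⟩
    pow x (toℕ i)                      ∎)

module DihedralGroup {c ℓ} (H : Group c ℓ) (n : ℕ) (iso : Isomorphic (Dihedral (suc n)) H) where

  open Group H
  open GroupProperties H
  open Mult monoid using (×-homo-+)
  open SetoidReasoning setoid

  private
    module D = Group (Dihedral (suc n))
    φ = proj₁ iso
    open GroupMorphisms.IsGroupIsomorphism (proj₂ iso)
      using (⟦⟧-cong; ∙-homo; ε-homo; ⁻¹-homo; surjective)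

    pow : Carrier → ℕ → Carrier
    pow = power rawMonoid

  x y : Carrier
  x = φ (gen genX)
  y = φ (gen genY)

  private
    φ-power : ∀ w k → φ (power (wordMonoid DihedralGenerator) w k) ≈ pow (φ w) k
    φ-power w zero    = ε-homo
    φ-power w (suc k) = trans (∙-homo _ _) (∙-congˡ (φ-power w k))

  xⁿ≈ε : pow x (suc n) ≈ ε
  xⁿ≈ε = trans (sym (φ-power (gen genX) (suc n))) (trans (⟦⟧-cong (relation xⁿ≈1)) ε-homo)

  y²≈ε : pow y 2 ≈ ε
  y²≈ε = trans (sym (φ-power (gen genY) 2)) (trans (⟦⟧-cong (relation y²≈1)) ε-homo)

  yx≈x⁻¹y : y ∙ x ≈ x ⁻¹ ∙ y
  yx≈x⁻¹y = begin
    y ∙ x                ≈⟨ //-rightDividesˡ y (y ∙ x) ⟨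
    y ∙ x ∙ y ⁻¹ ∙ y     ≈⟨ ∙-congʳ (trans (sym yxy⁻¹) (trans (⟦⟧-cong (relation yxy⁻¹≈x⁻¹)) (⁻¹-homo _))) ⟩
    x ⁻¹ ∙ y             ∎
    where
    yxy⁻¹ : φ (gen genY · gen genX · inv (gen genY)) ≈ y ∙ x ∙ y ⁻¹
    yxy⁻¹ = trans (∙-homo _ _) (∙-cong (∙-homo _ _) (⁻¹-homo _))

  private
    x⁻¹≈xⁿ : x ⁻¹ ≈ pow x n
    x⁻¹≈xⁿ = sym (inverseʳ-unique x (pow x n) xⁿ≈ε)

    y⁻¹≈y : y ⁻¹ ≈ y
    y⁻¹≈y = sym (inverseʳ-unique y y (trans (∙-congˡ (sym (identityʳ y))) y²≈ε))

    -- Each `x` that `y` passes becomes `x ⁻¹`, which is written as `pow x n` so that exponents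
    -- remain natural numbers.
    yxⁱ : ∀ i → ∃[ k ] y ∙ pow x i ≈ pow x k ∙ y
    yxⁱ zero    = 0 , trans (identityʳ y) (sym (identityˡ y))
    yxⁱ (suc i) with k , eq ← yxⁱ i = n ℕ.+ k , (begin
      y ∙ (x ∙ pow x i)        ≈⟨ assoc _ _ _ ⟨
      y ∙ x ∙ pow x i          ≈⟨ ∙-congʳ (trans yx≈x⁻¹y (∙-congʳ x⁻¹≈xⁿ)) ⟩
      pow x n ∙ y ∙ pow x i    ≈⟨ assoc _ _ _ ⟩
      pow x n ∙ (y ∙ pow x i)  ≈⟨ ∙-congˡ eq ⟩
      pow x n ∙ (pow x k ∙ y)  ≈⟨ assoc _ _ _ ⟨
      pow x n ∙ pow x k ∙ y    ≈⟨ ∙-congʳ (×-homo-+ x n k) ⟨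
      pow x (n ℕ.+ k) ∙ y      ∎)

    NormalForm : Carrier → Set ℓ
    NormalForm h = ∃[ i ] ∃[ j ] h ≈ pow x i ∙ pow y j

    resp : ∀ {g h} → g ≈ h → NormalForm g → NormalForm h
    resp g≈h (i , j , eq) = i , j , trans (sym g≈h) eq

    xᵏ-normal : ∀ k {h} → NormalForm h → NormalForm (pow x k ∙ h)
    xᵏ-normal k {h} (i , j , eq) = k ℕ.+ i , j , (begin
      pow x k ∙ h                      ≈⟨ ∙-congˡ eq ⟩
      pow x k ∙ (pow x i ∙ pow y j)    ≈⟨ assoc _ _ _ ⟨
      pow x k ∙ pow x i ∙ pow y j      ≈⟨ ∙-congʳ (×-homo-+ x k i) ⟨
      pow x (k ℕ.+ i) ∙ pow y j        ∎)

    y-normal : ∀ {h} → NormalForm h → NormalForm (y ∙ h)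
    y-normal {h} (i , j , eq) with k , eq′ ← yxⁱ i = k , suc j , (begin
      y ∙ h                            ≈⟨ ∙-congˡ eq ⟩
      y ∙ (pow x i ∙ pow y j)          ≈⟨ assoc _ _ _ ⟨
      y ∙ pow x i ∙ pow y j            ≈⟨ ∙-congʳ eq′ ⟩
      pow x k ∙ y ∙ pow y j            ≈⟨ assoc _ _ _ ⟩
      pow x k ∙ (y ∙ pow y j)          ∎)

    -- Words act by left multiplication on normal forms, so a product of words becomes a composition
    -- of actions. The inverse action is carried along because `inv` interchanges the two
    -- statements.
    word-normal : ∀ w {h} → NormalForm h → NormalForm (φ w ∙ h) × NormalForm (φ w ⁻¹ ∙ h)
    word-normal (gen genX) nf =
      resp (∙-congʳ (identityʳ x)) (xᵏ-normal 1 nf) , resp (∙-congʳ (sym x⁻¹≈xⁿ)) (xᵏ-normal n nf)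
    word-normal (gen genY) nf = y-normal nf , resp (∙-congʳ (sym y⁻¹≈y)) (y-normal nf)
    word-normal one {h} nf =
      resp (trans (sym (identityˡ h)) (∙-congʳ (sym ε-homo))) nf ,
      resp (trans (sym (identityˡ h)) (∙-congʳ (trans (sym ε⁻¹≈ε) (⁻¹-cong (sym ε-homo))))) nf
    word-normal (u · v) {h} nf =
      resp (trans (sym (assoc _ _ _)) (∙-congʳ (sym (∙-homo u v)))) (proj₁ (word-normal u (proj₁ (word-normal v nf)))) ,
      resp (trans (sym (assoc _ _ _)) (∙-congʳ (trans (sym (⁻¹-anti-homo-∙ _ _)) (⁻¹-cong (sym (∙-homo u v))))))
        (proj₂ (word-normal v (proj₂ (word-normal u nf))))
    word-normal (inv u) nf =
      resp (∙-congʳ (sym (⁻¹-homo u))) (proj₂ (word-normal u nf)) ,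
      resp (∙-congʳ (trans (sym (⁻¹-involutive _)) (⁻¹-cong (sym (⁻¹-homo u))))) (proj₁ (word-normal u nf))

  element : Fin 2 → Fin (suc n) → Carrier
  element j i = pow x (toℕ i) ∙ pow y (toℕ j)

  element-surjective : ∀ h → ∃[ j ] ∃[ i ] h ≈ element j i
  element-surjective h =
    let w , φw≈ = surjective h
        i , j , eq = proj₁ (word-normal w {ε} (0 , 0 , sym (identityʳ ε)))
        i′ , xⁱ≈ = power-reduce H xⁿ≈ε i
        j′ , yʲ≈ = power-reduce H y²≈ε j
    in j′ , i′ , trans (sym (φw≈ ~-refl)) (trans (sym (identityʳ _)) (trans eq (∙-cong xⁱ≈ yʲ≈)))

  module _ (card : HasCardinality setoid (2 ℕ.* suc n)) where

    private
      open Inverse card using (to; from; from-cong; strictlyInverseˡ; strictlyInverseʳ)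

      element′ : Fin (2 ℕ.* suc n) → Carrier
      element′ k = element (proj₁ (Fin.remQuot (suc n) k)) (proj₂ (Fin.remQuot {2} (suc n) k))

      element′-combine : ∀ j i → element′ (Fin.combine j i) ≡ element j i
      element′-combine j i = ≡.cong (λ ji → element (proj₁ ji) (proj₂ ji)) (Fin.remQuot-combine j i)

      label-surjective : ∀ k → ∃[ k′ ] from (element′ k′) ≡ k
      label-surjective k with j , i , eq ← element-surjective (to k) = Fin.combine j i ,
        ≡.trans (from-cong (trans (reflexive (element′-combine j i)) (sym eq))) (strictlyInverseʳ k)

    -- The 2(n + 1) normal forms exhaust a group of that order, so by finiteness no two of them
    -- coincide.
    element-injective : ∀ {j i j′ i′} → element j i ≈ element j′ i′ → j ≡ j′ × i ≡ i′
    element-injective {j} {i} {j′} {i′} eq = Fin.combine-injective j i j′ i′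
      (surjective⇒injective {f = λ k → from (element′ k)} label-surjective (from-cong
        (trans (reflexive (element′-combine j i)) (trans eq (reflexive (≡.sym (element′-combine j′ i′)))))))

    powers-distinct : ∀ {i i′ : Fin (suc n)} → pow x (toℕ i) ≈ pow x (toℕ i′) → i ≡ i′
    powers-distinct eq = proj₂ (element-injective {zero} {_} {zero} (∙-congʳ eq))

module DihedralSubgroup {c ℓ p} (G : Group c ℓ) (D : Subgroup G p) (n : ℕ)
  (iso : Isomorphic (Dihedral (suc n)) (subgroupGroup G D))
  (card : HasCardinality (Group.setoid (subgroupGroup G D)) (2 ℕ.* suc n)) where

  open Group G
  open Subgroup D

  private
    module D = DihedralGroup (subgroupGroup G D) n iso

    pow : Carrier → ℕ → Carrier
    pow = power rawMonoid

  x y : Carrier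
  x = proj₁ D.x
  y = proj₁ D.y

  y∈D : Member y
  y∈D = proj₂ D.y

  power∈D : ∀ k → Member (pow x k)
  power∈D zero    = ε-closed
  power∈D (suc k) = ∙-closed (proj₂ D.x) (power∈D k)

  yx≈x⁻¹y : y ∙ x ≈ x ⁻¹ ∙ y
  yx≈x⁻¹y = D.yx≈x⁻¹y

  powers-distinct : ∀ {i i′ : Fin (suc n)} → pow x (toℕ i) ≈ pow x (toℕ i′) → i ≡ i′
  powers-distinct {i} {i′} eq = D.powers-distinct card (trans (reflexive (power-subgroup G D D.x (toℕ i)))
    (trans eq (reflexive (≡.sym (power-subgroup G D D.x (toℕ i′))))))

  members : ∀ {h} → Member h → ∃[ k ] (pow x k ≈ h ⊎ pow x k ∙ y ≈ h)
  members {h} h∈D with D.element-surjective (h , h∈D)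
  ... | zero     , i , eq = toℕ i , inj₁ (trans (reflexive (≡.sym (power-subgroup G D D.x (toℕ i)))) (trans (sym (identityʳ _)) (sym eq)))
  ... | suc zero , i , eq = toℕ i , inj₂ (trans (∙-congʳ (reflexive (≡.sym (power-subgroup G D D.x (toℕ i))))) (trans (∙-congˡ (sym (identityʳ y))) (sym eq)))

-- The set A, and coverings by a subgroup

module _ {c ℓ} (G : Group c ℓ) where

  open Group G
  private
    pow : Carrier → ℕ → Carrier
    pow = power rawMonoid

  power-consecutive : ∀ {x} n → pow x n ≈ ε → pow x (suc n) ≈ ε → x ≈ ε
  power-consecutive {x} n xⁿ≈ε xⁿ⁺¹≈ε = trans (sym (identityʳ x)) (trans (∙-congˡ (sym xⁿ≈ε)) xⁿ⁺¹≈ε)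

  power-2-apart : ∀ {x} n → pow x n ≈ ε → pow x (suc (suc n)) ≈ ε → pow x 2 ≈ ε
  power-2-apart n xⁿ≈ε xⁿ⁺²≈ε = trans (∙-congˡ (∙-congˡ (sym xⁿ≈ε))) xⁿ⁺²≈ε

  ≈ε⇒square≈ε : ∀ {x} → x ≈ ε → pow x 2 ≈ ε
  ≈ε⇒square≈ε x≈ε = trans (power-cong G 2 x≈ε) (power-ε G 2)

  setA-resp : ∀ q {x y} → x ≈ y → SetA G q x → SetA G q y
  setA-resp q x≈y (xᵠ⁺¹≈ε , x²≉ε) =
    trans (power-cong G (suc q) (sym x≈y)) xᵠ⁺¹≈ε , λ y²≈ε → x²≉ε (trans (power-cong G 2 x≈y) y²≈ε)

module _ {c ℓ p} {a s : Level} (G : Group c ℓ) (D : Subgroup G p) where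

  open Group G
  open Subgroup D
  open GroupProperties G

  -- `P` is a decidable substitute for membership of `g ∙ h k` in `A`, as counting needs decisions.
  -- A factorization is determined by its second factor, and it is labelled by the index of the
  -- inverse of that factor.
  coversExactly-subgroup : ∀ {A : Pred Carrier a} → (∀ {x y} → x ≈ y → A x → A y) →
    ∀ {m} (h : Fin m → Carrier) → (∀ k → Member (h k)) → (∀ {b} → Member b → ∃[ k ] h k ≈ b) →
    (∀ {j k} → h j ≈ h k → j ≡ k) →
    {P : Carrier → Pred (Fin m) s} (P? : ∀ g → Decidable (P g)) →
    (∀ g k → P g k → A (g ∙ h k)) → (∀ g k → A (g ∙ h k) → P g k) →
    ∀ {n} → (∀ g → count (P? g) ≡ n) → CoversExactly G A Member n
  coversExactly-subgroup {A} A-resp h h∈D h-surjective h-injective {P} P? P⇒A A⇒P {n} counts g =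
    ≡.subst (HasCardinality (subsetoid (×-setoid setoid setoid) (Factorization G A Member g))) (counts g)
    (hasCardinality-count _ (P? g)
      (λ k Pk → (g ∙ h k , h k ⁻¹) , P⇒A g k Pk , ⁻¹-closed (h∈D k) , //-rightDividesʳ (h k) g)
      (λ (_ , _ , b∈D , _) → label b∈D)
      (λ { {_ , _ , b∈D , _} {_ , _ , b′∈D , _} (_ , b≈b′) →
        h-injective (trans (label-≈ b∈D) (trans (⁻¹-cong b≈b′) (sym (label-≈ b′∈D)))) })
      (λ (_ , a∈A , b∈D , ab≈g) → A⇒P g _ (A-resp (sym (g∙label b∈D ab≈g)) a∈A))
      (λ (_ , _ , b∈D , ab≈g) _ → g∙label b∈D ab≈g , trans (⁻¹-cong (label-≈ b∈D)) (⁻¹-involutive _))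
      (λ k _ → h-injective (trans (label-≈ _) (⁻¹-involutive (h k)))))
    where
    label : ∀ {b} → Member b → Fin _
    label b∈D = proj₁ (h-surjective (⁻¹-closed b∈D))

    label-≈ : ∀ {b} (b∈D : Member b) → h (label b∈D) ≈ b ⁻¹
    label-≈ b∈D = proj₂ (h-surjective (⁻¹-closed b∈D))

    g∙label : ∀ {x b} (b∈D : Member b) → x ∙ b ≈ g → g ∙ h (label b∈D) ≈ x
    g∙label {x} {b} b∈D xb≈g = trans (∙-cong (sym xb≈g) (label-≈ b∈D)) (//-rightDividesʳ b x)

splitAt-injective : ∀ m {n} {j k : Fin (m ℕ.+ n)} → Fin.splitAt m j ≡ Fin.splitAt m k → j ≡ k
splitAt-injective m {n} {j} {k} eq =
  ≡.trans (≡.sym (Fin.join-splitAt m n j)) (≡.trans (≡.cong (Fin.join m n) eq) (Fin.join-splitAt m n k))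

2∣p^k⇒p≡2 : ∀ {p} k → Prime p → 2 ∣ p ℕ.^ k → p ≡ 2
2∣p^k⇒p≡2 zero    _  2∣1  = contradiction (∣1⇒≡1 2∣1) λ ()
2∣p^k⇒p≡2 {p} (suc k) pr 2∣ with euclidsLemma p (p ℕ.^ k) prime[2] 2∣
... | inj₂ 2∣pᵏ = 2∣p^k⇒p≡2 k pr 2∣pᵏ
... | inj₁ 2∣p with prime⇒irreducible pr 2∣p
...   | inj₂ 2≡p = ≡.sym 2≡p

-- Arithmetic in a finite field

module OverFiniteField {c ℓ₁ ℓ₂ q} (F : FiniteField c ℓ₁ ℓ₂ q) where

  open FiniteField F using (commutativeRing; cardinality; _#_; tight; #⇒invertible; invertible⇒#; #-irrefl)
  open CommutativeRing commutativeRing hiding (zero)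
  open IntegerSolver commutativeRing using (solve; _:+_; _:*_; _:-_; :-_; _:=_; con)
  open RingProperties ring using (-0#≈0#; -‿involutive; x∙y⁻¹≈ε⇒x≈y; x≈y⇒x∙y⁻¹≈ε)
  open SetoidReasoning setoid

  open Inverse cardinality public using ()
    renaming (to to enum; from to index; from-cong to index-cong;
              strictlyInverseˡ to enum-index; strictlyInverseʳ to index-enum)

  infix 4 _≟_
  abstract
    _≟_ : Binary.Decidable _≈_
    x ≟ y = Dec.map′
      (λ eq → trans (sym (enum-index x)) (trans (reflexive (≡.cong enum eq)) (enum-index y)))
      index-cong (index x Fin.≟ index y)

  ×-≈0 : ∀ {x y e} → x ≈ y * e → e ≈ 0# → x ≈ 0#
  ×-≈0 {x} {y} {e} x≈ e≈0 = trans x≈ (trans (*-congˡ e≈0) (zeroʳ y))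

  +×-≈0 : ∀ {x y e z f} → x ≈ y * e + z * f → e ≈ 0# → f ≈ 0# → x ≈ 0#
  +×-≈0 x≈ e≈0 f≈0 = trans x≈ (trans (+-cong (×-≈0 refl e≈0) (×-≈0 refl f≈0)) (+-identityˡ 0#))

  -- If 1 = 0, then 0 - 0 is invertible, and 0 would be apart from itself.
  1≉0 : ¬ 1# ≈ 0#
  1≉0 1≈0 = #-irrefl refl (invertible⇒# {0#} {0#}
    (0# , trans (zeroˡ _) (sym 1≈0) , trans (zeroʳ _) (sym 1≈0)))

  abstract
    -- Inequality does not hand over an inverse directly. A search through the finite field either
    -- finds one or shows that `x` is not apart from 0, and then tightness gives `x ≈ 0#`.
    inverse : ∀ {x} → ¬ x ≈ 0# → ∃[ y ] x * y ≈ 1#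
    inverse {x} x≉0 with Fin.any? (λ i → x * enum i ≟ 1#)
    ... | yes (i , xy≈1) = enum i , xy≈1
    ... | no ¬inv = contradiction (proj₁ (tight x 0#) ¬x#0) x≉0
      where
      ¬x#0 : ¬ x # 0#
      ¬x#0 x#0 with y , _ , xy≈1 ← #⇒invertible x#0 =
        ¬inv (index y , trans (*-cong (trans (sym (+-identityʳ x)) (+-congˡ (sym -0#≈0#))) (enum-index y)) xy≈1)

  cancel : ∀ {x y} → ¬ x ≈ 0# → x * y ≈ 0# → y ≈ 0#
  cancel {x} {y} x≉0 xy≈0 with x⁻¹ , xx⁻¹≈1 ← inverse x≉0 = begin
    y              ≈⟨ *-identityˡ y ⟨
    1# * y         ≈⟨ *-congʳ xx⁻¹≈1 ⟨
    (x * x⁻¹) * y  ≈⟨ solve 3 (λ x x⁻¹ y → (x :* x⁻¹) :* y := x⁻¹ :* (x :* y)) refl x x⁻¹ y ⟩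
    x⁻¹ * (x * y)  ≈⟨ ×-≈0 refl xy≈0 ⟩
    0#             ∎

  cancel-≈ : ∀ {x y z} → ¬ x ≈ 0# → x * y ≈ x * z → y ≈ z
  cancel-≈ {x} {y} {z} x≉0 eq = x∙y⁻¹≈ε⇒x≈y y z (cancel x≉0 (begin
    x * (y - z)    ≈⟨ solve 3 (λ x y z → x :* (y :- z) := x :* y :- x :* z) refl x y z ⟩
    x * y - x * z  ≈⟨ x≈y⇒x∙y⁻¹≈ε eq ⟩
    0#             ∎))

  *-≉0 : ∀ {x y} → ¬ x ≈ 0# → ¬ y ≈ 0# → ¬ x * y ≈ 0#
  *-≉0 x≉0 y≉0 xy≈0 = y≉0 (cancel x≉0 xy≈0)

  factor-≉0 : ∀ {x y} → x * y ≈ 1# → ¬ x ≈ 0#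
  factor-≉0 {x} {y} xy≈1 x≈0 = 1≉0 (trans (sym xy≈1) (×-≈0 (*-comm x y) x≈0))

  -1≉0 : ¬ - 1# ≈ 0#
  -1≉0 -1≈0 = 1≉0 (trans (sym (-‿involutive 1#)) (trans (-‿cong -1≈0) -0#≈0#))

  2# : Carrier
  2# = 1# + 1#

  -- The projective line

  -- The points of the projective line are represented by (1 , 0) and the (x , −1); in F[M], where
  -- (u , v) is u + vM, the latter is x − M, whose determinant is the characteristic polynomial at x.

  NonZero₂ : Carrier → Carrier → Set ℓ₁
  NonZero₂ u v = ¬ (u ≈ 0# × v ≈ 0#)

  Point : Set
  Point = Fin (suc q)

  px py : Point → Carrier
  px zero    = 1#
  px (suc i) = enum i
  py zero    = 0#
  py (suc i) = - 1#

  point-nonZero : ∀ i → NonZero₂ (px i) (py i)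
  point-nonZero zero    (1≈0 , _)  = 1≉0 1≈0
  point-nonZero (suc i) (_ , -1≈0) = -1≉0 -1≈0

  -- For v ≠ 0, division by -v brings (u, v) to the form (x, -1). At (0, 0) the value `zero` is a
  -- mere default, excluded by `NonZero₂` in what follows.
  point : Carrier → Carrier → Point
  point u v with v ≟ 0#
  ... | yes _  = zero
  ... | no v≉0 = suc (index (- (u * proj₁ (inverse v≉0))))

  point-scale : ∀ {u v} → NonZero₂ u v →
    ∃[ s ] ¬ s ≈ 0# × u ≈ s * px (point u v) × v ≈ s * py (point u v)
  point-scale {u} {v} uv≉0 with v ≟ 0#
  ... | yes v≈0 = u , (λ u≈0 → uv≉0 (u≈0 , v≈0)) , sym (*-identityʳ u) , trans v≈0 (sym (zeroʳ u))
  ... | no v≉0 with w , vw≈1 ← inverse v≉0 = - v ,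
    (λ -v≈0 → v≉0 (trans (sym (-‿involutive v)) (trans (-‿cong -v≈0) -0#≈0#))) ,
    (begin
      u                    ≈⟨ *-identityˡ u ⟨
      1# * u               ≈⟨ *-congʳ vw≈1 ⟨
      (v * w) * u          ≈⟨ solve 3 (λ u v w → (v :* w) :* u := (:- v) :* (:- (u :* w))) refl u v w ⟩
      - v * - (u * w)      ≈⟨ *-congˡ (enum-index _) ⟨
      - v * enum (index (- (u * w))) ∎) ,
    solve 1 (λ v → v := (:- v) :* (:- con (+ 1))) refl v

  points-≡ : ∀ i j → px i * py j - px j * py i ≈ 0# → i ≡ j
  points-≡ zero    zero    eq = ≡.refl
  points-≡ zero    (suc j) eq = contradiction (trans
    (solve 1 (λ x → :- con (+ 1) := con (+ 1) :* (:- con (+ 1)) :- x :* con (+ 0)) refl (enum j)) eq) -1≉0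
  points-≡ (suc i) zero    eq = contradiction (trans
    (solve 1 (λ x → con (+ 1) := x :* con (+ 0) :- con (+ 1) :* (:- con (+ 1))) refl (enum i)) eq) 1≉0
  points-≡ (suc i) (suc j) eq = ≡.cong suc (≡.trans (≡.sym (index-enum i)) (≡.trans (index-cong i≈j) (index-enum j)))
    where
    i≈j : enum i ≈ enum j
    i≈j = sym (x∙y⁻¹≈ε⇒x≈y _ _ (trans
      (solve 2 (λ x y → y :- x := x :* (:- con (+ 1)) :- y :* (:- con (+ 1))) refl (enum i) (enum j)) eq))

  point-unique : ∀ {u v} → NonZero₂ u v → ∀ i → u * py i - px i * v ≈ 0# → point u v ≡ i
  point-unique {u} {v} uv≉0 i eq with s , s≉0 , u≈ , v≈ ← point-scale uv≉0 =
    points-≡ (point u v) i (cancel s≉0 (begin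
      s * (px (point u v) * py i - px i * py (point u v))
        ≈⟨ solve 5 (λ s x y x′ y′ → s :* (x :* y′ :- x′ :* y) := (s :* x) :* y′ :- x′ :* (s :* y))
             refl s (px (point u v)) (py (point u v)) (px i) (py i) ⟩
      s * px (point u v) * py i - px i * (s * py (point u v))
        ≈⟨ +-cong (*-congʳ (sym u≈)) (-‿cong (*-congˡ (sym v≈))) ⟩
      u * py i - px i * v ≈⟨ eq ⟩
      0# ∎))

  point-cong : ∀ {u v u′ v′} → NonZero₂ u v → NonZero₂ u′ v′ → u * v′ - u′ * v ≈ 0# → point u v ≡ point u′ v′
  point-cong {u} {v} {u′} {v′} uv≉0 uv′≉0 eq with s , s≉0 , u≈ , v≈ ← point-scale uv′≉0 =
    point-unique uv≉0 (point u′ v′) (cancel s≉0 (begin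
      s * (u * py i - px i * v)
        ≈⟨ solve 5 (λ s u v x y → s :* (u :* y :- x :* v) :=
              u :* (s :* y) :- (s :* x) :* v) refl s u v (px i) (py i) ⟩
      u * (s * py i) - s * px i * v
        ≈⟨ +-cong (*-congˡ (sym v≈)) (-‿cong (*-congʳ (sym u≈))) ⟩
      u * v′ - u′ * v ≈⟨ eq ⟩
      0# ∎))
    where i = point u′ v′

  LinearZero : Carrier → Carrier → Pred Point ℓ₁
  LinearZero p r i = p * px i + r * py i ≈ 0#

  linearZero? : ∀ p r → Decidable (LinearZero p r)
  linearZero? p r i = p * px i + r * py i ≟ 0#

  perp-nonZero : ∀ {p r} → NonZero₂ p r → NonZero₂ r (- p)
  perp-nonZero pr≉0 (r≈0 , -p≈0) =
    pr≉0 (trans (sym (-‿involutive _)) (trans (-‿cong -p≈0) -0#≈0#) , r≈0)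

  linearZero-unique : ∀ {p r} → NonZero₂ p r → ∀ i → LinearZero p r i → i ≡ point r (- p)
  linearZero-unique {p} {r} pr≉0 i eq = ≡.sym (point-unique (perp-nonZero pr≉0) i
    (trans (solve 4 (λ p r x y → r :* y :- x :* (:- p) := p :* x :+ r :* y) refl p r (px i) (py i)) eq))

  linearZero-exists : ∀ {p r} → NonZero₂ p r → LinearZero p r (point r (- p))
  linearZero-exists {p} {r} pr≉0 with s , s≉0 , r≈ , -p≈ ← point-scale (perp-nonZero pr≉0) = cancel s≉0 (begin
    s * (p * px i + r * py i)
      ≈⟨ solve 5 (λ s p r x y → s :* (p :* x :+ r :* y) :=
            p :* (s :* x) :+ r :* (s :* y)) refl s p r (px i) (py i) ⟩
    p * (s * px i) + r * (s * py i)  ≈⟨ +-cong (*-congˡ (sym r≈)) (*-congˡ (sym -p≈)) ⟩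
    p * r + r * - p                  ≈⟨ solve 2 (λ p r → p :* r :+ r :* (:- p) := con (+ 0)) refl p r ⟩
    0#                               ∎)
    where i = point r (- p)

  count-linearZero : ∀ {p r} → NonZero₂ p r → count (linearZero? p r) ≡ 1
  count-linearZero {p} {r} pr≉0 = count-unique (linearZero? p r)
    (point r (- p)) (linearZero-exists pr≉0) (linearZero-unique pr≉0)

  -- Roots of quadratic polynomials

  quadratic : Carrier → Carrier → Carrier → Carrier
  quadratic t d x = x * x - t * x + d

  root? : ∀ t d → Decidable (λ i → quadratic t d (enum i) ≈ 0#)
  root? t d i = quadratic t d (enum i) ≟ 0#

  roots : Carrier → Carrier → ℕ
  roots t d = count (root? t d)

  quadratic-cong : ∀ {t t′ d d′ x x′} → t ≈ t′ → d ≈ d′ → x ≈ x′ → quadratic t d x ≈ quadratic t′ d′ x′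
  quadratic-cong t≈ d≈ x≈ = +-cong (+-cong (*-cong x≈ x≈) (-‿cong (*-cong t≈ x≈))) d≈

  roots-cong : ∀ {t t′ d d′} → t ≈ t′ → d ≈ d′ → roots t d ≡ roots t′ d′
  roots-cong {t} {t′} {d} {d′} t≈ d≈ = count-⇔ (root? t d) (root? t′ d′)
    (λ _ → trans (quadratic-cong (sym t≈) (sym d≈) refl)) (λ _ → trans (quadratic-cong t≈ d≈ refl))

  data Roots (t d : Carrier) : Set (c ⊔ ℓ₁) where
    none   : (∀ x → ¬ quadratic t d x ≈ 0#) → roots t d ≡ 0 → Roots t d
    double : ∀ a → t ≈ a + a → d ≈ a * a → roots t d ≡ 1 → Roots t d
    simple : ∀ a b → ¬ a ≈ b → t ≈ a + b → d ≈ a * b → roots t d ≡ 2 → Roots t d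

  private
    cofactor : ∀ {t d a} → quadratic t d a ≈ 0# → ∀ x → quadratic t d x ≈ (x - a) * (x - (t - a))
    cofactor {t} {d} {a} a-root x = begin
      quadratic t d x
        ≈⟨ solve 4 (λ t d a x → x :* x :- t :* x :+ d :=
             (x :- a) :* (x :- (t :- a)) :+ con (+ 1) :* (a :* a :- t :* a :+ d)) refl t d a x ⟩
      (x - a) * (x - (t - a)) + 1# * quadratic t d a   ≈⟨ +-congˡ (×-≈0 refl a-root) ⟩
      (x - a) * (x - (t - a)) + 0#                     ≈⟨ +-identityʳ _ ⟩
      (x - a) * (x - (t - a))                          ∎

    root-cases : ∀ {t d a} → quadratic t d a ≈ 0# → ∀ x → quadratic t d x ≈ 0# → x ≈ a ⊎ x ≈ t - a
    root-cases {t} {d} {a} a-root x x-root with x - a ≟ 0#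
    ... | yes eq = inj₁ (x∙y⁻¹≈ε⇒x≈y x a eq)
    ... | no neq = inj₂ (x∙y⁻¹≈ε⇒x≈y x (t - a) (cancel neq (trans (sym (cofactor a-root x)) x-root)))

    root-co : ∀ {t d a} → quadratic t d a ≈ 0# → quadratic t d (t - a) ≈ 0#
    root-co {t} {d} {a} a-root = trans
      (solve 3 (λ t d a → (t :- a) :* (t :- a) :- t :* (t :- a) :+ d :=
            a :* a :- t :* a :+ d) refl t d a) a-root

    index-≡ : ∀ {i x} → enum i ≈ x → i ≡ index x
    index-≡ {i} eq = ≡.trans (≡.sym (index-enum i)) (index-cong eq)

    root-index : ∀ {t d x} → quadratic t d x ≈ 0# → quadratic t d (enum (index x)) ≈ 0#
    root-index {x = x} = trans (quadratic-cong refl refl (enum-index x))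

  roots≡0⇒≉ : ∀ {t d} → roots t d ≡ 0 → ∀ x → ¬ quadratic t d x ≈ 0#
  roots≡0⇒≉ {t} {d} eq x x-root = count≡0⇒none (root? t d) eq (index x) (root-index x-root)

  roots-view : ∀ t d → Roots t d
  roots-view t d with Fin.any? (root? t d)
  ... | no ¬root = none
    (λ x x-root → ¬root (index x , root-index x-root))
    (count-none (root? t d) (λ i i-root → ¬root (i , i-root)))
  ... | yes (i , a-root) with enum i ≟ t - enum i
  ...   | yes a≈b = double a
          (trans t≈a+b (+-congˡ (sym a≈b)))
          (trans d≈ab (*-congˡ (sym a≈b)))
          (count-unique (root? t d) i a-root λ j j-root →
            ≡.trans (index-≡ ([ id , (λ eq → trans eq (sym a≈b)) ]′ (root-cases a-root _ j-root))) (index-enum i))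
    where
    a = enum i
    t≈a+b : t ≈ a + (t - a)
    t≈a+b = solve 2 (λ t a → t := a :+ (t :- a)) refl t a
    d≈ab : d ≈ a * (t - a)
    d≈ab = x∙y⁻¹≈ε⇒x≈y _ _ (trans
      (solve 3 (λ t d a → d :- a :* (t :- a) := a :* a :- t :* a :+ d) refl t d a) a-root)
  ...   | no a≉b = simple a (t - a) a≉b
          (solve 2 (λ t a → t := a :+ (t :- a)) refl t a)
          (x∙y⁻¹≈ε⇒x≈y _ _ (trans
            (solve 3 (λ t d a → d :- a :* (t :- a) := a :* a :- t :* a :+ d) refl t d a) a-root))
          (count-two (root? t d) {i} {index (t - a)}
            (λ i≡ → a≉b (trans (reflexive (≡.cong enum i≡)) (enum-index _)))
            a-root (root-index (root-co a-root))
            (λ k k-root → [ (λ eq → inj₁ (≡.trans (index-≡ eq) (index-enum i))) , inj₂ ∘ index-≡ ]′ (root-cases a-root _ k-root)))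
    where a = enum i

  roots-odd : ∀ t d → roots t d ≡ 1 → t * t ≈ (2# * 2#) * d
  roots-odd t d eq with roots-view t d
  ... | none _ eq′           = contradiction (≡.trans (≡.sym eq) eq′) λ ()
  ... | simple _ _ _ _ _ eq′ = contradiction (≡.trans (≡.sym eq) eq′) λ ()
  ... | double a t≈ d≈ _     = begin
    t * t              ≈⟨ *-cong t≈ t≈ ⟩
    (a + a) * (a + a)  ≈⟨ solve 1 (λ a → (a :+ a) :* (a :+ a) := con (+ 2) :* con (+ 2) :* (a :* a)) refl a ⟩
    2# * 2# * (a * a)  ≈⟨ *-congˡ d≈ ⟨
    2# * 2# * d        ∎

  square-≈0 : ∀ {x} → x * x ≈ 0# → x ≈ 0#
  square-≈0 {x} xx≈0 with x ≟ 0#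
  ... | yes x≈0 = x≈0
  ... | no x≉0  = cancel x≉0 xx≈0

  -- Two roots a, b would have (a - b)² = t² - 4d = 0, and at least one root exists, namely t/2.
  discriminant≈0⇒roots≡1 : ¬ 2# ≈ 0# → ∀ {t d} → t * t ≈ (2# * 2#) * d → roots t d ≡ 1
  discriminant≈0⇒roots≡1 2≉0 {t} {d} disc≈0 with roots-view t d
  ... | double _ _ _ eq = eq
  ... | simple a b a≉b t≈ d≈ _ = contradiction (x∙y⁻¹≈ε⇒x≈y a b (square-≈0 (begin
    (a - b) * (a - b)                        ≈⟨ solve 2 (λ a b → (a :- b) :* (a :- b) :=
                                                   (a :+ b) :* (a :+ b) :- con (+ 2) :* con (+ 2) :* (a :* b)) refl a b ⟩
    (a + b) * (a + b) - 2# * 2# * (a * b)    ≈⟨ +-cong (*-cong t≈ t≈) (-‿cong (*-congˡ d≈)) ⟨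
    t * t - 2# * 2# * d                      ≈⟨ x≈y⇒x∙y⁻¹≈ε disc≈0 ⟩
    0#                                       ∎))) a≉b
  -- With h = 1/2, four times the value at th is t²(2h - 1)² - (t² - 4d), and both terms vanish.
  ... | none no-root _ with h , 2h≈1 ← inverse 2≉0 = contradiction (cancel (*-≉0 2≉0 2≉0) (begin
    2# * 2# * quadratic t d (t * h)
      ≈⟨ solve 3 (λ t d h → con (+ 2) :* con (+ 2) :* (t :* h :* (t :* h) :- t :* (t :* h) :+ d) :=
           t :* t :* ((con (+ 2) :* h :- con (+ 1)) :* (con (+ 2) :* h :- con (+ 1))) :+ :- (t :* t :- con (+ 2) :* con (+ 2) :* d)) refl t d h ⟩
    t * t * ((2# * h - 1#) * (2# * h - 1#)) + - (t * t - 2# * 2# * d)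
      ≈⟨ +-cong (×-≈0 refl (×-≈0 refl (x≈y⇒x∙y⁻¹≈ε 2h≈1))) (-‿cong (x≈y⇒x∙y⁻¹≈ε disc≈0)) ⟩
    0# + - 0# ≈⟨ -‿inverseʳ 0# ⟩
    0# ∎)) (no-root (t * h))

  module Even (2≈0 : 2# ≈ 0#) where

    2x≈0 : ∀ x → x + x ≈ 0#
    2x≈0 x = ×-≈0 (solve 1 (λ x → x :+ x := x :* con (+ 2)) refl x) 2≈0

    -- In characteristic 2 one has (x - y)² = x² - y². On the finite field the injective squaring
    -- map is also onto, which provides `sqrt`.
    square-injective : ∀ {i j} → index (enum i * enum i) ≡ index (enum j * enum j) → i ≡ j
    square-injective {i} {j} eq = ≡.trans (index-≡ (x∙y⁻¹≈ε⇒x≈y _ _ (square-≈0 (begin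
      (x - y) * (x - y)
        ≈⟨ solve 2 (λ x y → (x :- y) :* (x :- y) :=
              (x :* x :- y :* y) :+ ((y :* y :- x :* y) :+ (y :* y :- x :* y))) refl x y ⟩
      (x * x - y * y) + ((y * y - x * y) + (y * y - x * y)) ≈⟨ +-cong (x≈y⇒x∙y⁻¹≈ε xx≈yy) (2x≈0 _) ⟩
      0# + 0#                          ≈⟨ +-identityˡ 0# ⟩
      0#                               ∎)))) (index-enum j)
      where
      x = enum i
      y = enum j
      xx≈yy : x * x ≈ y * y
      xx≈yy = trans (sym (enum-index _)) (trans (reflexive (≡.cong enum eq)) (enum-index _))

    abstract
      sqrt : ∀ m → ∃[ x ] x * x ≈ m
      sqrt m with i , eq ← injective⇒surjective {f = λ i → index (enum i * enum i)} square-injective (index m) =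
        enum i , trans (sym (enum-index _)) (trans (reflexive (≡.cong enum eq)) (enum-index m))

    roots≡1⇒≈0 : ∀ {t d} → roots t d ≡ 1 → t ≈ 0#
    roots≡1⇒≈0 {t} {d} eq with roots-view t d
    ... | none _ eq′           = contradiction (≡.trans (≡.sym eq) eq′) λ ()
    ... | simple _ _ _ _ _ eq′ = contradiction (≡.trans (≡.sym eq) eq′) λ ()
    ... | double a t≈ _ _      = trans t≈ (2x≈0 a)

    -- For t = 0 the square root of d is a root, and roots a, b with a + b = 0 agree in
    -- characteristic 2.
    ≈0⇒roots≡1 : ∀ {t d} → t ≈ 0# → roots t d ≡ 1
    ≈0⇒roots≡1 {t} {d} t≈0 with roots-view t d
    ... | double _ _ _ eq = eq
    ... | simple a b a≉b t≈ _ _ = contradiction (x∙y⁻¹≈ε⇒x≈y a b (begin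
      a - b          ≈⟨ solve 2 (λ a b → a :- b := (a :+ b) :- (b :+ b)) refl a b ⟩
      (a + b) - (b + b) ≈⟨ +-cong (trans (sym t≈) t≈0) (-‿cong (2x≈0 b)) ⟩
      0# - 0#        ≈⟨ -‿inverseʳ 0# ⟩
      0#             ∎)) a≉b
    ... | none no-root _ with x , xx≈d ← sqrt d = contradiction (begin
      x * x - t * x + d   ≈⟨ +-cong (+-cong xx≈d (-‿cong (×-≈0 (*-comm t x) t≈0))) refl ⟩
      d - 0# + d          ≈⟨ solve 1 (λ d → d :- con (+ 0) :+ d := d :+ d) refl d ⟩
      d + d               ≈⟨ 2x≈0 d ⟩
      0#                  ∎) (no-root x)

  -- The permutation x ↦ sx of the field carries the roots of x² + m to those of x² + s²m.
  -- Determinants of traceless matrices therefore matter only up to squares.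
  roots-scale : ∀ {s} m → ¬ s ≈ 0# → roots 0# (s * s * m) ≡ roots 0# m
  roots-scale {s} m s≉0 with s⁻¹ , ss⁻¹≈1 ← inverse s≉0 = ≡.trans
    (sum-permute (indicator ∘ root? 0# (s * s * m)) π)
    (sum-cong-≗ λ i → indicator-⇔ (root? 0# (s * s * m) (index (s * enum i))) (root? 0# m i)
      (λ root → cancel s≉0 (cancel s≉0 (trans (sym (scaled i)) root)))
      (λ root → trans (scaled i) (×-≈0 refl (×-≈0 refl root))))
    where
    scaled : ∀ i → quadratic 0# (s * s * m) (enum (index (s * enum i))) ≈ s * (s * quadratic 0# m (enum i))
    scaled i = trans (quadratic-cong refl refl (enum-index _))
      (solve 3 (λ s m x → s :* x :* (s :* x) :- con (+ 0) :* (s :* x) :+ s :* s :* m :=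
        s :* (s :* (x :* x :- con (+ 0) :* x :+ m))) refl s m (enum i))

    inverses : ∀ {x y} → x * y ≈ 1# → ∀ i → index (x * enum (index (y * enum i))) ≡ i
    inverses {x} {y} xy≈1 i = ≡.trans (index-cong (begin
      x * enum (index (y * enum i))  ≈⟨ *-congˡ (enum-index _) ⟩
      x * (y * enum i)               ≈⟨ *-assoc x y (enum i) ⟨
      x * y * enum i                 ≈⟨ *-congʳ xy≈1 ⟩
      1# * enum i                    ≈⟨ *-identityˡ _ ⟩
      enum i                         ∎)) (index-enum i)

    π : Permutation q q
    π = permutation (λ i → index (s * enum i)) (λ i → index (s⁻¹ * enum i))
      (inverses ss⁻¹≈1) (inverses (trans (*-comm s⁻¹ s) ss⁻¹≈1))

  -- Matrices: eigenvalues and fixed points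

  Matrix : Set c
  Matrix = Mat₂ commutativeRing

  tr det : Matrix → Carrier
  tr  (mat a b c e) = a + e
  det (mat a b c e) = a * e - b * c

  Scalar : Matrix → Set ℓ₁
  Scalar (mat a b c e) = b ≈ 0# × c ≈ 0# × a ≈ e

  scalar? : ∀ M → Dec (Scalar M)
  scalar? (mat a b c e) = (b ≟ 0#) ×-dec (c ≟ 0#) ×-dec (a ≟ e)

  charRoots : Matrix → ℕ
  charRoots M = roots (tr M) (det M)

  -- M P ∧ P, which vanishes when P spans an eigenline of M.
  wedge : Matrix → Carrier → Carrier → Carrier
  wedge (mat a b c e) x y = (c * x + e * y) * x - (a * x + b * y) * y

  Fixes : Matrix → Pred Point ℓ₁
  Fixes M i = wedge M (px i) (py i) ≈ 0#

  fixes? : ∀ M → Decidable (Fixes M)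
  fixes? M i = wedge M (px i) (py i) ≟ 0#

  Eigen : Matrix → Carrier → Pred Point ℓ₁
  Eigen (mat a b c e) s i = a * px i + b * py i ≈ s * px i × c * px i + e * py i ≈ s * py i

  eigen? : ∀ M s → Decidable (Eigen M s)
  eigen? (mat a b c e) s i = (a * px i + b * py i ≟ s * px i) ×-dec (c * px i + e * py i ≟ s * py i)

  -- The factor w / P, for a vector w on the line through the point P.
  ratio : Point → Carrier → Carrier → Carrier
  ratio zero    w₁ w₂ = w₁
  ratio (suc i) w₁ w₂ = - w₂

  ratio-scales : ∀ i {w₁ w₂} → w₂ * px i - w₁ * py i ≈ 0# →
                 w₁ ≈ ratio i w₁ w₂ * px i × w₂ ≈ ratio i w₁ w₂ * py i
  ratio-scales zero {w₁} {w₂} eq = sym (*-identityʳ w₁) ,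
    trans (solve 2 (λ w₁ w₂ → w₂ :=
          w₂ :* con (+ 1) :- w₁ :* con (+ 0)) refl w₁ w₂) (trans eq (sym (zeroʳ w₁)))
  ratio-scales (suc i) {w₁} {w₂} eq =
    x∙y⁻¹≈ε⇒x≈y _ _ (trans
      (solve 3 (λ w₁ w₂ x → w₁ :- (:- w₂) :* x := w₂ :* x :- w₁ :* (:- con (+ 1))) refl w₁ w₂ (enum i)) eq) ,
    solve 1 (λ w → w := (:- w) :* (:- con (+ 1))) refl w₂

  ratio-unique : ∀ i {w₁ w₂ s} → w₁ ≈ s * px i → w₂ ≈ s * py i → s ≈ ratio i w₁ w₂
  ratio-unique zero    w₁≈ w₂≈ = sym (trans w₁≈ (*-identityʳ _))
  ratio-unique (suc i) {s = s} w₁≈ w₂≈ = sym (trans (-‿cong w₂≈) (solve 1 (λ s → :- (s :* (:- con (+ 1))) :=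
        s) refl s))

  eigen⇒fixes : ∀ M {s} i → Eigen M s i → Fixes M i
  eigen⇒fixes (mat a b c e) {s} i (w₁≈ , w₂≈) = trans
    (+-cong (*-congʳ w₂≈) (-‿cong (*-congʳ w₁≈)))
    (solve 3 (λ s x y → s :* y :* x :- s :* x :* y := con (+ 0)) refl s (px i) (py i))

  -- Multiplying (M - s)P = 0 by the adjugate of M - s gives det(M - s) P = 0, whose rows are
  -- `kill-x` and `kill-y`; the coordinates of P are not both zero.
  eigen⇒root : ∀ M {s} i → Eigen M s i → quadratic (tr M) (det M) s ≈ 0#
  eigen⇒root M@(mat a b c e) {s} i (w₁≈ , w₂≈) with quadratic (tr M) (det M) s ≟ 0#
  ... | yes eq = eq
  ... | no neq = contradiction (cancel neq kill-x , cancel neq kill-y) (point-nonZero i)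
    where
    w₁-≈0 = x≈y⇒x∙y⁻¹≈ε w₁≈
    w₂-≈0 = x≈y⇒x∙y⁻¹≈ε w₂≈

    kill-x : quadratic (tr M) (det M) s * px i ≈ 0#
    kill-x = +×-≈0 (solve 7 (λ a b c e s x y →
      (s :* s :- (a :+ e) :* s :+ (a :* e :- b :* c)) :* x :=
      (e :- s) :* (a :* x :+ b :* y :- s :* x) :+ (:- b) :* (c :* x :+ e :* y :- s :* y)) refl a b c e s (px i) (py i))
      w₁-≈0 w₂-≈0

    kill-y : quadratic (tr M) (det M) s * py i ≈ 0#
    kill-y = +×-≈0 (solve 7 (λ a b c e s x y →
      (s :* s :- (a :+ e) :* s :+ (a :* e :- b :* c)) :* y :=
      (:- c) :* (a :* x :+ b :* y :- s :* x) :+ (a :- s) :* (c :* x :+ e :* y :- s :* y)) refl a b c e s (px i) (py i))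
      w₁-≈0 w₂-≈0

  count-eigenvalues : ∀ M i → count (λ k → eigen? M (enum k) i) ≡ indicator (fixes? M i)
  count-eigenvalues M@(mat a b c e) i with fixes? M i
  ... | no ¬fixed = count-none (λ k → eigen? M (enum k) i) (λ k → ¬fixed ∘ eigen⇒fixes M i)
  ... | yes fixed = count-unique (λ k → eigen? M (enum k) i) (index s)
    (trans w₁≈ (*-congʳ (sym (enum-index s))) , trans w₂≈ (*-congʳ (sym (enum-index s))))
    (λ k (w₁≈′ , w₂≈′) → ≡.trans (≡.sym (index-enum k)) (index-cong (ratio-unique i w₁≈′ w₂≈′)))
    where
    s = ratio i (a * px i + b * py i) (c * px i + e * py i)
    w₁≈ = proj₁ (ratio-scales i fixed)
    w₂≈ = proj₂ (ratio-scales i fixed)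

  -- For a root s the nonscalar matrix M - s has rank one. One nonzero row cuts out a single point,
  -- and the other row vanishes there because det(M - s) = 0. If the first row is zero, the second
  -- is not, as M would be scalar.
  count-eigenpoints : ∀ M → ¬ Scalar M → ∀ k →
    count (eigen? M (enum k)) ≡ indicator (root? (tr M) (det M) k)
  count-eigenpoints M@(mat a b c e) ¬scalar k with root? (tr M) (det M) k
  ... | no ¬root = count-none (eigen? M (enum k)) (λ i → ¬root ∘ eigen⇒root M i)
  ... | yes root with (a - s ≟ 0#) ×-dec (b ≟ 0#)
    where s = enum k
  ...   | no row₁≉0 = ≡.trans
          (count-⇔ (eigen? M s) (linearZero? (a - s) b)
            (λ i (w₁≈ , _) → trans (row₁ i) (x≈y⇒x∙y⁻¹≈ε w₁≈))
            (λ i zero₁ → x∙y⁻¹≈ε⇒x≈y _ _ (trans (sym (row₁ i)) zero₁) , x∙y⁻¹≈ε⇒x≈y _ _ (row₂≈0 i zero₁)))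
          (count-linearZero row₁≉0)
    where
    s = enum k

    row₁ : ∀ i → (a - s) * px i + b * py i ≈ a * px i + b * py i - s * px i
    row₁ i = solve 5 (λ a b s x y → (a :- s) :* x :+ b :* y :=
          a :* x :+ b :* y :- s :* x) refl a b s (px i) (py i)

    row₂≈0 : ∀ i → (a - s) * px i + b * py i ≈ 0# → c * px i + e * py i - s * py i ≈ 0#
    row₂≈0 i zero₁ with a - s ≟ 0#
    ... | no neq = cancel neq (+×-≈0 (solve 7 (λ a b c e s x y →
            (a :- s) :* (c :* x :+ e :* y :- s :* y) :=
            c :* ((a :- s) :* x :+ b :* y) :+ y :* (s :* s :- (a :+ e) :* s :+ (a :* e :- b :* c))) refl a b c e s (px i) (py i))
            zero₁ root)
    ... | yes eq = cancel (λ b≈0 → row₁≉0 (eq , b≈0)) (+×-≈0 (solve 7 (λ a b c e s x y →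
            b :* (c :* x :+ e :* y :- s :* y) :=
            (e :- s) :* ((a :- s) :* x :+ b :* y) :+ (:- x) :* (s :* s :- (a :+ e) :* s :+ (a :* e :- b :* c))) refl a b c e s (px i) (py i))
            zero₁ root)
  ...   | yes (a≈s , b≈0) = ≡.trans
          (count-⇔ (eigen? M s) (linearZero? c (e - s))
            (λ i (_ , w₂≈) → trans (row₂ i) (x≈y⇒x∙y⁻¹≈ε w₂≈))
            (λ i zero₂ → x∙y⁻¹≈ε⇒x≈y _ _ (row₁≈0 i) , x∙y⁻¹≈ε⇒x≈y _ _ (trans (sym (row₂ i)) zero₂)))
          (count-linearZero (λ (c≈0 , e≈s) → ¬scalar (b≈0 , c≈0 ,
            trans (x∙y⁻¹≈ε⇒x≈y a s a≈s) (sym (x∙y⁻¹≈ε⇒x≈y e s e≈s)))))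
    where
    s = enum k

    row₂ : ∀ i → c * px i + (e - s) * py i ≈ c * px i + e * py i - s * py i
    row₂ i = solve 5 (λ c e s x y → c :* x :+ (e :- s) :* y :=
          c :* x :+ e :* y :- s :* y) refl c e s (px i) (py i)

    row₁≈0 : ∀ i → a * px i + b * py i - s * px i ≈ 0#
    row₁≈0 i = +×-≈0 (solve 5 (λ a b s x y → a :* x :+ b :* y :- s :* x :=
          x :* (a :- s) :+ y :* b) refl a b s (px i) (py i)) a≈s b≈0

  -- Double counting of the pairs (point, eigenvalue): a fixed point has one eigenvalue, and an
  -- eigenvalue of a nonscalar matrix has one fixed point.
  count-fixes : ∀ M → ¬ Scalar M → count (fixes? M) ≡ charRoots M
  count-fixes M ¬scalar = ≡.trans (sum-cong-≗ (λ i → ≡.sym (count-eigenvalues M i)))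
    (≡.trans (∑-comm (λ i k → indicator (eigen? M (enum k) i)))
             (sum-cong-≗ (count-eigenpoints M ¬scalar)))

  fixes-none⇒charRoots≡0 : ∀ M → ¬ Scalar M → (∀ i → ¬ Fixes M i) → charRoots M ≡ 0
  fixes-none⇒charRoots≡0 M ¬scalar ¬fixes = ≡.trans (≡.sym (count-fixes M ¬scalar)) (count-none (fixes? M) ¬fixes)

  scalar⇒fixes : ∀ M → Scalar M → ∀ i → Fixes M i
  scalar⇒fixes (mat a b c e) (b≈0 , c≈0 , a≈e) i = trans
    (+-cong (*-congʳ (+-congʳ (*-congʳ c≈0))) (-‿cong (*-congʳ (+-cong (*-congʳ a≈e) (*-congʳ b≈0)))))
    (solve 3 (λ e x y → (con (+ 0) :* x :+ e :* y) :* x :- (e :* x :+ con (+ 0) :* y) :* y :=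
          con (+ 0)) refl e (px i) (py i))

  -- Pencils of matrices

  combination : Matrix → Matrix → Carrier → Carrier → Matrix
  combination (mat a b c e) (mat a′ b′ c′ e′) u v =
    mat (u * a + v * a′) (u * b + v * b′) (u * c + v * c′) (u * e + v * e′)

  -- For each point P the condition that P is fixed is a nonzero linear condition on the pencil.
  module Pencil (H H′ : Matrix) (anisotropic : ∀ u v → NonZero₂ u v → ¬ det (combination H H′ u v) ≈ 0#) where

    member : Point → Matrix
    member i = combination H H′ (px i) (py i)

    wedge-linear : ∀ K K′ u v x y → wedge (combination K K′ u v) x y ≈ wedge K x y * u + wedge K′ x y * v
    wedge-linear (mat a b c e) (mat a′ b′ c′ e′) =
      solve 12 (λ a b c e a′ b′ c′ e′ u v x y →
        ((u :* c :+ v :* c′) :* x :+ (u :* e :+ v :* e′) :* y) :* x :- ((u :* a :+ v :* a′) :* x :+ (u :* b :+ v :* b′) :* y) :* y :=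
        ((c :* x :+ e :* y) :* x :- (a :* x :+ b :* y) :* y) :* u :+ ((c′ :* x :+ e′ :* y) :* x :- (a′ :* x :+ b′ :* y) :* y) :* v)
        refl a b c e a′ b′ c′ e′

    private
      kernel : ∀ K K′ {u v s s′} i → Eigen K s i → Eigen K′ s′ i → u * s + v * s′ ≈ 0# →
               det (combination K K′ u v) ≈ 0#
      kernel K@(mat a b c e) K′@(mat a′ b′ c′ e′) {u} {v} {s} {s′} i (w₁≈ , w₂≈) (w₁′≈ , w₂′≈) eq =
        -- The determinant is the value of the characteristic polynomial at 0, and 0 is an
        -- eigenvalue of the combination at `i`.
        trans (solve 2 (λ t d → d := con (+ 0) :* con (+ 0) :- t :* con (+ 0) :+ d) refl (tr C) (det C))
              (eigen⇒root C i (row a b a′ b′ (px i) w₁≈ w₁′≈ , row c e c′ e′ (py i) w₂≈ w₂′≈))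
        where
        C = combination K K′ u v

        row : ∀ a b a′ b′ z → a * px i + b * py i ≈ s * z → a′ * px i + b′ * py i ≈ s′ * z →
              (u * a + v * a′) * px i + (u * b + v * b′) * py i ≈ 0# * z
        row a b a′ b′ z w≈ w′≈ = begin
          (u * a + v * a′) * px i + (u * b + v * b′) * py i
            ≈⟨ solve 8 (λ a b a′ b′ u v x y →
                 (u :* a :+ v :* a′) :* x :+ (u :* b :+ v :* b′) :* y :=
                 u :* (a :* x :+ b :* y) :+ v :* (a′ :* x :+ b′ :* y)) refl a b a′ b′ u v (px i) (py i) ⟩
          u * (a * px i + b * py i) + v * (a′ * px i + b′ * py i)
            ≈⟨ +-cong (*-congˡ w≈) (*-congˡ w′≈) ⟩
          u * (s * z) + v * (s′ * z)
            ≈⟨ solve 5 (λ u v s s′ z → u :* (s :* z) :+ v :* (s′ :* z) :=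
                  (u :* s :+ v :* s′) :* z) refl u v s s′ z ⟩
          (u * s + v * s′) * z ≈⟨ *-congʳ eq ⟩
          0# * z ∎

      eigenvalue : ∀ K i → Fixes K i → ∃[ s ] Eigen K s i
      eigenvalue (mat a b c e) i fixed = _ , ratio-scales i fixed

    -- If P were fixed by both H and H′, with eigenvalues s and s′, then s′H - sH′ would kill P,
    -- contrary to anisotropy.
    wedges-nonZero : ∀ i → NonZero₂ (wedge H (px i) (py i)) (wedge H′ (px i) (py i))
    wedges-nonZero i (fixed , fixed′)
      with s , eig ← eigenvalue H i fixed | s′ , eig′ ← eigenvalue H′ i fixed′
      with (s′ ≟ 0#) ×-dec (- s ≟ 0#)
    ... | no nz = anisotropic s′ (- s) nz (kernel H H′ i eig eig′
            (solve 2 (λ s s′ → s′ :* s :+ (:- s) :* s′ := con (+ 0)) refl s s′))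
    -- With both eigenvalues zero that combination is trivial, but then H itself kills P.
    ... | yes (_ , -s≈0) = anisotropic 1# 0# (λ (1≈0 , _) → 1≉0 1≈0) (kernel H H′ i eig eig′
            (trans (solve 2 (λ s s′ → con (+ 1) :* s :+ con (+ 0) :* s′ := :- (:- s)) refl s s′)
              (trans (-‿cong -s≈0) -0#≈0#)))

    fixes⇒linearZero : ∀ i j → Fixes (member i) j → LinearZero (wedge H (px j) (py j)) (wedge H′ (px j) (py j)) i
    fixes⇒linearZero i j = trans (sym (wedge-linear H H′ (px i) (py i) (px j) (py j)))

    linearZero⇒fixes : ∀ i j → LinearZero (wedge H (px j) (py j)) (wedge H′ (px j) (py j)) i → Fixes (member i) j
    linearZero⇒fixes i j = trans (wedge-linear H H′ (px i) (py i) (px j) (py j))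

    fixes-unique : ∀ i i′ j → Fixes (member i) j → Fixes (member i′) j → i ≡ i′
    fixes-unique i i′ j fixed fixed′ = ≡.trans
      (linearZero-unique (wedges-nonZero j) i (fixes⇒linearZero i j fixed))
      (≡.sym (linearZero-unique (wedges-nonZero j) i′ (fixes⇒linearZero i′ j fixed′)))

    count-members-fixing : ∀ j → count (λ i → fixes? (member i) j) ≡ 1
    count-members-fixing j = ≡.trans
      (count-⇔ (λ i → fixes? (member i) j) (linearZero? _ _) (λ i → fixes⇒linearZero i j) (λ i → linearZero⇒fixes i j))
      (count-linearZero (wedges-nonZero j))

    sum-charRoots : (∀ i → ¬ Scalar (member i)) → sum (λ i → charRoots (member i)) ≡ suc q
    sum-charRoots ¬scalar = ≡.trans (sum-cong-≗ (λ i → ≡.sym (count-fixes (member i) (¬scalar i))))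
      (≡.trans (∑-comm (λ i j → indicator (fixes? (member i) j)))
        (≡.trans (sum-cong-≗ count-members-fixing)
          (≡.trans (sum-const (suc q) 1) (ℕ.*-identityʳ (suc q)))))

    scalar-unique : ∀ {i i′} → Scalar (member i) → Scalar (member i′) → i ≡ i′
    scalar-unique {i} {i′} scalar scalar′ = fixes-unique i i′ zero
      (scalar⇒fixes (member i) scalar zero) (scalar⇒fixes (member i′) scalar′ zero)

    -- Each point is fixed by only one member, and the scalar already fixes all points.
    not-fixed : ∀ i i₀ → Scalar (member i₀) → ¬ Scalar (member i) → ∀ j → ¬ Fixes (member i) j
    not-fixed i i₀ scalar ¬scalar j fixed = ¬scalar (≡.subst (λ k → Scalar (member k)) i₀≡i scalar)
      where
      i₀≡i : i₀ ≡ i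
      i₀≡i = fixes-unique i₀ i j (scalar⇒fixes (member i₀) scalar j) fixed

    charRoots-away-from-scalar : ∀ i i₀ → Scalar (member i₀) → ¬ Scalar (member i) → charRoots (member i) ≡ 0
    charRoots-away-from-scalar i i₀ scalar ¬scalar =
      fixes-none⇒charRoots≡0 (member i) ¬scalar (not-fixed i i₀ scalar ¬scalar)

  -- Good members of a pencil whose determinant is a multiple of a norm form

  Good : Matrix → Set ℓ₁
  Good M = ¬ tr M ≈ 0# × charRoots M ≡ 0

  good? : ∀ M → Dec (Good M)
  good? M = Dec.¬? (tr M ≟ 0#) ×-dec (charRoots M ℕ.≟ 0)

  scalar⇒charRoots≢0 : ∀ M → Scalar M → charRoots M ≢ 0
  scalar⇒charRoots≢0 (mat a b c e) (b≈0 , c≈0 , a≈e) eq = roots≡0⇒≉ eq a (begin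
    a * a - (a + e) * a + (a * e - b * c)
      ≈⟨ solve 4 (λ a b c e → a :* a :- (a :+ e) :* a :+ (a :* e :- b :* c) := (:- b) :* c) refl a b c e ⟩
    - b * c   ≈⟨ ×-≈0 refl c≈0 ⟩
    0#        ∎)

  roots≤2 : ∀ t d → roots t d ℕ.≤ 2
  roots≤2 t d with roots-view t d
  ... | none _ eq           = ℕ.≤-trans (ℕ.≤-reflexive eq) ℕ.z≤n
  ... | double _ _ _ eq     = ℕ.≤-trans (ℕ.≤-reflexive eq) (ℕ.s≤s ℕ.z≤n)
  ... | simple _ _ _ _ _ eq = ℕ.≤-reflexive eq

  module _ (t d : Carrier) where

    -- The norm of u + vX, where X has trace t and determinant d.
    norm : Carrier → Carrier → Carrier
    norm u v = u * u + t * u * v + d * v * v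

    -- This is `norm r (- p)`, the norm form at the zero (r, -p) of the linear form pu + rv.
    dual : Carrier → Carrier → Carrier
    dual p r = r * r - t * p * r + d * p * p

    disc : Carrier
    disc = t * t - 2# * 2# * d

    norm-scale : ∀ s u v → norm (s * u) (s * v) ≈ s * s * norm u v
    norm-scale = solve 5 (λ t d s u v →
      s :* u :* (s :* u) :+ t :* (s :* u) :* (s :* v) :+ d :* (s :* v) :* (s :* v) :=
      s :* s :* (u :* u :+ t :* u :* v :+ d :* v :* v)) refl t d

    norm-cong : ∀ {u u′ v v′} → u ≈ u′ → v ≈ v′ → norm u v ≈ norm u′ v′
    norm-cong u≈ v≈ = +-cong (+-cong (*-cong u≈ u≈) (*-cong (*-congˡ u≈) v≈)) (*-cong (*-congˡ v≈) v≈)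

    -- For v ≠ 0, the norm divided by v² is the value of the polynomial at -u/v; for v = 0 it is u².
    norm-anisotropic : (∀ x → ¬ quadratic t d x ≈ 0#) → ∀ u v → NonZero₂ u v → ¬ norm u v ≈ 0#
    norm-anisotropic no-root u v nz N≈0 with v ≟ 0#
    ... | yes v≈0 = nz (square-≈0 (begin
            u * u                          ≈⟨ solve 4 (λ t d u v → u :* u :=
                                                (u :* u :+ t :* u :* v :+ d :* v :* v) :+ (:- (t :* u :+ d :* v)) :* v) refl t d u v ⟩
            norm u v + (- (t * u + d * v)) * v ≈⟨ +-cong N≈0 (×-≈0 refl v≈0) ⟩
            0# + 0#                        ≈⟨ +-identityˡ 0# ⟩
            0#                             ∎) , v≈0)
    ... | no v≉0 with w , vw≈1 ← inverse v≉0 = no-root (- (u * w)) (+×-≈0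
            (solve 5 (λ t d u v w →
              (:- (u :* w)) :* (:- (u :* w)) :- t :* (:- (u :* w)) :+ d :=
              w :* w :* (u :* u :+ t :* u :* v :+ d :* v :* v) :+
              (:- (t :* u :* w :+ d :* v :* w :+ d)) :* (v :* w :- con (+ 1))) refl t d u v w)
            N≈0 (x≈y⇒x∙y⁻¹≈ε vw≈1))

    -- Only the linear trace form and the factor δ of the determinant enter the count, so the same
    -- argument serves both halves of a coset.
    module NormPencil (no-root : ∀ x → ¬ quadratic t d x ≈ 0#)
      (H H′ : Matrix) (p r δ : Carrier) (δ≉0 : ¬ δ ≈ 0#)
      (tr-≈ : ∀ u v → tr (combination H H′ u v) ≈ p * u + r * v)
      (det-≈ : ∀ u v → det (combination H H′ u v) ≈ δ * norm u v) where

      det≉0 : ∀ u v → NonZero₂ u v → ¬ det (combination H H′ u v) ≈ 0#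
      det≉0 u v nz eq = *-≉0 δ≉0 (norm-anisotropic no-root u v nz) (trans (sym (det-≈ u v)) eq)

      open Pencil H H′ det≉0

      goods : ℕ
      goods = count (λ i → good? (member i))

      trace? : Decidable (LinearZero p r)
      trace? = linearZero? p r

      traceless : ∀ i → LinearZero p r i → tr (member i) ≈ 0#
      traceless i = trans (tr-≈ _ _)

      not-good-traceless : ∀ i → LinearZero p r i → ¬ Good (member i)
      not-good-traceless i zero-i (tr≉0 , _) = tr≉0 (traceless i zero-i)

      goods-traceless : ¬ NonZero₂ p r → goods ≡ 0
      goods-traceless p≈r≈0 with (p ≟ 0#) ×-dec (r ≟ 0#)
      ... | no nz = contradiction nz p≈r≈0
      ... | yes (p≈0 , r≈0) = count-none (λ i → good? (member i)) λ i → not-good-traceless i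
              (trans (+-cong (trans (*-comm p _) (×-≈0 refl p≈0)) (trans (*-comm r _) (×-≈0 refl r≈0))) (+-identityˡ 0#))

      -- The traceless member sits at the point of (r, -p). Its determinant differs from
      -- `δ * dual p r` by the square of the factor that normalises (r, -p) to a point, and
      -- `roots-scale` absorbs this square.
      charRoots-traceless : NonZero₂ p r → ∀ i → LinearZero p r i → charRoots (member i) ≡ roots 0# (δ * dual p r)
      charRoots-traceless pr≉0 i zero-i = go (point-scale (perp-nonZero pr≉0)) (≡.sym (linearZero-unique pr≉0 i zero-i))
        where
        go : ∀ {j} → ∃[ s ] ¬ s ≈ 0# × r ≈ s * px j × - p ≈ s * py j → j ≡ i →
             charRoots (member i) ≡ roots 0# (δ * dual p r)
        go (s , s≉0 , r≈ , -p≈) ≡.refl = ≡.trans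
          (roots-cong (traceless i zero-i) (det-≈ (px i) (py i)))
          (≡.trans (≡.sym (roots-scale (δ * norm (px i) (py i)) s≉0)) (roots-cong refl (begin
            s * s * (δ * norm (px i) (py i))
              ≈⟨ solve 3 (λ s δ n → s :* s :* (δ :* n) := δ :* (s :* s :* n)) refl s δ (norm (px i) (py i)) ⟩
            δ * (s * s * norm (px i) (py i))        ≈⟨ *-congˡ (norm-scale s (px i) (py i)) ⟨
            δ * norm (s * px i) (s * py i)          ≈⟨ *-congˡ (norm-cong r≈ -p≈) ⟨
            δ * norm r (- p)
              ≈⟨ *-congˡ (solve 4 (λ t d p r → r :* r :+ t :* r :* (:- p) :+ d :* (:- p) :* (:- p) :=
                    r :* r :- t :* p :* r :+ d :* p :* p) refl t d p r) ⟩
            δ * dual p r                            ∎)))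

      -- Vanishing discriminant; for 2 ≠ 0 this means exactly one eigenvalue.
      Parabolic : Pred Point ℓ₁
      Parabolic i = tr (member i) * tr (member i) ≈ 2# * 2# * det (member i)

      parabolic? : Decidable Parabolic
      parabolic? i = tr (member i) * tr (member i) ≟ 2# * 2# * det (member i)

      -- The discriminant of the pencil is a binary quadratic form αx² + 2βxy + γy²; its zeros are
      -- the eigenlines of a traceless matrix.
      count-parabolic : ¬ 2# ≈ 0# → ¬ dual p r + δ * disc ≈ 0# →
                        count parabolic? ≡ roots 0# (- (δ * (dual p r + δ * disc)))
      count-parabolic 2≉0 dual≉0 = ≡.trans
        (count-⇔ parabolic? (fixes? Q)
          (λ i eq → trans (wedge-Q i) (x≈y⇒x∙y⁻¹≈ε eq))
          (λ i fixed → x∙y⁻¹≈ε⇒x≈y _ _ (trans (sym (wedge-Q i)) fixed)))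
        (≡.trans (count-fixes Q ¬scalar)
          (≡.trans (roots-cong (-‿inverseˡ β) det-Q) (roots-scale _ 2≉0)))
        where
        α = p * p - 2# * 2# * δ
        β = p * r - 2# * δ * t
        γ = r * r - 2# * 2# * δ * d
        Q = mat (- β) (- γ) α β

        det-Q : det Q ≈ 2# * 2# * - (δ * (dual p r + δ * disc))
        det-Q = solve 5 (λ t d p r δ →
          let four = con (+ 2) :* con (+ 2)
              α = p :* p :- four :* δ
              β = p :* r :- con (+ 2) :* δ :* t
              γ = r :* r :- four :* δ :* d
          in (:- β) :* β :- (:- γ) :* α :=
             four :* (:- (δ :* ((r :* r :- t :* p :* r :+ d :* p :* p) :+ δ :* (t :* t :- four :* d))))) refl t d p r δ

        wedge-Q : ∀ i → wedge Q (px i) (py i) ≈ tr (member i) * tr (member i) - 2# * 2# * det (member i)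
        wedge-Q i = trans
          (solve 7 (λ t d p r δ x y →
            let four = con (+ 2) :* con (+ 2)
                α = p :* p :- four :* δ
                β = p :* r :- con (+ 2) :* δ :* t
                γ = r :* r :- four :* δ :* d
            in (α :* x :+ β :* y) :* x :- ((:- β) :* x :+ (:- γ) :* y) :* y :=
               (p :* x :+ r :* y) :* (p :* x :+ r :* y) :- four :* (δ :* (x :* x :+ t :* x :* y :+ d :* y :* y))) refl t d p r δ (px i) (py i))
          (sym (+-cong (*-cong (tr-≈ _ _) (tr-≈ _ _)) (-‿cong (*-congˡ (det-≈ _ _)))))

        ¬scalar : ¬ Scalar Q
        -- In odd characteristic a traceless scalar matrix is zero, whereas the determinant of `Q`
        -- is not.
        ¬scalar (-γ≈0 , α≈0 , -β≈β) = dual≉0 (cancel δ≉0 (trans (sym (-‿involutive _)) (trans (-‿cong (cancel (*-≉0 2≉0 2≉0)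
          (trans (sym det-Q) (+×-≈0 (solve 3 (λ α β γ → (:- β) :* β :- (:- γ) :* α :=
                (:- β) :* β :+ γ :* α) refl α β γ) β≈0 α≈0)))) -0#≈0#)))
          where
          β≈0 : β ≈ 0#
          β≈0 = cancel 2≉0 (begin
            2# * β    ≈⟨ solve 1 (λ β → con (+ 2) :* β := β :- (:- β)) refl β ⟩
            β - - β   ≈⟨ x≈y⇒x∙y⁻¹≈ε (sym -β≈β) ⟩
            0#        ∎)

      private
        #good #trace #parabolic #roots #scalar : Point → ℕ
        #good i      = indicator (good? (member i))
        #trace i     = indicator (trace? i)
        #parabolic i = indicator (parabolic? i)
        #roots i     = charRoots (member i)
        #scalar i    = indicator (scalar? (member i))

        ρ = roots 0# (δ * dual p r)

        split₃ : (f g h : Point → ℕ) → sum (λ i → f i ℕ.+ g i ℕ.+ h i) ≡ sum f ℕ.+ sum g ℕ.+ sum h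
        split₃ f g h = ≡.trans (∑-distrib-+ (λ i → f i ℕ.+ g i) h) (≡.cong (ℕ._+ sum h) (∑-distrib-+ f g))

      module _ (pr≉0 : NonZero₂ p r) where

        private
          count-traceless : count trace? ≡ 1
          count-traceless = count-linearZero pr≉0

          tr≉0 : ∀ i → ¬ LinearZero p r i → ¬ tr (member i) ≈ 0#
          tr≉0 i nz tr≈0 = nz (trans (sym (tr-≈ _ _)) tr≈0)

        module NoScalar (¬scalar : ∀ i → ¬ Scalar (member i)) where

          -- Each member receives total weight 2. Away from trace zero this is 2 + 0 + 0, 0 + 1 + 1
          -- or 0 + 0 + 2 (good twice, parabolic, roots) for 0, 1 or 2 roots. The traceless member
          -- has ρ roots and is topped up by `2 ∸ ρ`.
          goods-odd : ¬ 2# ≈ 0# → ¬ dual p r + δ * disc ≈ 0# →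
            goods ℕ.+ goods ℕ.+ roots 0# (- (δ * (dual p r + δ * disc))) ℕ.+ suc q ℕ.+ (2 ℕ.∸ roots 0# (δ * dual p r)) ≡ suc q ℕ.* 2
          goods-odd 2≉0 dual≉0 = ≡.trans (≡.sym total) (≡.trans (sum-cong-≗ pointwise) (sum-const (suc q) 2))
            where
            f : Point → ℕ
            f i = #good i ℕ.+ #good i ℕ.+ #parabolic i ℕ.+ #roots i ℕ.+ #trace i ℕ.* (2 ℕ.∸ ρ)

            total : sum f ≡ goods ℕ.+ goods ℕ.+ roots 0# (- (δ * (dual p r + δ * disc))) ℕ.+ suc q ℕ.+ (2 ℕ.∸ ρ)
            total = ≡.trans (split₃ (λ i → #good i ℕ.+ #good i ℕ.+ #parabolic i) #roots (λ i → #trace i ℕ.* (2 ℕ.∸ ρ)))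
              (≡.cong₂ ℕ._+_
                (≡.cong₂ ℕ._+_ (≡.trans (split₃ #good #good #parabolic) (≡.cong (goods ℕ.+ goods ℕ.+_) (count-parabolic 2≉0 dual≉0)))
                               (sum-charRoots ¬scalar))
                (≡.trans (sum-*ʳ #trace (2 ℕ.∸ ρ)) (≡.trans (≡.cong (ℕ._* (2 ℕ.∸ ρ)) count-traceless) (ℕ.*-identityˡ _))))

            combine : ∀ {g g′ δ δ′ R R′ l l′} → g ≡ g′ → δ ≡ δ′ → R ≡ R′ → l ≡ l′ →
                      g ℕ.+ g ℕ.+ δ ℕ.+ R ℕ.+ l ℕ.* (2 ℕ.∸ ρ) ≡ g′ ℕ.+ g′ ℕ.+ δ′ ℕ.+ R′ ℕ.+ l′ ℕ.* (2 ℕ.∸ ρ)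
            combine ≡.refl ≡.refl ≡.refl ≡.refl = ≡.refl

            cases : ∀ i → Dec (LinearZero p r i) → Roots (tr (member i)) (det (member i)) → f i ≡ 2
            cases i (yes zero-i) _ = ≡.trans
              (combine (indicator-no (good? (member i)) (not-good-traceless i zero-i))
                       -- A traceless parabolic member would satisfy 4 det = 0.
                       (indicator-no (parabolic? i) (λ eq → det≉0 (px i) (py i) (point-nonZero i)
                         (cancel (*-≉0 2≉0 2≉0) (trans (sym eq) (×-≈0 refl (traceless i zero-i))))))
                       (charRoots-traceless pr≉0 i zero-i)
                       (indicator-yes (trace? i) zero-i))
              (≡.trans (≡.cong (ρ ℕ.+_) (ℕ.*-identityˡ (2 ℕ.∸ ρ))) (ℕ.m+[n∸m]≡n (roots≤2 0# (δ * dual p r))))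
            cases i (no nz) (none _ eq) = combine
              (indicator-yes (good? (member i)) (tr≉0 i nz , eq))
              (indicator-no (parabolic? i) (λ par → contradiction (≡.trans (≡.sym eq) (discriminant≈0⇒roots≡1 2≉0 par)) λ ()))
              eq (indicator-no (trace? i) nz)
            cases i (no nz) (double _ _ _ eq) = combine
              (indicator-no (good? (member i)) (λ good → contradiction (≡.trans (≡.sym eq) (proj₂ good)) λ ()))
              (indicator-yes (parabolic? i) (roots-odd _ _ eq))
              eq (indicator-no (trace? i) nz)
            cases i (no nz) (simple _ _ _ _ _ eq) = combine
              (indicator-no (good? (member i)) (λ good → contradiction (≡.trans (≡.sym eq) (proj₂ good)) λ ()))
              (indicator-no (parabolic? i) (λ par → contradiction (≡.trans (≡.sym eq) (discriminant≈0⇒roots≡1 2≉0 par)) λ ()))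
              eq (indicator-no (trace? i) nz)

            pointwise : ∀ i → f i ≡ 2
            pointwise i = cases i (trace? i) (roots-view _ _)

          -- Here one root means trace zero, so the traceless member gets weight 1 + 1 and every
          -- other member 2 + 0 or 0 + 2.
          goods-even : 2# ≈ 0# → goods ℕ.+ goods ≡ q
          goods-even 2≈0 = ℕ.+-cancelʳ-≡ (suc q ℕ.+ 1) (goods ℕ.+ goods) q (≡.trans (≡.sym total)
            (≡.trans (sum-cong-≗ pointwise) (≡.trans (sum-const (suc q) 2)
              (suc-double q))))
            where
            open Even 2≈0
            f : Point → ℕ
            f i = #good i ℕ.+ #good i ℕ.+ (#roots i ℕ.+ #trace i)

            total : sum f ≡ goods ℕ.+ goods ℕ.+ (suc q ℕ.+ 1)
            total = ≡.trans (split₃ #good #good (λ i → #roots i ℕ.+ #trace i)) (≡.cong (goods ℕ.+ goods ℕ.+_)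
              (≡.trans (∑-distrib-+ #roots #trace) (≡.cong₂ ℕ._+_ (sum-charRoots ¬scalar) count-traceless)))

            combine : ∀ {g g′ R R′ l l′} → g ≡ g′ → R ≡ R′ → l ≡ l′ → g ℕ.+ g ℕ.+ (R ℕ.+ l) ≡ g′ ℕ.+ g′ ℕ.+ (R′ ℕ.+ l′)
            combine ≡.refl ≡.refl ≡.refl = ≡.refl

            cases : ∀ i → Dec (LinearZero p r i) → Roots (tr (member i)) (det (member i)) → f i ≡ 2
            cases i (yes zero-i) _ = combine
              (indicator-no (good? (member i)) (not-good-traceless i zero-i))
              (≈0⇒roots≡1 (traceless i zero-i)) (indicator-yes (trace? i) zero-i)
            cases i (no nz) (none _ eq) = combine
              (indicator-yes (good? (member i)) (tr≉0 i nz , eq)) eq (indicator-no (trace? i) nz)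
            cases i (no nz) (double _ _ _ eq) = contradiction (roots≡1⇒≈0 eq) (tr≉0 i nz)
            cases i (no nz) (simple _ _ _ _ _ eq) = combine
              (indicator-no (good? (member i)) (λ good → contradiction (≡.trans (≡.sym eq) (proj₂ good)) λ ()))
              eq (indicator-no (trace? i) nz)

            pointwise : ∀ i → f i ≡ 2
            pointwise i = cases i (trace? i) (roots-view _ _)

        module WithScalar (i₀ : Point) (scalar₀ : Scalar (member i₀)) where

          private
            scalar-tr : ∀ M → Scalar M → tr M ≈ 2# * Mat₂.m₁₁ M
            scalar-tr (mat a b c e) (_ , _ , a≈e) =
              trans (+-congˡ (sym a≈e)) (solve 1 (λ a → a :+ a := con (+ 2) :* a) refl a)

            scalar-det : ∀ M → Scalar M → Mat₂.m₁₁ M ≈ 0# → det M ≈ 0#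
            scalar-det (mat a b c e) (_ , c≈0 , _) a≈0 =
              +×-≈0 (solve 4 (λ a b c e → a :* e :- b :* c := e :* a :+ (:- b) :* c) refl a b c e) a≈0 c≈0

          -- Of the q + 1 members one is scalar and another one traceless: a traceless scalar a has
          -- 2a = 0, hence determinant 0. All the others are good.
          goods-odd : ¬ 2# ≈ 0# → goods ≡ q ℕ.∸ 1
          goods-odd 2≉0 = ≡.cong ℕ.pred (ℕ.suc-injective (≡.trans (≡.trans (ℕ.+-comm 2 goods) (≡.sym (ℕ.+-assoc goods 1 1))) (≡.trans (≡.sym total)
            (≡.trans (sum-cong-≗ pointwise) (≡.trans (sum-const (suc q) 1) (ℕ.*-identityʳ (suc q)))))))
            where
            f : Point → ℕ
            f i = #good i ℕ.+ #trace i ℕ.+ #scalar i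

            total : sum f ≡ goods ℕ.+ 1 ℕ.+ 1
            total = ≡.trans (split₃ #good #trace #scalar)
              (≡.cong₂ ℕ._+_ (≡.cong (goods ℕ.+_) count-traceless)
                (count-unique (λ i → scalar? (member i)) i₀ scalar₀ (λ j scalar → scalar-unique {j} {i₀} scalar scalar₀)))

            cases : ∀ i → Dec (Scalar (member i)) → Dec (LinearZero p r i) → f i ≡ 1
            cases i (yes scalar) _ = ≡.cong₂ ℕ._+_
              (≡.cong₂ ℕ._+_ (indicator-no (good? (member i)) (scalar⇒charRoots≢0 (member i) scalar ∘ proj₂))
                (indicator-no (trace? i) (λ zero-i → det≉0 (px i) (py i) (point-nonZero i)
                        (scalar-det (member i) scalar (cancel 2≉0 (trans (sym (scalar-tr (member i) scalar)) (traceless i zero-i)))))))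
              (indicator-yes (scalar? (member i)) scalar)
            cases i (no ¬scalar) (yes zero-i) = ≡.cong₂ ℕ._+_
              (≡.cong₂ ℕ._+_ (indicator-no (good? (member i)) (not-good-traceless i zero-i)) (indicator-yes (trace? i) zero-i))
              (indicator-no (scalar? (member i)) ¬scalar)
            cases i (no ¬scalar) (no nz) = ≡.cong₂ ℕ._+_
              (≡.cong₂ ℕ._+_ (indicator-yes (good? (member i)) (tr≉0 i nz , charRoots-away-from-scalar i i₀ scalar₀ ¬scalar))
                             (indicator-no (trace? i) nz))
              (indicator-no (scalar? (member i)) ¬scalar)

            pointwise : ∀ i → f i ≡ 1
            pointwise i = cases i (scalar? (member i)) (trace? i)

          -- In characteristic 2 scalars have trace zero, so the scalar is itself the traceless
          -- member and only one member is lost.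
          goods-even : 2# ≈ 0# → goods ≡ q
          goods-even 2≈0 = ℕ.suc-injective (≡.trans (ℕ.+-comm 1 goods) (≡.trans (≡.sym total)
            (≡.trans (sum-cong-≗ pointwise) (≡.trans (sum-const (suc q) 1) (ℕ.*-identityʳ (suc q))))))
            where
            open Even 2≈0
            f : Point → ℕ
            f i = #good i ℕ.+ #trace i

            total : sum f ≡ goods ℕ.+ 1
            total = ≡.trans (∑-distrib-+ #good #trace) (≡.cong (goods ℕ.+_) count-traceless)

            cases : ∀ i → Dec (LinearZero p r i) → f i ≡ 1
            cases i (yes zero-i) = ≡.cong₂ ℕ._+_
              (indicator-no (good? (member i)) (not-good-traceless i zero-i)) (indicator-yes (trace? i) zero-i)
            cases i (no nz) = ≡.cong₂ ℕ._+_
              (indicator-yes (good? (member i)) (tr≉0 i nz , charRoots-away-from-scalar i i₀ scalar₀ ¬scalar))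
              (indicator-no (trace? i) nz)
              where
              ¬scalar : ¬ Scalar (member i)
              ¬scalar scalar = tr≉0 i nz (trans (scalar-tr (member i) scalar) (trans (*-comm _ _) (×-≈0 refl 2≈0)))

            pointwise : ∀ i → f i ≡ 1
            pointwise i = cases i (trace? i)

  -- The two pencils of a coset

  -- These are u + vX and (u + vX)Y for X = ( 0 −d ; 1 t ) and Y = ( 1 t ; 0 −1 ).
  rotation reflection : (t d u v : Carrier) → Matrix
  rotation   t d u v = mat u (- (d * v)) v (u + t * v)
  reflection t d u v = mat u (t * u + d * v) v (- u)

  scalar-member : ∀ H H′ {u v} → NonZero₂ u v → Scalar (combination H H′ u v) →
                  Scalar (combination H H′ (px (point u v)) (py (point u v)))
  scalar-member (mat a b c e) (mat a′ b′ c′ e′) {u} {v} nz (b≈0 , c≈0 , a≈e) with s , s≉0 , u≈ , v≈ ← point-scale nz =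
    cancel s≉0 (trans (scaled b b′) b≈0) , cancel s≉0 (trans (scaled c c′) c≈0) ,
    cancel-≈ s≉0 (trans (scaled a a′) (trans a≈e (sym (scaled e e′))))
    where
    scaled : ∀ z z′ → s * (px (point u v) * z + py (point u v) * z′) ≈ u * z + v * z′
    scaled z z′ = trans
      (solve 5 (λ s x y z z′ → s :* (x :* z :+ y :* z′) :=
            (s :* x) :* z :+ (s :* y) :* z′) refl s (px (point u v)) (py (point u v)) z z′)
      (+-cong (*-congʳ (sym u≈)) (*-congʳ (sym v≈)))

  module Cosets (t d : Carrier) (no-root : ∀ x → ¬ quadratic t d x ≈ 0#) (disc≉0 : ¬ disc t d ≈ 0#)
    (a b c e : Carrier) (Δ≉0 : ¬ det (mat a b c e) ≈ 0#) where

    -- For g = ( a b ; c e ) and the matrices X, Y above, p₁ and r₁ are the traces of g and gX, and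
    -- p₂ and r₂ those of gY and gXY. The four matrices below are g, gX, gY and gXY.
    Δ p₁ r₁ p₂ r₂ : Carrier
    Δ  = det (mat a b c e)
    p₁ = a + e
    r₁ = b - d * c + t * e
    p₂ = a + t * c - e
    r₂ = b + d * c

    rotations rotations′ reflections reflections′ : Matrix
    rotations    = mat a b c e
    rotations′   = mat b (- (d * a) + t * b) e (- (d * c) + t * e)
    reflections  = mat a (t * a - b) c (t * c - e)
    reflections′ = mat b (d * a) e (d * c)

    dual-nonZero : ∀ {p r} → NonZero₂ p r → ¬ dual t d p r ≈ 0#
    dual-nonZero {p} {r} nz eq = norm-anisotropic t d no-root r (- p) (perp-nonZero nz) (trans
      (solve 4 (λ t d p r → r :* r :+ t :* r :* (:- p) :+ d :* (:- p) :* (:- p) :=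
            r :* r :- t :* p :* r :+ d :* p :* p) refl t d p r) eq)

    -- The identity behind the cancellation: it turns the determinant that governs the parabolic
    -- members of one pencil into that of the traceless member of the other.
    dual-relation : dual t d p₁ r₁ + Δ * disc t d ≈ dual t d p₂ r₂
    dual-relation = solve 6 (λ t d a b c e →
      let p₁ = a :+ e
          r₁ = b :- d :* c :+ t :* e
          p₂ = a :+ t :* c :- e
          r₂ = b :+ d :* c
      in (r₁ :* r₁ :- t :* p₁ :* r₁ :+ d :* p₁ :* p₁) :+ (a :* e :- b :* c) :* (t :* t :- con (+ 2) :* con (+ 2) :* d) :=
         r₂ :* r₂ :- t :* p₂ :* r₂ :+ d :* p₂ :* p₂) refl t d a b c e

    dual-relation′ : dual t d p₂ r₂ + (- Δ) * disc t d ≈ dual t d p₁ r₁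
    dual-relation′ = trans (+-congʳ (sym dual-relation))
      (solve 3 (λ D Δ k → D :+ Δ :* k :+ (:- Δ) :* k := D) refl (dual t d p₁ r₁) Δ (disc t d))

    -Δ≉0 : ¬ - Δ ≈ 0#
    -Δ≉0 eq = Δ≉0 (trans (sym (-‿involutive Δ)) (trans (-‿cong eq) -0#≈0#))

    module Rot = NormPencil t d no-root rotations rotations′ p₁ r₁ Δ Δ≉0
      (λ u v → solve 8 (λ t d a b c e u v → u :* a :+ v :* b :+ (u :* e :+ v :* (:- (d :* c) :+ t :* e)) :=
        (a :+ e) :* u :+ (b :- d :* c :+ t :* e) :* v) refl t d a b c e u v)
      (λ u v → solve 8 (λ t d a b c e u v →
        (u :* a :+ v :* b) :* (u :* e :+ v :* (:- (d :* c) :+ t :* e)) :- (u :* b :+ v :* (:- (d :* a) :+ t :* b)) :* (u :* c :+ v :* e) :=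
        (a :* e :- b :* c) :* (u :* u :+ t :* u :* v :+ d :* v :* v)) refl t d a b c e u v)

    module Refl = NormPencil t d no-root reflections reflections′ p₂ r₂ (- Δ) -Δ≉0
      (λ u v → solve 8 (λ t d a b c e u v → u :* a :+ v :* b :+ (u :* (t :* c :- e) :+ v :* (d :* c)) :=
        (a :+ t :* c :- e) :* u :+ (b :+ d :* c) :* v) refl t d a b c e u v)
      (λ u v → solve 8 (λ t d a b c e u v →
        (u :* a :+ v :* b) :* (u :* (t :* c :- e) :+ v :* (d :* c)) :- (u :* (t :* a :- b) :+ v :* (d :* a)) :* (u :* c :+ v :* e) :=
        (:- (a :* e :- b :* c)) :* (u :* u :+ t :* u :* v :+ d :* v :* v)) refl t d a b c e u v)

    +×³-≈0 : ∀ {x y₁ y₂ y₃ e₁ e₂ e₃} → x ≈ y₁ * e₁ + y₂ * e₂ + y₃ * e₃ → e₁ ≈ 0# → e₂ ≈ 0# → e₃ ≈ 0# → x ≈ 0#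
    +×³-≈0 x≈ e₁≈0 e₂≈0 e₃≈0 = trans x≈ (trans (+-cong (+×-≈0 refl e₁≈0 e₂≈0) (×-≈0 refl e₃≈0)) (+-identityˡ 0#))

    -- Put h = g(u + vX), and let z̄ be the conjugate u + tv - vX. Then N(u, v)g = hz̄, so N(u, v)
    -- times p₂ or r₂ is the trace of hz̄Y or hz̄XY. These are traces of traceless matrices if h is
    -- scalar; the identities write them in h₁₁ - h₂₂, h₁₂ and h₂₁.
    rotation-not-scalar : NonZero₂ p₂ r₂ → ∀ u v → NonZero₂ u v → ¬ Scalar (combination rotations rotations′ u v)
    rotation-not-scalar nz u v uv≉0 (h₁₂≈0 , h₂₁≈0 , h₁₁≈h₂₂) = nz
      ( cancel (norm-anisotropic t d no-root u v uv≉0) (+×³-≈0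
          (solve 8 (λ t d a b c e u v →
            (u :* u :+ t :* u :* v :+ d :* v :* v) :* (a :+ t :* c :- e) :=
            (u :+ t :* v) :* ((u :* a :+ v :* b) :- (u :* e :+ v :* (:- (d :* c) :+ t :* e))) :+
            (:- v) :* (u :* b :+ v :* (:- (d :* a) :+ t :* b)) :+
            (t :* (u :+ t :* v) :- d :* v) :* (u :* c :+ v :* e)) refl t d a b c e u v)
          (x≈y⇒x∙y⁻¹≈ε h₁₁≈h₂₂) h₁₂≈0 h₂₁≈0)
      , cancel (norm-anisotropic t d no-root u v uv≉0) (+×³-≈0
          (solve 8 (λ t d a b c e u v →
            (u :* u :+ t :* u :* v :+ d :* v :* v) :* (b :+ d :* c) :=
            (d :* v) :* ((u :* a :+ v :* b) :- (u :* e :+ v :* (:- (d :* c) :+ t :* e))) :+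
            u :* (u :* b :+ v :* (:- (d :* a) :+ t :* b)) :+
            (d :* (u :+ t :* v)) :* (u :* c :+ v :* e)) refl t d a b c e u v)
          (x≈y⇒x∙y⁻¹≈ε h₁₁≈h₂₂) h₁₂≈0 h₂₁≈0) )

    -- As for rotations, with the reflection R = (u + vX)Y taking the place of the conjugate: R² =
    -- N(u, v), so N(u, v)g = hR for h = gR, and R and RX are traceless.
    reflection-not-scalar : NonZero₂ p₁ r₁ → ∀ u v → NonZero₂ u v → ¬ Scalar (combination reflections reflections′ u v)
    reflection-not-scalar nz u v uv≉0 (h₁₂≈0 , h₂₁≈0 , h₁₁≈h₂₂) = nz
      ( cancel (norm-anisotropic t d no-root u v uv≉0) (+×³-≈0
          (solve 8 (λ t d a b c e u v →
            (u :* u :+ t :* u :* v :+ d :* v :* v) :* (a :+ e) :=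
            u :* ((u :* a :+ v :* b) :- (u :* (t :* c :- e) :+ v :* (d :* c))) :+
            v :* (u :* (t :* a :- b) :+ v :* (d :* a)) :+
            (t :* u :+ d :* v) :* (u :* c :+ v :* e)) refl t d a b c e u v)
          (x≈y⇒x∙y⁻¹≈ε h₁₁≈h₂₂) h₁₂≈0 h₂₁≈0)
      , cancel (norm-anisotropic t d no-root u v uv≉0) (+×³-≈0
          (solve 8 (λ t d a b c e u v →
            (u :* u :+ t :* u :* v :+ d :* v :* v) :* (b :- d :* c :+ t :* e) :=
            (t :* u :+ d :* v) :* ((u :* a :+ v :* b) :- (u :* (t :* c :- e) :+ v :* (d :* c))) :+
            (:- u) :* (u :* (t :* a :- b) :+ v :* (d :* a)) :+
            (t :* (t :* u :+ d :* v) :- d :* u) :* (u :* c :+ v :* e)) refl t d a b c e u v)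
          (x≈y⇒x∙y⁻¹≈ε h₁₁≈h₂₂) h₁₂≈0 h₂₁≈0) )

    -- The hypotheses say that g = a + cX, and (a + tc) - cX is its conjugate.
    rotation-scalar : p₂ ≈ 0# → r₂ ≈ 0# → Scalar (combination rotations rotations′ (a + t * c) (- c))
    rotation-scalar p₂≈0 r₂≈0 =
      ×-≈0 (solve 5 (λ t d a b c → (a :+ t :* c) :* b :+ (:- c) :* (:- (d :* a) :+ t :* b) :=
            a :* (b :+ d :* c)) refl t d a b c) r₂≈0 ,
      ×-≈0 (solve 4 (λ t a c e → (a :+ t :* c) :* c :+ (:- c) :* e :=
            c :* (a :+ t :* c :- e)) refl t a c e) p₂≈0 ,
      x∙y⁻¹≈ε⇒x≈y _ _ (+×-≈0 (solve 6 (λ t d a b c e →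
        (a :+ t :* c) :* a :+ (:- c) :* b :- ((a :+ t :* c) :* e :+ (:- c) :* (:- (d :* c) :+ t :* e)) :=
        a :* (a :+ t :* c :- e) :+ (:- c) :* (b :+ d :* c)) refl t d a b c e) p₂≈0 r₂≈0)

    -- The hypotheses say that g = (a + cX)Y, which has scalar square.
    reflection-scalar : p₁ ≈ 0# → r₁ ≈ 0# → Scalar (combination reflections reflections′ a c)
    reflection-scalar p₁≈0 r₁≈0 =
      +×-≈0 (solve 6 (λ t d a b c e → a :* (t :* a :- b) :+ c :* (d :* a) :=
        (a :* t) :* (a :+ e) :+ (:- a) :* (b :- d :* c :+ t :* e)) refl t d a b c e) p₁≈0 r₁≈0 ,
      ×-≈0 (solve 3 (λ a c e → a :* c :+ c :* e := c :* (a :+ e)) refl a c e) p₁≈0 ,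
      x∙y⁻¹≈ε⇒x≈y _ _ (+×-≈0 (solve 6 (λ t d a b c e →
        a :* a :+ c :* b :- (a :* (t :* c :- e) :+ c :* (d :* c)) :=
        (a :- t :* c) :* (a :+ e) :+ c :* (b :- d :* c :+ t :* e)) refl t d a b c e) p₁≈0 r₁≈0)

    column-nonZero : NonZero₂ a c
    column-nonZero (a≈0 , c≈0) = Δ≉0 (+×-≈0 (solve 4 (λ a b c e → a :* e :- b :* c :=
          e :* a :+ (:- b) :* c) refl a b c e) a≈0 c≈0)

    conjugate-nonZero : NonZero₂ (a + t * c) (- c)
    conjugate-nonZero (a+tc≈0 , -c≈0) = column-nonZero
      (+×-≈0 (solve 3 (λ t a c → a := con (+ 1) :* (a :+ t :* c) :+ t :* (:- c)) refl t a c) a+tc≈0 -c≈0 ,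
       trans (sym (-‿involutive c)) (trans (-‿cong -c≈0) -0#≈0#))

    -- If both trace forms vanished, `dual-relation` would read Δ(t² - 4d) = 0.
    L₂≈0⇒L₁≉0 : p₂ ≈ 0# → r₂ ≈ 0# → NonZero₂ p₁ r₁
    L₂≈0⇒L₁≉0 p₂≈0 r₂≈0 (p₁≈0 , r₁≈0) = *-≉0 Δ≉0 disc≉0 (begin
      Δ * disc t d                       ≈⟨ solve 2 (λ D x → x :=
            D :+ x :- D) refl (dual t d p₁ r₁) (Δ * disc t d) ⟩
      dual t d p₁ r₁ + Δ * disc t d - dual t d p₁ r₁ ≈⟨ +-congʳ dual-relation ⟩
      dual t d p₂ r₂ - dual t d p₁ r₁    ≈⟨ +-cong (dual-zero p₂≈0 r₂≈0) (-‿cong (dual-zero p₁≈0 r₁≈0)) ⟩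
      0# - 0#                            ≈⟨ -‿inverseʳ 0# ⟩
      0#                                 ∎)
      where
      dual-zero : ∀ {p r} → p ≈ 0# → r ≈ 0# → dual t d p r ≈ 0#
      dual-zero {p} {r} p≈0 r≈0 = +×-≈0 (solve 4 (λ t d p r →
        r :* r :- t :* p :* r :+ d :* p :* p := (d :* p :- t :* r) :* p :+ r :* r) refl t d p r) p≈0 r≈0

    private
      x≤2 = roots≤2 0# (Δ * dual t d p₁ r₁)
      y≤2 = roots≤2 0# (- Δ * dual t d p₂ r₂)

      y-≈ : - Δ * dual t d p₂ r₂ ≈ - (Δ * (dual t d p₁ r₁ + Δ * disc t d))
      y-≈ = trans (*-congˡ (sym dual-relation)) (solve 2 (λ Δ x → (:- Δ) :* x := :- (Δ :* x)) refl Δ _)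

      x-≈ : Δ * dual t d p₁ r₁ ≈ - (- Δ * (dual t d p₂ r₂ + - Δ * disc t d))
      x-≈ = trans (*-congˡ (sym dual-relation′)) (solve 2 (λ Δ x → Δ :* x := :- ((:- Δ) :* x)) refl Δ _)

    goods-odd : ¬ 2# ≈ 0# → Rot.goods ℕ.+ Refl.goods ≡ q ℕ.∸ 1
    goods-odd 2≉0 = cases ((p₂ ≟ 0#) ×-dec (r₂ ≟ 0#)) ((p₁ ≟ 0#) ×-dec (r₁ ≟ 0#))
      where
      cases : Dec (p₂ ≈ 0# × r₂ ≈ 0#) → Dec (p₁ ≈ 0# × r₁ ≈ 0#) → Rot.goods ℕ.+ Refl.goods ≡ q ℕ.∸ 1
      cases (yes (p₂≈0 , r₂≈0)) _ = ≡.trans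
        (≡.cong₂ ℕ._+_ (Rot.WithScalar.goods-odd (L₂≈0⇒L₁≉0 p₂≈0 r₂≈0) (point (a + t * c) (- c))
                          (scalar-member rotations rotations′ conjugate-nonZero (rotation-scalar p₂≈0 r₂≈0)) 2≉0)
                       (Refl.goods-traceless (λ nz → nz (p₂≈0 , r₂≈0))))
        (ℕ.+-identityʳ _)
      cases (no L₂≉0) (yes (p₁≈0 , r₁≈0)) =
        ≡.cong₂ ℕ._+_ (Rot.goods-traceless (λ nz → nz (p₁≈0 , r₁≈0)))
                      (Refl.WithScalar.goods-odd L₂≉0 (point a c) (scalar-member reflections reflections′ column-nonZero (reflection-scalar p₁≈0 r₁≈0)) 2≉0)
      -- By `y-≈` and `x-≈`, the parabolic count of each pencil is the root count at the traceless
      -- member of the other, as `goods-cancel` requires.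
      cases (no L₂≉0) (no L₁≉0) = goods-cancel Rot.goods Refl.goods (roots 0# (Δ * dual t d p₁ r₁)) (roots 0# (- Δ * dual t d p₂ r₂)) q x≤2 y≤2
        (≡.trans (≡.cong (λ y → Rot.goods ℕ.+ Rot.goods ℕ.+ y ℕ.+ suc q ℕ.+ (2 ℕ.∸ roots 0# (Δ * dual t d p₁ r₁))) (roots-cong refl y-≈))
          (Rot.NoScalar.goods-odd L₁≉0 (λ i → rotation-not-scalar L₂≉0 _ _ (point-nonZero i)) 2≉0
            (λ eq → dual-nonZero L₂≉0 (trans (sym dual-relation) eq))))
        (≡.trans (≡.cong (λ x → Refl.goods ℕ.+ Refl.goods ℕ.+ x ℕ.+ suc q ℕ.+ (2 ℕ.∸ roots 0# (- Δ * dual t d p₂ r₂))) (roots-cong refl x-≈))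
          (Refl.NoScalar.goods-odd L₂≉0 (λ i → reflection-not-scalar L₁≉0 _ _ (point-nonZero i)) 2≉0
            (λ eq → dual-nonZero L₁≉0 (trans (sym dual-relation′) eq))))
    goods-even : 2# ≈ 0# → Rot.goods ℕ.+ Refl.goods ≡ q
    goods-even 2≈0 = cases ((p₂ ≟ 0#) ×-dec (r₂ ≟ 0#)) ((p₁ ≟ 0#) ×-dec (r₁ ≟ 0#))
      where
      cases : Dec (p₂ ≈ 0# × r₂ ≈ 0#) → Dec (p₁ ≈ 0# × r₁ ≈ 0#) → Rot.goods ℕ.+ Refl.goods ≡ q
      cases (yes (p₂≈0 , r₂≈0)) _ = ≡.trans
        (≡.cong₂ ℕ._+_ (Rot.WithScalar.goods-even (L₂≈0⇒L₁≉0 p₂≈0 r₂≈0) (point (a + t * c) (- c))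
                          (scalar-member rotations rotations′ conjugate-nonZero (rotation-scalar p₂≈0 r₂≈0)) 2≈0)
                       (Refl.goods-traceless (λ nz → nz (p₂≈0 , r₂≈0))))
        (ℕ.+-identityʳ _)
      cases (no L₂≉0) (yes (p₁≈0 , r₁≈0)) =
        ≡.cong₂ ℕ._+_ (Rot.goods-traceless (λ nz → nz (p₁≈0 , r₁≈0)))
                      (Refl.WithScalar.goods-even L₂≉0 (point a c) (scalar-member reflections reflections′ column-nonZero (reflection-scalar p₁≈0 r₁≈0)) 2≈0)
      cases (no L₂≉0) (no L₁≉0) = double-cancel Rot.goods Refl.goods q
        (Rot.NoScalar.goods-even L₁≉0 (λ i → rotation-not-scalar L₂≉0 _ _ (point-nonZero i)) 2≈0)
        (Refl.NoScalar.goods-even L₂≉0 (λ i → reflection-not-scalar L₁≉0 _ _ (point-nonZero i)) 2≈0)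

  -- Classes in PGL(2, q) as matrices up to scalars

  private
    module M = Monoid (Mat₂-monoid commutativeRing)
  module PGL = Group (PGL[2, F ])

  infix 4 _≋_
  _≋_ : Matrix → Matrix → Set ℓ₁
  _≋_ = _≈ᴹ_ commutativeRing

  infixl 7 _⊗_
  _⊗_ : Matrix → Matrix → Matrix
  _⊗_ = _*ᴹ_ commutativeRing

  infixr 8 _•_
  _•_ : Carrier → Matrix → Matrix
  s • mat a b c e = mat (s * a) (s * b) (s * c) (s * e)

  adj : Matrix → Matrix
  adj (mat a b c e) = mat e (- b) (- c) a

  matrix : PGL.Carrier → Matrix
  matrix = proj₁

  I : Matrix
  I = scalarMat commutativeRing 1#

  •-cong : ∀ s {M N} → M ≋ N → s • M ≋ s • N
  •-cong s (mat≈ p q r t) = mat≈ (*-congˡ p) (*-congˡ q) (*-congˡ r) (*-congˡ t)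

  •-assoc : ∀ {s s′} → s * s′ ≈ 1# → ∀ M → M ≋ s • s′ • M
  •-assoc {s} {s′} ss′≈1 (mat a b c e) = mat≈ (go a) (go b) (go c) (go e)
    where
    go : ∀ x → x ≈ s * (s′ * x)
    go x = trans (sym (*-identityˡ x)) (trans (*-congʳ (sym ss′≈1)) (*-assoc s s′ x))

  •-• : ∀ s s′ M → s • s′ • M ≋ (s * s′) • M
  •-• s s′ (mat a b c e) = mat≈ (sym (*-assoc s s′ a)) (sym (*-assoc s s′ b)) (sym (*-assoc s s′ c)) (sym (*-assoc s s′ e))

  •-flip : ∀ {s M N} → ¬ s ≈ 0# → M ≋ s • N → ∃[ s′ ] ¬ s′ ≈ 0# × N ≋ s′ • M
  •-flip {s} {M} {N} s≉0 eq = let s′ , ss′≈1 = inverse s≉0 ; s′s≈1 = trans (*-comm s′ s) ss′≈1 in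
    s′ , factor-≉0 s′s≈1 , M.trans (•-assoc s′s≈1 N) (•-cong s′ (M.sym eq))

  tr-cong : ∀ {M N} → M ≋ N → tr M ≈ tr N
  tr-cong (mat≈ p _ _ s) = +-cong p s

  det-cong : ∀ {M N} → M ≋ N → det M ≈ det N
  det-cong (mat≈ p q r s) = +-cong (*-cong p s) (-‿cong (*-cong q r))

  det-* : ∀ M N → det (M ⊗ N) ≈ det M * det N
  det-* (mat a b c e) (mat a′ b′ c′ e′) = solve 8 (λ a b c e a′ b′ c′ e′ →
    (a :* a′ :+ b :* c′) :* (c :* b′ :+ e :* e′) :- (a :* b′ :+ b :* e′) :* (c :* a′ :+ e :* c′) :=
    (a :* e :- b :* c) :* (a′ :* e′ :- b′ :* c′)) refl a b c e a′ b′ c′ e′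

  det-• : ∀ s M → det (s • M) ≈ s * s * det M
  det-• s (mat a b c e) = solve 5 (λ s a b c e →
    s :* a :* (s :* e) :- s :* b :* (s :* c) := s :* s :* (a :* e :- b :* c)) refl s a b c e

  det-I : det I ≈ 1#
  det-I = solve 0 (con (+ 1) :* con (+ 1) :- con (+ 0) :* con (+ 0) := con (+ 1)) refl

  ⊗-adj : ∀ M → M ⊗ adj M ≋ scalarMat commutativeRing (det M)
  ⊗-adj (mat a b c e) = mat≈
    (solve 4 (λ a b c e → a :* e :+ b :* (:- c) := a :* e :- b :* c) refl a b c e)
    (solve 2 (λ a b → a :* (:- b) :+ b :* a := con (+ 0)) refl a b)
    (solve 2 (λ c e → c :* e :+ e :* (:- c) := con (+ 0)) refl c e)
    (solve 4 (λ a b c e → c :* (:- b) :+ e :* a := a :* e :- b :* c) refl a b c e)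

  adj-⊗ : ∀ M → adj M ⊗ M ≋ scalarMat commutativeRing (det M)
  adj-⊗ (mat a b c e) = mat≈
    (solve 4 (λ a b c e → e :* a :+ (:- b) :* c := a :* e :- b :* c) refl a b c e)
    (solve 2 (λ b e → e :* b :+ (:- b) :* e := con (+ 0)) refl b e)
    (solve 2 (λ a c → (:- c) :* a :+ a :* c := con (+ 0)) refl a c)
    (solve 4 (λ a b c e → (:- c) :* b :+ a :* e := a :* e :- b :* c) refl a b c e)

  ⊗-scalar : ∀ M s → M ⊗ scalarMat commutativeRing s ≋ s • M
  ⊗-scalar (mat a b c e) s = mat≈ (l a b) (r a b) (l c e) (r c e)
    where
    l : ∀ x y → x * s + y * 0# ≈ s * x
    l = solve 3 (λ s x y → x :* s :+ y :* con (+ 0) := s :* x) refl s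
    r : ∀ x y → x * 0# + y * s ≈ s * y
    r = solve 3 (λ s x y → x :* con (+ 0) :+ y :* s := s :* y) refl s

  ⊗-• : ∀ M s N → M ⊗ (s • N) ≋ s • (M ⊗ N)
  ⊗-• (mat a b c e) s (mat a′ b′ c′ e′) = mat≈ (go a b a′ c′) (go a b b′ e′) (go c e a′ c′) (go c e b′ e′)
    where
    go : ∀ x y x′ y′ → x * (s * x′) + y * (s * y′) ≈ s * (x * x′ + y * y′)
    go = solve 5 (λ s x y x′ y′ → x :* (s :* x′) :+ y :* (s :* y′) := s :* (x :* x′ :+ y :* y′)) refl s

  •-⊗ : ∀ s M N → (s • M) ⊗ N ≋ s • (M ⊗ N)
  •-⊗ s (mat a b c e) (mat a′ b′ c′ e′) = mat≈ (go a b a′ c′) (go a b b′ e′) (go c e a′ c′) (go c e b′ e′)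
    where
    go : ∀ x y x′ y′ → s * x * x′ + s * y * y′ ≈ s * (x * x′ + y * y′)
    go = solve 5 (λ s x y x′ y′ → s :* x :* x′ :+ s :* y :* y′ := s :* (x :* x′ :+ y :* y′)) refl s

  •-I : ∀ s → s • I ≋ scalarMat commutativeRing s
  •-I s = mat≈ (*-identityʳ s) (zeroʳ s) (zeroʳ s) (*-identityʳ s)

  det≉0 : ∀ g → ¬ det (matrix g) ≈ 0#
  det≉0 (M , M⁻¹ , _ , MM⁻¹≈I) = factor-≉0 (trans (sym (det-* M M⁻¹)) (trans (det-cong MM⁻¹≈I) det-I))

  fromMatrix : ∀ M → ¬ det M ≈ 0# → PGL.Carrier
  fromMatrix M detM≉0 = M , w • adj M ,
    M.trans (•-⊗ w (adj M) M) (unit (adj-⊗ M)) ,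
    M.trans (⊗-• M w (adj M)) (unit (⊗-adj M))
    where
    w = proj₁ (inverse detM≉0)

    unit : ∀ {N} → N ≋ scalarMat commutativeRing (det M) → w • N ≋ I
    unit (mat≈ p q r s) = mat≈ (normalise p) (×-≈0 refl q) (×-≈0 refl r) (normalise s)
      where
      normalise : ∀ {x} → x ≈ det M → w * x ≈ 1#
      normalise x≈ = trans (*-congˡ x≈) (trans (*-comm w (det M)) (proj₂ (inverse detM≉0)))

  -- Equality in the quotient says that M⁻¹N is a scalar s; it is nonzero because det N = s² det M
  -- is.
  ≈⇒proportional : ∀ {g h} → g PGL.≈ h → ∃[ s ] ¬ s ≈ 0# × matrix h ≋ s • matrix g
  ≈⇒proportional {g@(M , M⁻¹ , _ , MM⁻¹≈I)} {h@(N , _)} (s , eq) = s , s≉0 , N≋sM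
    where
    N≋sM : N ≋ s • M
    N≋sM = M.trans (M.sym (M.identityˡ N)) (M.trans (M.∙-congʳ (M.sym MM⁻¹≈I))
      (M.trans (M.assoc M M⁻¹ N) (M.trans (M.∙-congˡ {M} eq) (⊗-scalar M s))))

    s≉0 : ¬ s ≈ 0#
    s≉0 s≈0 = det≉0 h (trans (det-cong N≋sM) (trans (det-• s M) (trans (*-comm _ _) (×-≈0 refl (×-≈0 refl s≈0)))))

  proportional⇒≈ : ∀ g h s → matrix h ≋ s • matrix g → g PGL.≈ h
  proportional⇒≈ (M , M⁻¹ , M⁻¹M≈I , _) (N , _) s eq = s ,
    M.trans (M.∙-congˡ {M⁻¹} eq) (M.trans (⊗-• M⁻¹ s M) (M.trans (•-cong s M⁻¹M≈I) (•-I s)))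

  adj-≋ : ∀ g → ∃[ w ] matrix (g PGL.⁻¹) ≋ w • adj (matrix g)
  adj-≋ g@(M , M⁻¹ , M⁻¹M≈I , _) = w , M.trans (•-assoc (trans (*-comm w (det M)) (proj₂ (inverse (det≉0 g)))) M⁻¹)
    (•-cong w (M.sym (M.trans (M.sym (M.identityˡ (adj M))) (M.trans (M.∙-congʳ (M.sym M⁻¹M≈I))
      (M.trans (M.assoc M⁻¹ M (adj M)) (M.trans (M.∙-congˡ {M⁻¹} (⊗-adj M)) (⊗-scalar M⁻¹ (det M))))))))
    where w = proj₁ (inverse (det≉0 g))

  scalar-cong : ∀ {M N} → M ≋ N → Scalar M → Scalar N
  scalar-cong (mat≈ p q r s) (b≈0 , c≈0 , a≈e) = trans (sym q) b≈0 , trans (sym r) c≈0 , trans (sym p) (trans a≈e s)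

  scalar⇒≈ε : ∀ g → Scalar (matrix g) → g PGL.≈ PGL.ε
  scalar⇒≈ε g@(mat a b c e , _) (b≈0 , c≈0 , a≈e) = PGL.sym {PGL.ε} {g} (proportional⇒≈ PGL.ε g a (mat≈
    (sym (*-identityʳ a)) (trans b≈0 (sym (zeroʳ a))) (trans c≈0 (sym (zeroʳ a))) (trans (sym a≈e) (sym (*-identityʳ a)))))

  ≈ε⇒scalar : ∀ g → g PGL.≈ PGL.ε → Scalar (matrix g)
  ≈ε⇒scalar g g≈ε =
    let s , _ , eq = ≈⇒proportional {PGL.ε} {g} (PGL.sym {g} {PGL.ε} g≈ε)
    in scalar-cong (M.sym eq) (zeroʳ s , zeroʳ s , refl)

  -- The commutative algebra F[M] and its units

  affine : Matrix → Carrier → Carrier → Matrix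
  affine (mat a b c e) u v = mat (u + v * a) (v * b) (v * c) (u + v * e)

  affine-cong : ∀ M {u u′ v v′} → u ≈ u′ → v ≈ v′ → affine M u v ≋ affine M u′ v′
  affine-cong M u≈ v≈ = mat≈ (+-cong u≈ (*-congʳ v≈)) (*-congʳ v≈) (*-congʳ v≈) (+-cong u≈ (*-congʳ v≈))

  •-affine : ∀ M s u v → s • affine M u v ≋ affine M (s * u) (s * v)
  •-affine (mat a b c e) s u v = mat≈ (go a) (sym (*-assoc s v b)) (sym (*-assoc s v c)) (go e)
    where
    go : ∀ x → s * (u + v * x) ≈ s * u + s * v * x
    go = solve 4 (λ s u v x → s :* (u :+ v :* x) := s :* u :+ s :* v :* x) refl s u v

  -- Cayley–Hamilton
  affine-⊗ : ∀ M u v u′ v′ → affine M u v ⊗ affine M u′ v′ ≋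
             affine M (u * u′ - det M * (v * v′)) (u * v′ + v * u′ + tr M * (v * v′))
  affine-⊗ (mat a b c e) u v u′ v′ = mat≈
    (solve 8 (λ a b c e u v u′ v′ → (u :+ v :* a) :* (u′ :+ v′ :* a) :+ v :* b :* (v′ :* c) :=
      u :* u′ :- (a :* e :- b :* c) :* (v :* v′) :+ (u :* v′ :+ v :* u′ :+ (a :+ e) :* (v :* v′)) :* a) refl a b c e u v u′ v′)
    (solve 8 (λ a b c e u v u′ v′ → (u :+ v :* a) :* (v′ :* b) :+ v :* b :* (u′ :+ v′ :* e) :=
      (u :* v′ :+ v :* u′ :+ (a :+ e) :* (v :* v′)) :* b) refl a b c e u v u′ v′)
    (solve 8 (λ a b c e u v u′ v′ → v :* c :* (u′ :+ v′ :* a) :+ (u :+ v :* e) :* (v′ :* c) :=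
      (u :* v′ :+ v :* u′ :+ (a :+ e) :* (v :* v′)) :* c) refl a b c e u v u′ v′)
    (solve 8 (λ a b c e u v u′ v′ → v :* c :* (v′ :* b) :+ (u :+ v :* e) :* (u′ :+ v′ :* e) :=
      u :* u′ :- (a :* e :- b :* c) :* (v :* v′) :+ (u :* v′ :+ v :* u′ :+ (a :+ e) :* (v :* v′)) :* e) refl a b c e u v u′ v′)

  affine-comm : ∀ M u v u′ v′ → affine M u v ⊗ affine M u′ v′ ≋ affine M u′ v′ ⊗ affine M u v
  affine-comm M u v u′ v′ = M.trans (affine-⊗ M u v u′ v′) (M.trans
    (affine-cong M
      (solve 5 (λ d u v u′ v′ → u :* u′ :- d :* (v :* v′) :=
            u′ :* u :- d :* (v′ :* v)) refl (det M) u v u′ v′)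
      (solve 5 (λ t u v u′ v′ → u :* v′ :+ v :* u′ :+ t :* (v :* v′) :=
            u′ :* v :+ v′ :* u :+ t :* (v′ :* v)) refl (tr M) u v u′ v′))
    (M.sym (affine-⊗ M u′ v′ u v)))

  adj-affine : ∀ M u v → adj (affine M u v) ≋ affine M (u + tr M * v) (- v)
  adj-affine (mat a b c e) u v = mat≈
    (solve 4 (λ a e u v → u :+ v :* e := u :+ (a :+ e) :* v :+ (:- v) :* a) refl a e u v)
    (solve 2 (λ v b → :- (v :* b) := (:- v) :* b) refl v b)
    (solve 2 (λ v c → :- (v :* c) := (:- v) :* c) refl v c)
    (solve 4 (λ a e u v → u :+ v :* a := u :+ (a :+ e) :* v :+ (:- v) :* e) refl a e u v)

  affine-identity : ∀ M → M ≋ affine M 0# 1#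
  affine-identity (mat a b c e) = mat≈ (go a) (sym (*-identityˡ b)) (sym (*-identityˡ c)) (go e)
    where
    go : ∀ x → x ≈ 0# + 1# * x
    go x = trans (sym (*-identityˡ x)) (sym (+-identityˡ _))

  affine-I : ∀ M → I ≋ affine M 1# 0#
  affine-I (mat a b c e) = mat≈ (go a) (sym (zeroˡ b)) (sym (zeroˡ c)) (go e)
    where
    go : ∀ x → 1# ≈ 1# + 0# * x
    go x = trans (sym (+-identityʳ 1#)) (+-congˡ (sym (zeroˡ x)))

  affine-injective : ∀ M → ¬ Scalar M → ∀ {u v u′ v′} → affine M u v ≋ affine M u′ v′ → u ≈ u′ × v ≈ v′
  affine-injective (mat a b c e) ¬scalar {u} {v} {u′} {v′} (mat≈ p q r s) = u≈u′ , v≈v′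
    where
    v≈v′ : v ≈ v′
    v≈v′ with v - v′ ≟ 0#
    ... | yes eq = x∙y⁻¹≈ε⇒x≈y v v′ eq
    ... | no neq = contradiction
      (cancel neq (trans (solve 3 (λ v v′ b → (v :- v′) :* b :=
            v :* b :- v′ :* b) refl v v′ b) (x≈y⇒x∙y⁻¹≈ε q)) ,
       cancel neq (trans (solve 3 (λ v v′ c → (v :- v′) :* c :=
             v :* c :- v′ :* c) refl v v′ c) (x≈y⇒x∙y⁻¹≈ε r)) ,
       x∙y⁻¹≈ε⇒x≈y a e (cancel neq (trans
         (solve 6 (λ a e u v u′ v′ → (v :- v′) :* (a :- e) :=
               (u :+ v :* a :- (u′ :+ v′ :* a)) :- (u :+ v :* e :- (u′ :+ v′ :* e))) refl a e u v u′ v′)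
         (trans (+-cong (x≈y⇒x∙y⁻¹≈ε p) (-‿cong (x≈y⇒x∙y⁻¹≈ε s))) (-‿inverseʳ 0#)))))
      ¬scalar

    u≈u′ : u ≈ u′
    u≈u′ = x∙y⁻¹≈ε⇒x≈y u u′ (trans
      (solve 5 (λ a u v u′ v′ → u :- u′ :=
            (u :+ v :* a :- (u′ :+ v′ :* a)) :- (v :- v′) :* a) refl a u v u′ v′)
      (trans (+-cong (x≈y⇒x∙y⁻¹≈ε p) (-‿cong (trans (*-congʳ (x≈y⇒x∙y⁻¹≈ε v≈v′)) (zeroˡ a)))) (-‿inverseʳ 0#)))

  det-affine-0 : ∀ M {u v} → u ≈ 0# → v ≈ 0# → det (affine M u v) ≈ 0#
  det-affine-0 (mat a b c e) {u} {v} u≈0 v≈0 = +×-≈0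
    (solve 6 (λ a b c e u v → (u :+ v :* a) :* (u :+ v :* e) :- v :* b :* (v :* c) :=
      (u :+ v :* e :+ v :* a) :* u :+ (v :* (a :* e) :- v :* (b :* c)) :* v) refl a b c e u v)
    u≈0 v≈0

  -- The subgroup F[M]ˣ / Fˣ of PGL(2, q).
  module Polynomials (M : Matrix) where

    polynomials : Subgroup PGL[2, F ] (c ⊔ ℓ₁)
    polynomials = record
      { Member    = λ g → ∃[ u ] ∃[ v ] matrix g ≋ affine M u v
      ; resp      = λ {g} {h} g≈h (u , v , eq) → let s , _ , h≋ = ≈⇒proportional {g} {h} g≈h in
          s * u , s * v , M.trans h≋ (M.trans (•-cong s eq) (•-affine M s u v))
      ; ε-closed  = 1# , 0# , affine-I M
      ; ∙-closed  = λ (u , v , eq) (u′ , v′ , eq′) → _ , _ , M.trans (M.∙-cong eq eq′) (affine-⊗ M u v u′ v′)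
      ; ⁻¹-closed = λ {g} (u , v , eq) → let w , g⁻¹≋ = adj-≋ g in
          _ , _ , M.trans g⁻¹≋ (M.trans (•-cong w (M.trans (adj-cong eq) (adj-affine M u v))) (•-affine M w _ _))
      }
      where
      adj-cong : ∀ {N N′} → N ≋ N′ → adj N ≋ adj N′
      adj-cong (mat≈ p q r s) = mat≈ s (-‿cong q) (-‿cong r) p

    polynomialGroup : Group _ _
    polynomialGroup = subgroupGroup PGL[2, F ] polynomials

    private module P = Group polynomialGroup

    polynomials-comm : ∀ x y → x P.∙ y P.≈ y P.∙ x
    polynomials-comm x@(g , u , v , eq) y@(h , u′ , v′ , eq′) =
      proportional⇒≈ (g PGL.∙ h) (h PGL.∙ g) 1# (M.trans
        (M.trans (M.∙-cong eq′ eq) (M.trans (affine-comm M u′ v′ u v) (M.sym (M.∙-cong eq eq′))))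
        (•-one (matrix g ⊗ matrix h)))
      where
      •-one : ∀ N → N ≋ 1# • N
      •-one (mat a b c e) = mat≈ (sym (*-identityˡ a)) (sym (*-identityˡ b)) (sym (*-identityˡ c)) (sym (*-identityˡ e))

    Unit : Pred Point ℓ₁
    Unit i = ¬ det (affine M (px i) (py i)) ≈ 0#

    unit? : Decidable Unit
    unit? i = Dec.¬? (det (affine M (px i) (py i)) ≟ 0#)

    coefficients-nonZero : ∀ g {u v} → matrix g ≋ affine M u v → NonZero₂ u v
    coefficients-nonZero g eq (u≈0 , v≈0) = det≉0 g (trans (det-cong eq) (det-affine-0 M u≈0 v≈0))

    affine-point : ∀ {u v} → NonZero₂ u v →
                   ∃[ s ] ¬ s ≈ 0# × affine M u v ≋ s • affine M (px (point u v)) (py (point u v))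
    affine-point {u} {v} nz = let s , s≉0 , u≈ , v≈ = point-scale nz in
      s , s≉0 , M.trans (affine-cong M u≈ v≈) (M.sym (•-affine M s _ _))

    point-self : ∀ i → point (px i) (py i) ≡ i
    point-self i = point-unique (point-nonZero i) i (-‿inverseʳ _)

    module _ (¬scalar : ¬ Scalar M) where

      point-proportional : ∀ {g h u v u′ v′} → g PGL.≈ h → matrix g ≋ affine M u v → matrix h ≋ affine M u′ v′ →
                           point u v ≡ point u′ v′
      point-proportional {g} {h} {u} {v} {u′} {v′} g≈h eq eq′ =
        let s , _ , h≋ = ≈⇒proportional {g} {h} g≈h
            u′≈ , v′≈ = affine-injective M ¬scalar (M.trans (M.sym eq′) (M.trans h≋ (M.trans (•-cong s eq) (•-affine M s u v))))
        in point-cong (coefficients-nonZero g eq) (coefficients-nonZero h eq′)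
          (trans (+-cong (*-congˡ v′≈) (-‿cong (*-congʳ u′≈)))
            (solve 3 (λ s u v → u :* (s :* v) :- s :* u :* v := con (+ 0)) refl s u v))

      -- A unit of F[M] modulo scalars is a point of the projective line of F[M] with nonzero
      -- determinant. Linear independence of I and M makes this point well defined.
      polynomials-cardinality : HasCardinality P.setoid (count unit?)
      polynomials-cardinality = hasCardinality-count P.setoid unit?
        (λ i unit → fromMatrix (affine M (px i) (py i)) unit , px i , py i , M.refl)
        (λ (_ , u , v , _) → point u v)
        (λ { {g , _ , _ , eq} {h , _ , _ , eq′} g≈h → point-proportional {g} {h} g≈h eq eq′ })
        (λ (g , u , v , eq) det≈0 → let s , _ , u≋ = affine-point (coefficients-nonZero g eq) in
          det≉0 g (trans (det-cong (M.trans eq u≋)) (trans (det-• s _) (×-≈0 refl det≈0))))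
        (λ (g , u , v , eq) unit → let s , _ , u≋ = affine-point (coefficients-nonZero g eq) in
          proportional⇒≈ (fromMatrix _ unit) g s (M.trans eq u≋))
        (λ i unit → point-self i)

      power-units : ∀ g → matrix g ≋ M → power PGL.rawMonoid g (count unit?) PGL.≈ PGL.ε
      power-units g eq = ≡.subst (PGL._≈ PGL.ε) (power-subgroup PGL[2, F ] polynomials x (count unit?))
        (power-cardinality polynomialGroup polynomials-comm polynomials-cardinality x)
        where
        x : P.Carrier
        x = g , 0# , 1# , M.trans eq (affine-identity M)

    -- The point (1, 0) is always a unit. The point (x, -1) is x - M, which fails to be one exactly
    -- when x is a root.
    units+roots : count unit? ℕ.+ charRoots M ≡ suc q
    units+roots = ≡.trans (ℕ.+-assoc (indicator (unit? zero)) _ _) (≡.cong₂ ℕ._+_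
      {x = indicator (unit? zero)} {y = 1} (indicator-yes (unit? zero) (λ eq → 1≉0 (trans (sym det-one) eq)))
      (≡.trans (≡.sym (∑-distrib-+ (λ k → indicator (unit? (suc k))) (λ k → indicator (root? (tr M) (det M) k))))
        (≡.trans (sum-cong-≗ (λ k → complementary (unit? (suc k)) (root? (tr M) (det M) k)
            (λ unit root → unit (trans (sym (det-root M (enum k))) root))
            (λ ¬root det≈0 → ¬root (trans (det-root M (enum k)) det≈0))))
          (≡.trans (sum-const q 1) (ℕ.*-identityʳ q)))))
      where
      det-one : det (affine M 1# 0#) ≈ 1#
      det-one = trans (det-cong (M.sym (affine-I M))) det-I

      det-root : ∀ M x → quadratic (tr M) (det M) x ≈ det (affine M x (- 1#))
      det-root (mat a b c e) = solve 5 (λ a b c e x →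
        x :* x :- (a :+ e) :* x :+ (a :* e :- b :* c) :=
        (x :+ (:- con (+ 1)) :* a) :* (x :+ (:- con (+ 1)) :* e) :- (:- con (+ 1)) :* b :* ((:- con (+ 1)) :* c)) refl a b c e

      complementary : ∀ {a b} {A : Set a} {B : Set b} (A? : Dec A) (B? : Dec B) →
                      (A → ¬ B) → (¬ B → A) → indicator A? ℕ.+ indicator B? ≡ 1
      complementary (yes x) B? f g = ≡.cong suc (indicator-no B? (f x))
      complementary (no ¬x) (yes _) f g = ≡.refl
      complementary (no ¬x) (no ¬y) f g = contradiction (g ¬y) ¬x

  -- The set A in terms of trace and eigenvalues

  pow : PGL.Carrier → ℕ → PGL.Carrier
  pow = power PGL.rawMonoid

  G : Group _ _
  G = PGL[2, F ]

  matrix-square : ∀ g → matrix (pow g 2) ≋ matrix g ⊗ matrix g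
  matrix-square g = M.∙-congˡ {matrix g} (M.identityʳ (matrix g))

  -- By Cayley-Hamilton, M² and tr(M) M differ by a scalar; this also gives the converse for nonzero
  -- trace below.
  traceless⇒scalar-square : ∀ M → tr M ≈ 0# → Scalar (M ⊗ M)
  traceless⇒scalar-square (mat a b c e) tr≈0 =
    ×-≈0 (solve 3 (λ a b e → a :* b :+ b :* e := b :* (a :+ e)) refl a b e) tr≈0 ,
    ×-≈0 (solve 3 (λ a c e → c :* a :+ e :* c := c :* (a :+ e)) refl a c e) tr≈0 ,
    x∙y⁻¹≈ε⇒x≈y _ _ (×-≈0 (solve 4 (λ a b c e → a :* a :+ b :* c :- (c :* b :+ e :* e) :=
          (a :- e) :* (a :+ e)) refl a b c e) tr≈0)

  scalar-square⇒scalar : ∀ M → ¬ tr M ≈ 0# → Scalar (M ⊗ M) → Scalar M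
  scalar-square⇒scalar (mat a b c e) tr≉0 (p , q , r) =
    cancel tr≉0 (trans (solve 3 (λ a b e → (a :+ e) :* b := a :* b :+ b :* e) refl a b e) p) ,
    cancel tr≉0 (trans (solve 3 (λ a c e → (a :+ e) :* c := c :* a :+ e :* c) refl a c e) q) ,
    x∙y⁻¹≈ε⇒x≈y a e (cancel tr≉0 (trans
      (solve 4 (λ a b c e → (a :+ e) :* (a :- e) :=
            a :* a :+ b :* c :- (c :* b :+ e :* e)) refl a b c e) (x≈y⇒x∙y⁻¹≈ε r)))

  square≈ε⇒scalar-square : ∀ g → pow g 2 PGL.≈ PGL.ε → Scalar (matrix g ⊗ matrix g)
  square≈ε⇒scalar-square g eq = scalar-cong (matrix-square g) (≈ε⇒scalar (pow g 2) eq)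

  traceless⇒square≈ε : ∀ g → tr (matrix g) ≈ 0# → pow g 2 PGL.≈ PGL.ε
  traceless⇒square≈ε g tr≈0 = scalar⇒≈ε (pow g 2)
    (scalar-cong (M.sym (matrix-square g)) (traceless⇒scalar-square (matrix g) tr≈0))

  power-roots : ∀ g → ¬ Scalar (matrix g) → ∀ k m → charRoots (matrix g) ≡ k → suc q ≡ k ℕ.+ m → pow g m PGL.≈ PGL.ε
  power-roots g ¬scalar k m roots≡k eq = ≡.subst (λ n → pow g n PGL.≈ PGL.ε) units≡m
    (Polynomials.power-units (matrix g) ¬scalar g M.refl)
    where
    units≡m : count (Polynomials.unit? (matrix g)) ≡ m
    units≡m = ℕ.+-cancelʳ-≡ k _ m (≡.trans (≡.cong (count (Polynomials.unit? (matrix g)) ℕ.+_) (≡.sym roots≡k))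
      (≡.trans (Polynomials.units+roots (matrix g)) (≡.trans eq (ℕ.+-comm k m))))

  good⇒setA : ∀ g → Good (matrix g) → SetA G q g
  good⇒setA g (tr≉0 , roots≡0) =
    power-roots g ¬scalar 0 (suc q) roots≡0 ≡.refl ,
    λ eq → ¬scalar (scalar-square⇒scalar (matrix g) tr≉0 (square≈ε⇒scalar-square g eq))
    where
    ¬scalar : ¬ Scalar (matrix g)
    ¬scalar scalar = scalar⇒charRoots≢0 (matrix g) scalar roots≡0

  -- With one root the q-th power of g is trivial, and with the (q + 1)-st so is g. With two roots
  -- the exponents are q - 1 and q + 1, so g² is trivial. Both contradict the definition of A.
  setA⇒good : ∀ g → SetA G q g → Good (matrix g)
  setA⇒good g (gᵠ⁺¹≈ε , g²≉ε) = (λ tr≈0 → g²≉ε (traceless⇒square≈ε g tr≈0)) , go (roots-view _ _)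
    where
    ¬scalar : ¬ Scalar (matrix g)
    ¬scalar scalar = g²≉ε (≈ε⇒square≈ε G {g} (scalar⇒≈ε g scalar))

    two : ∀ n → suc n ≡ q → charRoots (matrix g) ≡ 2 → pow g 2 PGL.≈ PGL.ε
    two n ≡.refl eq = power-2-apart G {g} n (power-roots g ¬scalar 2 n eq ≡.refl) gᵠ⁺¹≈ε

    go : Roots (tr (matrix g)) (det (matrix g)) → charRoots (matrix g) ≡ 0
    go (none _ eq) = eq
    go (double _ _ _ eq) = contradiction (≈ε⇒square≈ε G {g}
      (power-consecutive G {g} q (power-roots g ¬scalar 1 q eq ≡.refl) gᵠ⁺¹≈ε)) g²≉ε
    go (simple _ _ _ _ _ eq) = contradiction (two (ℕ.pred q) (ℕ.suc-pred q ⦃ q≢0 ⦄) eq) g²≉ε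
      where
      q≢0 : ℕ.NonZero q
      q≢0 = Fin.nonZeroIndex (index 0#)

  -- Normal form of the generators of D

  •-rotation : ∀ t d s u v → s • rotation t d u v ≋ rotation t d (s * u) (s * v)
  •-rotation t d s u v = mat≈ refl
    (solve 3 (λ s d v → s :* (:- (d :* v)) := :- (d :* (s :* v))) refl s d v) refl
    (solve 4 (λ s t u v → s :* (u :+ t :* v) := s :* u :+ t :* (s :* v)) refl s t u v)

  •-reflection : ∀ t d s u v → s • reflection t d u v ≋ reflection t d (s * u) (s * v)
  •-reflection t d s u v = mat≈ refl
    (solve 5 (λ s t d u v → s :* (t :* u :+ d :* v) := t :* (s :* u) :+ d :* (s :* v)) refl s t d u v) refl
    (solve 2 (λ s u → s :* (:- u) := :- (s :* u)) refl s u)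

  rotation-⊗-reflection : ∀ t d a b u v →
    rotation t d a b ⊗ reflection t d u v ≋ reflection t d (a * u - d * b * v) (b * u + (a + t * b) * v)
  rotation-⊗-reflection t d a b u v = mat≈
    (solve 5 (λ d a b u v → a :* u :+ (:- (d :* b)) :* v := a :* u :- d :* b :* v) refl d a b u v)
    (solve 6 (λ t d a b u v → a :* (t :* u :+ d :* v) :+ (:- (d :* b)) :* (:- u) :=
      t :* (a :* u :- d :* b :* v) :+ d :* (b :* u :+ (a :+ t :* b) :* v)) refl t d a b u v)
    refl
    (solve 6 (λ t d a b u v → b :* (t :* u :+ d :* v) :+ (a :+ t :* b) :* (:- u) :=
          :- (a :* u :- d :* b :* v)) refl t d a b u v)

  det-rotation : ∀ t d u v → det (rotation t d u v) ≈ norm t d u v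
  det-rotation = solve 4 (λ t d u v → u :* (u :+ t :* v) :- (:- (d :* v)) :* v :=
        u :* u :+ t :* u :* v :+ d :* v :* v) refl

  det-reflection : ∀ t d u v → det (reflection t d u v) ≈ - norm t d u v
  det-reflection = solve 4 (λ t d u v → u :* (:- u) :- (t :* u :+ d :* v) :* v :=
        :- (u :* u :+ t :* u :* v :+ d :* v :* v)) refl

  index-≢ : ∀ {n} {i j : Fin n} → i ≢ j → 2 ℕ.≤ n
  index-≢ {1}           {zero} {zero} i≢j = contradiction ≡.refl i≢j
  index-≢ {suc (suc n)}               _   = ℕ.s≤s (ℕ.s≤s ℕ.z≤n)

  2≤q : 2 ℕ.≤ q
  2≤q = index-≢ {i = index 0#} {j = index 1#} λ eq → 1≉0
    (trans (sym (enum-index 1#)) (trans (reflexive (≡.cong enum (≡.sym eq))) (enum-index 0#)))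

  -- Invariance of the trace under conjugation, with `adj Y` in place of the inverse so that no
  -- division occurs.
  trace-adj : ∀ X Y → det Y * tr X ≈ tr ((Y ⊗ X) ⊗ adj Y)
  trace-adj (mat a b c e) (mat a′ b′ c′ e′) = solve 8 (λ a b c e a′ b′ c′ e′ →
    (a′ :* e′ :- b′ :* c′) :* (a :+ e) :=
    (a′ :* a :+ b′ :* c) :* e′ :+ (a′ :* b :+ b′ :* e) :* (:- c′) :+
    ((c′ :* a :+ e′ :* c) :* (:- b′) :+ (c′ :* b :+ e′ :* e) :* a′)) refl a b c e a′ b′ c′ e′

  trace-adj′ : ∀ s X Y → tr ((s • (adj X ⊗ Y)) ⊗ adj Y) ≈ det Y * (s * tr X)
  trace-adj′ s (mat a b c e) (mat a′ b′ c′ e′) = solve 9 (λ s a b c e a′ b′ c′ e′ →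
    s :* (e :* a′ :+ (:- b) :* c′) :* e′ :+ s :* (e :* b′ :+ (:- b) :* e′) :* (:- c′) :+
    (s :* ((:- c) :* a′ :+ a :* c′) :* (:- b′) :+ s :* ((:- c) :* b′ :+ a :* e′) :* a′) :=
    (a′ :* e′ :- b′ :* c′) :* (s :* (a :+ e))) refl s a b c e a′ b′ c′ e′

  module Generators (x y : PGL.Carrier)
    (distinct : ∀ {i j : Fin (suc q)} → pow x (Fin.toℕ i) PGL.≈ pow x (Fin.toℕ j) → i ≡ j)
    (yx≈x⁻¹y : y PGL.∙ x PGL.≈ x PGL.⁻¹ PGL.∙ y) where

    X Y : Matrix
    X = matrix x
    Y = matrix y

    open Mat₂ X renaming (m₁₁ to x₁; m₁₂ to x₂; m₂₁ to x₃; m₂₂ to x₄) using ()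
    open Mat₂ Y renaming (m₁₁ to y₁; m₁₂ to y₂; m₂₁ to y₃; m₂₂ to y₄) using ()

    private
      distinct-ℕ : ∀ {m n} (m< : m ℕ.< suc q) (n< : n ℕ.< suc q) → pow x m PGL.≈ pow x n → m ≡ n
      distinct-ℕ {m} {n} m< n< eq = ≡.trans (≡.sym (Fin.toℕ-fromℕ< m<)) (≡.trans (≡.cong Fin.toℕ
        (distinct (≡.subst₂ (λ m n → pow x m PGL.≈ pow x n) (≡.sym (Fin.toℕ-fromℕ< m<)) (≡.sym (Fin.toℕ-fromℕ< n<)) eq)))
        (Fin.toℕ-fromℕ< n<))

    ¬scalar : ¬ Scalar X
    ¬scalar scalar = contradiction (distinct-ℕ {1} {0} (ℕ.s≤s (ℕ.≤-trans (ℕ.s≤s ℕ.z≤n) 2≤q)) (ℕ.s≤s ℕ.z≤n)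
      (scalar⇒≈ε (pow x 1) (scalar-cong (M.sym (M.identityʳ X)) scalar))) λ ()

    -- Trace zero would make x² trivial, but x² and x⁰ are among the q + 1 > 2 distinct powers.
    tr≉0 : ¬ tr X ≈ 0#
    tr≉0 tr≈0 = contradiction (distinct-ℕ {2} {0} (ℕ.s≤s 2≤q) (ℕ.s≤s ℕ.z≤n) (traceless⇒square≈ε x tr≈0)) λ ()

    open Polynomials X

    power-polynomial : ∀ n → ∃[ u ] ∃[ v ] matrix (pow x n) ≋ affine X u v
    power-polynomial zero    = 1# , 0# , affine-I X
    power-polynomial (suc n) = let u , v , eq = power-polynomial n in
      _ , _ , M.trans (M.∙-cong (affine-identity X) eq) (affine-⊗ X 0# 1# u v)

    private
      power-point : Fin (suc q) → Point
      power-point i = let u , v , _ = power-polynomial (Fin.toℕ i) in point u v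

      power-≋ : ∀ i → ∃[ s ] ¬ s ≈ 0# × matrix (pow x (Fin.toℕ i)) ≋ s • affine X (px (power-point i)) (py (power-point i))
      power-≋ i = let _ , _ , eq = power-polynomial (Fin.toℕ i)
                      s , s≉0 , u≋ = affine-point (coefficients-nonZero (pow x (Fin.toℕ i)) eq)
                  in s , s≉0 , M.trans eq u≋

      power-point-injective : ∀ {i j} → power-point i ≡ power-point j → i ≡ j
      power-point-injective {i} {j} same =
        let s , s≉0 , i≋ = power-≋ i
            s′ , _ , j≋ = power-≋ j
            w , _ , N≋ = •-flip s≉0 i≋
        in distinct (proportional⇒≈ (pow x (Fin.toℕ i)) (pow x (Fin.toℕ j)) (s′ * w)
             (M.trans (≡.subst (λ k → matrix (pow x (Fin.toℕ j)) ≋ s′ • affine X (px k) (py k)) (≡.sym same) j≋)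
               (M.trans (•-cong s′ N≋) (•-• s′ w _))))

    affine-power : ∀ u v → NonZero₂ u v → ∃[ n ] ∃[ s ] ¬ s ≈ 0# × affine X u v ≋ s • matrix (pow x n)
    affine-power u v nz =
      let i , same = injective⇒surjective power-point-injective (point u v)
          s , s≉0 , u≋ = affine-point nz
          s′ , s′≉0 , i≋ = power-≋ i
          w , w≉0 , N≋ = •-flip s′≉0 i≋
      in Fin.toℕ i , s * w , *-≉0 s≉0 w≉0 ,
         M.trans (≡.subst (λ k → affine X u v ≋ s • affine X (px k) (py k)) (≡.sym same) u≋)
           (M.trans (•-cong s N≋) (•-• s w _))

    det-affine≉0 : ∀ u v → NonZero₂ u v → ¬ det (affine X u v) ≈ 0#
    det-affine≉0 u v nz eq =
      let n , s , s≉0 , u≋ = affine-power u v nz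
      in det≉0 (pow x n) (cancel s≉0 (cancel s≉0 (trans (sym (*-assoc s s _)) (trans (sym (det-• s _)) (trans (det-cong (M.sym u≋)) eq)))))

    -- X - x₁ has determinant -x₂x₃, and as a nonzero element of F[X] it is invertible.
    x₃≉0 : ¬ x₃ ≈ 0#
    x₃≉0 x₃≈0 = det-affine≉0 (- x₁) 1# (λ (_ , 1≈0) → 1≉0 1≈0) (×-≈0
      (solve 4 (λ a b c e → ((:- a) :+ con (+ 1) :* a) :* ((:- a) :+ con (+ 1) :* e) :- con (+ 1) :* b :* (con (+ 1) :* c) :=
            (:- b) :* c) refl x₁ x₂ x₃ x₄)
      x₃≈0)

    w : Carrier
    w = proj₁ (inverse x₃≉0)

    x₃w≈1 : x₃ * w ≈ 1#
    x₃w≈1 = proj₂ (inverse x₃≉0)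

    w≉0 : ¬ w ≈ 0#
    w≉0 = factor-≉0 (trans (*-comm w x₃) x₃w≈1)

    -- The trace and determinant of (X − x₁) / x₃, whose first column is (0, 1).
    t d : Carrier
    t = (x₄ - x₁) * w
    d = - (x₂ * w)

    absorb : ∀ z → z * (x₃ * w) ≈ z
    absorb z = trans (*-congˡ x₃w≈1) (*-identityʳ z)

    -- X′ = (X - x₁)/x₃ is itself the matrix ( 0 -d ; 1 t ), so passing between X and X′ only
    -- substitutes coefficients and changes no basis.
    rotation-affine : ∀ u v → rotation t d u v ≋ affine X (u - v * w * x₁) (v * w)
    rotation-affine u v = mat≈
      (solve 4 (λ u v w a → u := u :- v :* w :* a :+ v :* w :* a) refl u v w x₁)
      (solve 3 (λ v w b → :- ((:- (b :* w)) :* v) := v :* w :* b) refl v w x₂)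
      (trans (sym (absorb v)) (solve 3 (λ v w c → v :* (c :* w) := v :* w :* c) refl v w x₃))
      (solve 5 (λ u v w a e → u :+ (e :- a) :* w :* v := u :- v :* w :* a :+ v :* w :* e) refl u v w x₁ x₄)

    affine-rotation : ∀ u v → affine X u v ≋ rotation t d (u + v * x₁) (v * x₃)
    affine-rotation u v = mat≈ refl
      (trans (sym (absorb (v * x₂))) (solve 4 (λ v w b c → v :* b :* (c :* w) :=
            :- ((:- (b :* w)) :* (v :* c))) refl v w x₂ x₃))
      refl
      (trans (+-congˡ (sym (absorb (v * x₄)))) (trans
        (solve 6 (λ u v w a c e → u :+ v :* e :* (c :* w) :=
              u :+ v :* a :* (c :* w) :+ (e :- a) :* w :* (v :* c)) refl u v w x₁ x₃ x₄)
        (+-congʳ (+-congˡ (absorb (v * x₁))))))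

    private
      affine-nonZero : ∀ {u v} → NonZero₂ u v → NonZero₂ (u - v * w * x₁) (v * w)
      affine-nonZero {u} {v} nz (u≈ , vw≈0) = nz (
        trans (solve 4 (λ u v w a → u := (u :- v :* w :* a) :+ v :* w :* a) refl u v w x₁)
          (trans (+-cong u≈ (trans (*-congʳ vw≈0) (zeroˡ x₁))) (+-identityˡ 0#)) ,
        cancel w≉0 (trans (*-comm w v) vw≈0))

    norm≉0 : ∀ u v → NonZero₂ u v → ¬ norm t d u v ≈ 0#
    norm≉0 u v nz eq = det-affine≉0 _ _ (affine-nonZero nz)
      (trans (det-cong (M.sym (rotation-affine u v))) (trans (det-rotation t d u v) eq))

    no-root : ∀ z → ¬ quadratic t d z ≈ 0#
    no-root z eq = norm≉0 z (- 1#) (λ (_ , -1≈0) → -1≉0 -1≈0) (trans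
      (solve 3 (λ t d z → z :* z :+ t :* z :* (:- con (+ 1)) :+ d :* (:- con (+ 1)) :* (:- con (+ 1)) :=
            z :* z :- t :* z :+ d) refl t d z) eq)

    -- disc = −N(2X′ − t) for X′ = (X − x₁) / x₃; in characteristic 2 the trace t does not vanish.
    disc≉0 : ¬ disc t d ≈ 0#
    disc≉0 eq = norm≉0 (- t) 2# nz (trans
      (solve 2 (λ t d → (:- t) :* (:- t) :+ t :* (:- t) :* con (+ 2) :+ d :* con (+ 2) :* con (+ 2) :=
            :- (t :* t :- con (+ 2) :* con (+ 2) :* d)) refl t d)
      (trans (-‿cong eq) -0#≈0#))
      where
      nz : NonZero₂ (- t) 2#
      nz (-t≈0 , 2≈0) = tr≉0 (+×-≈0
        (solve 2 (λ a e → a :+ e := con (+ 1) :* (e :- a) :+ a :* con (+ 2)) refl x₁ x₄)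
        (cancel w≉0 (trans (solve 3 (λ w a e → w :* (e :- a) :=
              :- (:- ((e :- a) :* w))) refl w x₁ x₄) (trans (-‿cong -t≈0) -0#≈0#)))
        2≈0)

    private
      commutation : ∃[ s ] Y ⊗ X ≋ s • (adj X ⊗ Y)
      commutation =
        let s , _ , eq = ≈⇒proportional {x PGL.⁻¹ PGL.∙ y} {y PGL.∙ x} (PGL.sym {y PGL.∙ x} {x PGL.⁻¹ PGL.∙ y} yx≈x⁻¹y)
            r , adj≋ = adj-≋ x
        in s * r , M.trans eq (M.trans (•-cong s (M.trans (M.∙-congʳ {Y} adj≋) (•-⊗ r (adj X) Y))) (•-• s r _))

      -- In PGL the relation holds up to a factor s. Conjugating by Y and taking traces gives tr X =
      -- s tr(adj X) = s tr X, and tr X is nonzero.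
      s≈1 : proj₁ commutation ≈ 1#
      s≈1 = sym (cancel-≈ tr≉0 (trans (*-identityʳ (tr X)) (trans
        (cancel-≈ (det≉0 y) (trans (trace-adj X Y) (trans (tr-cong (M.∙-congʳ {adj Y} (proj₂ commutation))) (trace-adj′ (proj₁ commutation) X Y))))
        (*-comm _ (tr X)))))

      YX≋ : Y ⊗ X ≋ adj X ⊗ Y
      YX≋ = M.trans (proj₂ commutation) (one• (adj X ⊗ Y))
        where
        one• : ∀ N → proj₁ commutation • N ≋ N
        one• (mat a b c e) = mat≈ (go a) (go b) (go c) (go e)
          where
          go : ∀ z → proj₁ commutation * z ≈ z
          go z = trans (*-congʳ s≈1) (*-identityˡ z)

    -- The first column of YX = adj(X) Y expresses the second column of Y through its first.
    Y≋reflection : Y ≋ reflection t d y₁ y₃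
    Y≋reflection = mat≈ refl y₂≈ refl y₄≈
      where
      y₂≈ : y₂ ≈ t * y₁ + d * y₃
      y₂≈ = trans (sym (absorb y₂)) (x∙y⁻¹≈ε⇒x≈y _ _ (×-≈0
        (solve 8 (λ a b c e w y₁ y₂ y₃ →
          y₂ :* (c :* w) :- ((e :- a) :* w :* y₁ :+ (:- (b :* w)) :* y₃) :=
          w :* ((y₁ :* a :+ y₂ :* c) :- (e :* y₁ :+ (:- b) :* y₃))) refl x₁ x₂ x₃ x₄ w y₁ y₂ y₃)
        (x≈y⇒x∙y⁻¹≈ε (_≈ᴹ_.eq₁₁ YX≋))))

      y₄≈ : y₄ ≈ - y₁
      y₄≈ = x∙y⁻¹≈ε⇒x≈y _ _ (cancel x₃≉0 (trans
        (solve 5 (λ a c y₁ y₃ y₄ → c :* (y₄ :- (:- y₁)) :=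
              (y₃ :* a :+ y₄ :* c) :- ((:- c) :* y₁ :+ a :* y₃)) refl x₁ x₃ y₁ y₃ y₄)
        (x≈y⇒x∙y⁻¹≈ε (_≈ᴹ_.eq₂₁ YX≋))))

    private
      N : Carrier
      N = norm t d y₁ y₃

      N≉0 : ¬ N ≈ 0#
      N≉0 eq = det≉0 y (trans (det-cong Y≋reflection) (trans (det-reflection t d y₁ y₃) (trans (-‿cong eq) -0#≈0#)))

    IsRotation IsReflection : PGL.Carrier → Set _
    IsRotation   g = ∃[ u ] ∃[ v ] matrix g ≋ rotation t d u v
    IsReflection g = ∃[ u ] ∃[ v ] matrix g ≋ reflection t d u v

    power⇒rotation : ∀ n g → pow x n PGL.≈ g → IsRotation g
    power⇒rotation n g eq =
      let s , _ , g≋ = ≈⇒proportional {pow x n} {g} eq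
          u , v , n≋ = power-polynomial n
      in _ , _ , M.trans g≋ (M.trans (•-cong s (M.trans n≋ (affine-rotation u v))) (•-rotation t d s _ _))

    power∙y⇒reflection : ∀ n g → pow x n PGL.∙ y PGL.≈ g → IsReflection g
    power∙y⇒reflection n g eq =
      let s , _ , g≋ = ≈⇒proportional {pow x n PGL.∙ y} {g} eq
          u , v , n≋ = power-polynomial n
      in _ , _ , M.trans g≋ (M.trans (•-cong s (M.trans (M.∙-cong (M.trans n≋ (affine-rotation u v)) Y≋reflection)
           (rotation-⊗-reflection t d _ _ y₁ y₃))) (•-reflection t d s _ _))

    rotation⇒power : ∀ g {u v} → NonZero₂ u v → matrix g ≋ rotation t d u v → ∃[ n ] pow x n PGL.≈ g
    rotation⇒power g {u} {v} nz g≋ =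
      let n , s , _ , eq = affine-power _ _ (affine-nonZero nz)
      in n , proportional⇒≈ (pow x n) g s (M.trans g≋ (M.trans (rotation-affine u v) eq))

    -- Y is (y₁ + y₃X′) times the standard reflection ( 1 t ; 0 -1 ), so the power sought is (u +
    -- vX′)/(y₁ + y₃X′), computed as a product with the conjugate divided by the norm `N`.
    reflection⇒power∙y : ∀ g {u v} → NonZero₂ u v → matrix g ≋ reflection t d u v → ∃[ n ] pow x n PGL.∙ y PGL.≈ g
    reflection⇒power∙y g {u} {v} nz g≋ =
      let n , s , _ , eq = affine-power _ _ (affine-nonZero ab-nonZero)
          N⁻¹ , NN⁻¹≈1 = inverse N≉0
      in n , proportional⇒≈ (pow x n PGL.∙ y) g (N⁻¹ * s) (M.trans g≋ (M.trans
           (•-assoc (trans (*-comm N⁻¹ N) NN⁻¹≈1) (reflection t d u v)) (M.trans (•-cong N⁻¹ (M.trans (M.sym quotient)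
             (M.trans (M.∙-congʳ {Y} (M.trans (rotation-affine a b) eq)) (•-⊗ s (matrix (pow x n)) Y)))) (•-• N⁻¹ s _))))
      where
      -- (u + vX′) times the conjugate of y₁ + y₃X′
      a b : Carrier
      a = u * (y₁ + t * y₃) + d * v * y₃
      b = v * y₁ - u * y₃

      first : a * y₁ - d * b * y₃ ≈ N * u
      first = solve 6 (λ t d u v y₁ y₃ →
        (u :* (y₁ :+ t :* y₃) :+ d :* v :* y₃) :* y₁ :- d :* (v :* y₁ :- u :* y₃) :* y₃ :=
        (y₁ :* y₁ :+ t :* y₁ :* y₃ :+ d :* y₃ :* y₃) :* u) refl t d u v y₁ y₃

      second : b * y₁ + (a + t * b) * y₃ ≈ N * v
      second = solve 6 (λ t d u v y₁ y₃ →
        (v :* y₁ :- u :* y₃) :* y₁ :+ ((u :* (y₁ :+ t :* y₃) :+ d :* v :* y₃) :+ t :* (v :* y₁ :- u :* y₃)) :* y₃ :=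
        (y₁ :* y₁ :+ t :* y₁ :* y₃ :+ d :* y₃ :* y₃) :* v) refl t d u v y₁ y₃

      quotient : rotation t d a b ⊗ Y ≋ N • reflection t d u v
      quotient = M.trans (M.∙-congˡ {rotation t d a b} Y≋reflection) (M.trans (rotation-⊗-reflection t d a b y₁ y₃)
        (M.trans (mat≈ first (+-cong (*-congˡ first) (*-congˡ second)) second (-‿cong first)) (M.sym (•-reflection t d N u v))))

      ab-nonZero : NonZero₂ a b
      ab-nonZero (a≈0 , b≈0) = nz
        ( cancel N≉0 (trans (sym first) (+×-≈0 (solve 5 (λ a b d y₁ y₃ → a :* y₁ :- d :* b :* y₃ :=
              y₁ :* a :+ (:- (d :* y₃)) :* b) refl a b d y₁ y₃) a≈0 b≈0))
        , cancel N≉0 (trans (sym second) (+×-≈0 (solve 5 (λ a b t y₁ y₃ → b :* y₁ :+ (a :+ t :* b) :* y₃ :=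
              y₃ :* a :+ (y₁ :+ t :* y₃) :* b) refl a b t y₁ y₃) a≈0 b≈0)) )

  -- Parity of q and the characteristic

  open SemiringMult semiring using (×1-homo-*) renaming (_×_ to _·ⁿ_)

  q·1≈0 : q ·ⁿ 1# ≈ 0#
  q·1≈0 = power-cardinality +-group +-comm cardinality 1#

  private
    2·1≈2# : 2 ·ⁿ 1# ≈ 2#
    2·1≈2# = +-congˡ (+-identityʳ 1#)

    2^k·1≈0 : ∀ k → (2 ℕ.^ k) ·ⁿ 1# ≈ 0# → 2# ≈ 0#
    2^k·1≈0 zero    eq = contradiction (trans (sym (+-identityʳ 1#)) eq) 1≉0
    2^k·1≈0 (suc k) eq with 2# ≟ 0#
    ... | yes 2≈0 = 2≈0
    ... | no 2≉0  = 2^k·1≈0 k (cancel 2≉0 (trans (*-congʳ (sym 2·1≈2#)) (trans (sym (×1-homo-* 2 (2 ℕ.^ k))) eq)))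

  -- The prime below q must be 2, and the factors 2 of 2ᵏ · 1 = q · 1 = 0 can be cancelled one by
  -- one unless 2 = 0.
  even : IsPrimePower q → 2 ∣ q → 2# ≈ 0#
  even (p , k , p-prime , _ , q≡) 2∣q = 2^k·1≈0 k (≡.subst (λ n → n ·ⁿ 1# ≈ 0#)
    (≡.trans q≡ (≡.cong (ℕ._^ k) (2∣p^k⇒p≡2 k p-prime (≡.subst (2 ∣_) q≡ 2∣q)))) q·1≈0)

  -- For q = 2m + 1 and 2 = 0, the relation q · 1 = 0 would read 1 = 0.
  odd : ¬ 2 ∣ q → ¬ 2# ≈ 0#
  odd 2∤q 2≈0 with q divMod 2
  ... | result m zero       q≡ = 2∤q (divides m q≡)
  ... | result m (suc zero) q≡ = 1≉0 (trans (sym (+-identityʳ 1#)) (trans (+-congˡ (sym m·2≈0))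
          (trans (reflexive (≡.cong (_·ⁿ 1#) (≡.sym q≡))) q·1≈0)))
    where
    m·2≈0 : (m ℕ.* 2) ·ⁿ 1# ≈ 0#
    m·2≈0 = trans (×1-homo-* m 2) (×-≈0 refl (trans 2·1≈2# 2≈0))

  -- Enumeration of D and the count in a coset

  module DihedralCover {p} (D : Subgroup PGL[2, F ] p)
    (iso : Isomorphic (Dihedral (suc q)) (subgroupGroup PGL[2, F ] D))
    (card : HasCardinality (Group.setoid (subgroupGroup PGL[2, F ] D)) (2 ℕ.* suc q)) where

    private module D = DihedralSubgroup PGL[2, F ] D q iso card
    open Subgroup D using (resp; ∙-closed)
    open Generators D.x D.y D.powers-distinct D.yx≈x⁻¹y using
      (t; d; no-root; disc≉0; norm≉0; power⇒rotation; power∙y⇒reflection; rotation⇒power; reflection⇒power∙y)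

    element : Point ⊎ Point → PGL.Carrier
    element (inj₁ i) = fromMatrix (rotation t d (px i) (py i))
      (λ eq → norm≉0 _ _ (point-nonZero i) (trans (sym (det-rotation t d _ _)) eq))
    element (inj₂ i) = fromMatrix (reflection t d (px i) (py i))
      (λ eq → norm≉0 _ _ (point-nonZero i) (trans (sym (-‿involutive _)) (trans (-‿cong (trans (sym (det-reflection t d _ _)) eq)) -0#≈0#)))

    element∈D : ∀ k → Subgroup.Member D (element k)
    element∈D (inj₁ i) = let n , eq = rotation⇒power (element (inj₁ i)) (point-nonZero i) M.refl in resp eq (D.power∈D n)
    element∈D (inj₂ i) = let n , eq = reflection⇒power∙y (element (inj₂ i)) (point-nonZero i) M.refl in
      resp eq (∙-closed (D.power∈D n) D.y∈D)

    private
      norm-zero : ∀ {u v} → u ≈ 0# → v ≈ 0# → norm t d u v ≈ 0#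
      norm-zero {u} {v} u≈0 v≈0 = +×-≈0
        (solve 4 (λ t d u v → u :* u :+ t :* u :* v :+ d :* v :* v :=
              (u :+ t :* v) :* u :+ (d :* v) :* v) refl t d u v) u≈0 v≈0

      rotation-nonZero : ∀ g {u v} → matrix g ≋ rotation t d u v → NonZero₂ u v
      rotation-nonZero g eq (u≈0 , v≈0) = det≉0 g (trans (det-cong eq) (trans (det-rotation t d _ _) (norm-zero u≈0 v≈0)))

      reflection-nonZero : ∀ g {u v} → matrix g ≋ reflection t d u v → NonZero₂ u v
      reflection-nonZero g eq (u≈0 , v≈0) = det≉0 g (trans (det-cong eq)
        (trans (det-reflection t d _ _) (trans (-‿cong (norm-zero u≈0 v≈0)) -0#≈0#)))

      rotation-cong : ∀ {u u′ v v′} → u ≈ u′ → v ≈ v′ → rotation t d u v ≋ rotation t d u′ v′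
      rotation-cong u≈ v≈ = mat≈ u≈ (-‿cong (*-congˡ v≈)) v≈ (+-cong u≈ (*-congˡ v≈))

      reflection-cong : ∀ {u u′ v v′} → u ≈ u′ → v ≈ v′ → reflection t d u v ≋ reflection t d u′ v′
      reflection-cong u≈ v≈ = mat≈ u≈ (+-cong (*-congˡ u≈) (*-congˡ v≈)) v≈ (-‿cong u≈)

    element-surjective : ∀ {g} → Subgroup.Member D g → ∃[ k ] element k PGL.≈ g
    element-surjective {g} g∈D = go (D.members g∈D)
      where
      go : ∃[ n ] (pow D.x n PGL.≈ g ⊎ pow D.x n PGL.∙ D.y PGL.≈ g) → ∃[ k ] element k PGL.≈ g
      go (n , inj₁ eq) =
        let u , v , g≋ = power⇒rotation n g eq
            s , _ , u≈ , v≈ = point-scale (rotation-nonZero g g≋)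
        in inj₁ (point u v) , proportional⇒≈ (element (inj₁ (point u v))) g s
             (M.trans g≋ (M.trans (rotation-cong u≈ v≈) (M.sym (•-rotation t d s _ _))))
      go (n , inj₂ eq) =
        let u , v , g≋ = power∙y⇒reflection n g eq
            s , _ , u≈ , v≈ = point-scale (reflection-nonZero g g≋)
        in inj₂ (point u v) , proportional⇒≈ (element (inj₂ (point u v))) g s
             (M.trans g≋ (M.trans (reflection-cong u≈ v≈) (M.sym (•-reflection t d s _ _))))

    private
      same-point : ∀ {i j s} → px j ≈ s * px i → py j ≈ s * py i → i ≡ j
      same-point {i} {j} {s} x≈ y≈ = points-≡ i j (trans (+-cong (*-congˡ y≈) (-‿cong (*-congʳ x≈)))
        (solve 3 (λ s x y → x :* (s :* y) :- s :* x :* y := con (+ 0)) refl s (px i) (py i)))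

      -- Comparing second columns gives two linear equations for the point (u, v), namely tu + 2dv =
      -- 0 and 2u + tv = 0 up to a nonzero factor. Their determinant is the nonzero discriminant t²
      -- - 4d.
      rotation≉reflection : ∀ i j → ¬ element (inj₁ i) PGL.≈ element (inj₂ j)
      rotation≉reflection i j eq =
        let s , s≉0 , mat≈ u≈ e₁₂ v≈ e₂₂ = ≈⇒proportional {element (inj₁ i)} {element (inj₂ j)} eq
            u = px i
            v = py i
            E₁ : t * (s * u) + d * (s * v) - s * - (d * v) ≈ 0#
            E₁ = x≈y⇒x∙y⁻¹≈ε (trans (sym (+-cong (*-congˡ u≈) (*-congˡ v≈))) e₁₂)
            E₂ : - (s * u) - s * (u + t * v) ≈ 0#
            E₂ = x≈y⇒x∙y⁻¹≈ε (trans (sym (-‿cong u≈)) e₂₂)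
        in point-nonZero i
          ( cancel disc≉0 (cancel s≉0 (+×-≈0 (solve 5 (λ t d s u v →
              s :* ((t :* t :- con (+ 2) :* con (+ 2) :* d) :* u) :=
              t :* (t :* (s :* u) :+ d :* (s :* v) :- s :* (:- (d :* v))) :+ (con (+ 2) :* d) :* ((:- (s :* u)) :- s :* (u :+ t :* v))) refl t d s u v) E₁ E₂))
          , cancel disc≉0 (cancel s≉0 (+×-≈0 (solve 5 (λ t d s u v →
              s :* ((t :* t :- con (+ 2) :* con (+ 2) :* d) :* v) :=
              (:- con (+ 2)) :* (t :* (s :* u) :+ d :* (s :* v) :- s :* (:- (d :* v))) :+ (:- t) :* ((:- (s :* u)) :- s :* (u :+ t :* v))) refl t d s u v) E₁ E₂)) )

    element-injective : ∀ j k → element j PGL.≈ element k → j ≡ k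
    element-injective (inj₁ i) (inj₁ j) eq =
      let s , _ , mat≈ x≈ _ y≈ _ = ≈⇒proportional {element (inj₁ i)} {element (inj₁ j)} eq in ≡.cong inj₁ (same-point x≈ y≈)
    element-injective (inj₂ i) (inj₂ j) eq =
      let s , _ , mat≈ x≈ _ y≈ _ = ≈⇒proportional {element (inj₂ i)} {element (inj₂ j)} eq in ≡.cong inj₂ (same-point x≈ y≈)
    element-injective (inj₁ i) (inj₂ j) eq = contradiction eq (rotation≉reflection i j)
    element-injective (inj₂ i) (inj₁ j) eq =
      contradiction (PGL.sym {element (inj₂ i)} {element (inj₁ j)} eq) (rotation≉reflection j i)

    elements : Fin (suc q ℕ.+ suc q) → PGL.Carrier
    elements k = element (Fin.splitAt (suc q) k)

    elements∈D : ∀ k → Subgroup.Member D (elements k)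
    elements∈D k = element∈D (Fin.splitAt (suc q) k)

    elements-surjective : ∀ {g} → Subgroup.Member D g → ∃[ k ] elements k PGL.≈ g
    elements-surjective {g} g∈D = let k , eq = element-surjective {g} g∈D in
      Fin.join (suc q) (suc q) k , ≡.subst (λ s → element s PGL.≈ g) (≡.sym (Fin.splitAt-join (suc q) (suc q) k)) eq

    elements-injective : ∀ {j k} → elements j PGL.≈ elements k → j ≡ k
    elements-injective eq = splitAt-injective (suc q) (element-injective _ _ eq)

    good-cong : ∀ {M N} → M ≋ N → Good M → Good N
    good-cong M≋N (tr≉0 , roots≡0) =
      (λ eq → tr≉0 (trans (tr-cong M≋N) eq)) , ≡.trans (≡.sym (roots-cong (tr-cong M≋N) (det-cong M≋N))) roots≡0

    module Coset (g : PGL.Carrier) where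

      open Mat₂ (matrix g) renaming (m₁₁ to a; m₁₂ to b; m₂₁ to c′; m₂₂ to e)
      open Cosets t d no-root disc≉0 a b c′ e (det≉0 g)

      member : Point ⊎ Point → Matrix
      member (inj₁ i) = combination rotations rotations′ (px i) (py i)
      member (inj₂ i) = combination reflections reflections′ (px i) (py i)

      member-≋ : ∀ k → matrix (g PGL.∙ element k) ≋ member k
      member-≋ (inj₁ i) = mat≈ (l a b) (r a b) (l c′ e) (r c′ e)
        where
        l : ∀ z z′ → z * px i + z′ * py i ≈ px i * z + py i * z′
        l = solve 4 (λ u v z z′ → z :* u :+ z′ :* v := u :* z :+ v :* z′) refl (px i) (py i)
        r : ∀ z z′ → z * - (d * py i) + z′ * (px i + t * py i) ≈ px i * z′ + py i * (- (d * z) + t * z′)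
        r = solve 6 (λ t d u v z z′ → z :* (:- (d :* v)) :+ z′ :* (u :+ t :* v) :=
              u :* z′ :+ v :* (:- (d :* z) :+ t :* z′)) refl t d (px i) (py i)
      member-≋ (inj₂ i) = mat≈ (l a b) (r a b) (l c′ e) (r c′ e)
        where
        l : ∀ z z′ → z * px i + z′ * py i ≈ px i * z + py i * z′
        l = solve 4 (λ u v z z′ → z :* u :+ z′ :* v := u :* z :+ v :* z′) refl (px i) (py i)
        r : ∀ z z′ → z * (t * px i + d * py i) + z′ * - px i ≈ px i * (t * z - z′) + py i * (d * z)
        r = solve 6 (λ t d u v z z′ → z :* (t :* u :+ d :* v) :+ z′ :* (:- u) :=
              u :* (t :* z :- z′) :+ v :* (d :* z)) refl t d (px i) (py i)

      GoodIndex : Pred (Fin (suc q ℕ.+ suc q)) ℓ₁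
      GoodIndex k = Good (member (Fin.splitAt (suc q) k))

      goodIndex? : Decidable GoodIndex
      goodIndex? k = good? (member (Fin.splitAt (suc q) k))

      count-good : count goodIndex? ≡ Rot.goods ℕ.+ Refl.goods
      count-good = ≡.trans (sum-++ (suc q) (λ k → indicator (goodIndex? k))) (≡.cong₂ ℕ._+_
        (sum-cong-≗ (λ i → ≡.cong (λ s → indicator (good? (member s))) (Fin.splitAt-↑ˡ (suc q) i (suc q))))
        (sum-cong-≗ (λ i → ≡.cong (λ s → indicator (good? (member s))) (Fin.splitAt-↑ʳ (suc q) (suc q) i))))

      good⇒∈A : ∀ k → GoodIndex k → SetA PGL[2, F ] q (g PGL.∙ elements k)
      good⇒∈A k good = good⇒setA (g PGL.∙ elements k) (good-cong (M.sym (member-≋ (Fin.splitAt (suc q) k))) good)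

      ∈A⇒good : ∀ k → SetA PGL[2, F ] q (g PGL.∙ elements k) → GoodIndex k
      ∈A⇒good k a∈A = good-cong (member-≋ (Fin.splitAt (suc q) k)) (setA⇒good (g PGL.∙ elements k) a∈A)

      count-odd : ¬ 2# ≈ 0# → count goodIndex? ≡ q ℕ.∸ 1
      count-odd 2≉0 = ≡.trans count-good (goods-odd 2≉0)

      count-even : 2# ≈ 0# → count goodIndex? ≡ q
      count-even 2≈0 = ≡.trans count-good (goods-even 2≈0)

    covers : ∀ {n} → (∀ g → count (Coset.goodIndex? g) ≡ n) → CoversExactly PGL[2, F ] (SetA PGL[2, F ] q) (Subgroup.Member D) n
    covers = coversExactly-subgroup PGL[2, F ] D {A = SetA PGL[2, F ] q}
      (λ {x} {y} → setA-resp PGL[2, F ] q {x} {y}) elements elements∈D elements-surjective elements-injective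
      {P = Coset.GoodIndex} Coset.goodIndex? Coset.good⇒∈A Coset.∈A⇒good

open import Data.Nat.Base using (_*_; _+_; _∸_)

theorem1p1 : ∀ {c ℓ₁ ℓ₂ p} (q : ℕ) → IsPrimePower q →
    (F : FiniteField c ℓ₁ ℓ₂ q) →
    let G = PGL[2, F ] in
    (D : Subgroup G p) →
    Isomorphic (Dihedral (q + 1)) (subgroupGroup G D) →
    HasCardinality (Group.setoid (subgroupGroup G D)) (2 * (q + 1)) →
    let A = SetA G q in
    ( 2 ∣ q → CoversExactly G A (Subgroup.Member D) q) ×
    (¬ 2 ∣ q → CoversExactly G A (Subgroup.Member D) (q ∸ 1))
theorem1p1 q q-primePower F D iso card =
  (λ 2∣q → Cover.covers (λ g → Cover.Coset.count-even g (even q-primePower 2∣q))) ,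
  (λ 2∤q → Cover.covers (λ g → Cover.Coset.count-odd g (odd 2∤q)))
  where
  open OverFiniteField F using (even; odd; module DihedralCover)
  module Cover = DihedralCover D
    (≡.subst (λ n → Isomorphic (Dihedral n) (subgroupGroup PGL[2, F ] D)) (ℕ.+-comm q 1) iso)
    (≡.subst (λ n → HasCardinality (Group.setoid (subgroupGroup PGL[2, F ] D)) (2 * n)) (ℕ.+-comm q 1) card)
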